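{- Let $G$ be a finite simple graph on $n$ vertices, let $\mathbf z$ be an eigenvector of its adjacency matrix $A(G)$ corresponding to $\lambda_2(G)$, and let $V_+=\{w\in V(G):\mathbf z_w>0\}$ and $V_-=\{w\in V(G):\mathbf z_w<0\}$. Suppose that $u\in V_+$, $v\in V_-$ and $uv$ is an edge of $G$. Then $\lambda_2(G-uv)>\lambda_2(G)$.
   Context: For a graph $G$ on $n$ vertices, $\lambda_1(G)\ge\lambda_2(G)\ge\cdots\ge\lambda_n(G)$ are the eigenvalues of its adjacency matrix $A(G)$, listed with multiplicity. $G-uv$ denotes the graph obtained from $G$ by deleting the edge $uv$ (keeping all vertices). -}

module Defs where

open import Algebra.Bundles using (RawRing)
import Algebra.Definitions.RawSemiring as RawSemiringDefinitions
open import Data.Bool.Base using (if_then_else_)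
open import Data.Fin.Base as Fin using (Fin; toℕ; punchIn)
import Data.Fin.Properties as Fin
open import Data.Nat.Base as ℕ using (ℕ; zero; suc; _⊔_)
import Data.Nat.Properties as ℕ
open import Data.Product.Base using (∃; _×_; _,_)
open import Data.Rational.Base as ℚ using (ℚ; 0ℚ; 1ℚ; ½; 1/_; ∣_∣)
import Data.Rational.Properties as ℚ
open import Data.Rational.Solver using (module +-*-Solver)
open import Data.Sum.Base using (_⊎_; inj₁; inj₂)
open import Data.Vec.Functional using (Vector)
open import Level using (0ℓ)
open import Relation.Binary.Core using (Rel)
open import Relation.Binary.Definitions using (Decidable; Symmetric)
open import Relation.Binary.PropositionalEquality
  using (_≡_; refl; sym; trans; cong; cong₂; subst)
open import Relation.Nullary using (¬_; Dec; does)
open import Relation.Nullary.Decidable using (_×-dec_; _⊎-dec_; ¬?)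
open import Relation.Unary using (Pred)

------------------------------------------------------------------------
-- Real numbers

-- ℝ is the setoid of Cauchy sequences of rationals.  The modulus of
-- convergence is part of the data, so this is the usual constructive ℝ;
-- all operations are pointwise.

Cauchy : (ℕ → ℚ) → Set
Cauchy f = ∀ ε → 0ℚ ℚ.< ε →
  ∃ λ N → ∀ m n → N ℕ.≤ m → N ℕ.≤ n → ∣ f m ℚ.- f n ∣ ℚ.< ε

Eventually : Pred ℕ 0ℓ → Set
Eventually P = ∃ λ N → ∀ n → N ℕ.≤ n → P n

record ℝ : Set where
  constructor mkℝ
  field
    seq    : ℕ → ℚ
    cauchy : Cauchy seq

open ℝ public

infix 4 _≈_ _<_ _≤_ _#_

record _≈_ (x y : ℝ) : Set where
  constructor mk≈
  field
    close : ∀ ε → 0ℚ ℚ.< ε → Eventually λ n → ∣ seq x n ℚ.- seq y n ∣ ℚ.< ε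

-- The gap must be bounded below by a fixed positive rational: comparing
-- the sequences pointwise would not respect _≈_.

record _<_ (x y : ℝ) : Set where
  constructor mk<
  field
    gap       : ℚ
    gap>0     : 0ℚ ℚ.< gap
    separated : Eventually λ n → seq x n ℚ.+ gap ℚ.≤ seq y n

_≤_ : Rel ℝ 0ℓ
x ≤ y = ¬ (y < x)

_#_ : Rel ℝ 0ℓ
x # y = x < y ⊎ y < x

private
  abstract
    const-cauchy : ∀ q → Cauchy (λ _ → q)
    const-cauchy q ε 0<ε = 0 , λ _ _ _ _ →
      subst (ℚ._< ε) (sym (cong ∣_∣ (ℚ.+-inverseʳ q))) 0<ε

    0<½* : ∀ {ε} → 0ℚ ℚ.< ε → 0ℚ ℚ.< ½ ℚ.* ε
    0<½* {ε} 0<ε = subst (ℚ._< ½ ℚ.* ε) (ℚ.*-zeroʳ ½) (ℚ.*-monoʳ-<-pos ½ 0<ε)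

    ½*+½* : ∀ ε → ½ ℚ.* ε ℚ.+ ½ ℚ.* ε ≡ ε
    ½*+½* ε = trans (sym (ℚ.*-distribʳ-+ ε ½ ½)) (ℚ.*-identityˡ ε)

    m⊔n≤⇒m≤ : ∀ m n {o} → m ⊔ n ℕ.≤ o → m ℕ.≤ o
    m⊔n≤⇒m≤ m n = ℕ.≤-trans (ℕ.m≤m⊔n m n)

    m⊔n≤⇒n≤ : ∀ m n {o} → m ⊔ n ℕ.≤ o → n ℕ.≤ o
    m⊔n≤⇒n≤ m n = ℕ.≤-trans (ℕ.m≤n⊔m m n)

    +-cauchy : ∀ {f g} → Cauchy f → Cauchy g → Cauchy (λ n → f n ℚ.+ g n)
    +-cauchy {f} {g} cf cg ε 0<ε with cf _ (0<½* 0<ε) | cg _ (0<½* 0<ε)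
    ... | M , f-close | N , g-close = M ⊔ N , λ m n p q → begin-strict
      ∣ (f m ℚ.+ g m) ℚ.- (f n ℚ.+ g n) ∣      ≡⟨ cong ∣_∣ (rearrange (f m) (g m) (f n) (g n)) ⟩
      ∣ (f m ℚ.- f n) ℚ.+ (g m ℚ.- g n) ∣      ≤⟨ ℚ.∣p+q∣≤∣p∣+∣q∣ (f m ℚ.- f n) (g m ℚ.- g n) ⟩
      ∣ f m ℚ.- f n ∣ ℚ.+ ∣ g m ℚ.- g n ∣      <⟨ ℚ.+-mono-<
        (f-close m n (m⊔n≤⇒m≤ M N p) (m⊔n≤⇒m≤ M N q))
        (g-close m n (m⊔n≤⇒n≤ M N p) (m⊔n≤⇒n≤ M N q)) ⟩
      ½ ℚ.* ε ℚ.+ ½ ℚ.* ε                      ≡⟨ ½*+½* ε ⟩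
      ε                                        ∎
      where
      open ℚ.≤-Reasoning
      open +-*-Solver
      rearrange : ∀ a b c d → (a ℚ.+ b) ℚ.- (c ℚ.+ d) ≡ (a ℚ.- c) ℚ.+ (b ℚ.- d)
      rearrange = solve 4 (λ a b c d →
        (a :+ b) :- (c :+ d) := (a :- c) :+ (b :- d)) refl

    neg-cauchy : ∀ {f} → Cauchy f → Cauchy (λ n → ℚ.- f n)
    neg-cauchy {f} cf ε 0<ε with cf ε 0<ε
    ... | N , f-close = N , λ m n p q →
      subst (ℚ._< ε) (cong ∣_∣ (rearrange (f m) (f n))) (f-close n m q p)
      where
      open +-*-Solver
      rearrange : ∀ a b → b ℚ.- a ≡ (ℚ.- a) ℚ.- (ℚ.- b)
      rearrange = solve 2 (λ a b → b :- a := (:- a) :- (:- b)) refl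

    cauchy-bounded : ∀ {f} → Cauchy f →
      ∃ λ B → 0ℚ ℚ.< B × Eventually λ n → ∣ f n ∣ ℚ.< B
    cauchy-bounded {f} cf with cf 1ℚ (ℚ.positive⁻¹ 1ℚ)
    ... | N , f-close =
      1ℚ ℚ.+ ∣ f N ∣ ,
      ℚ.+-mono-<-≤ (ℚ.positive⁻¹ 1ℚ) (ℚ.0≤∣p∣ (f N)) ,
      N , λ n p → begin-strict
        ∣ f n ∣                       ≡⟨ cong ∣_∣ (rearrange (f n) (f N)) ⟩
        ∣ (f n ℚ.- f N) ℚ.+ f N ∣     ≤⟨ ℚ.∣p+q∣≤∣p∣+∣q∣ (f n ℚ.- f N) (f N) ⟩
        ∣ f n ℚ.- f N ∣ ℚ.+ ∣ f N ∣   <⟨ ℚ.+-monoˡ-< ∣ f N ∣ (f-close n N p ℕ.≤-refl) ⟩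
        1ℚ ℚ.+ ∣ f N ∣                ∎
      where
      open ℚ.≤-Reasoning
      open +-*-Solver
      rearrange : ∀ a b → a ≡ (a ℚ.- b) ℚ.+ b
      rearrange = solve 2 (λ a b → a := (a :- b) :+ b) refl

    *-mono-< : ∀ {a b c d} → 0ℚ ℚ.< b →
      a ℚ.< b → c ℚ.< d → 0ℚ ℚ.≤ c → a ℚ.* c ℚ.< b ℚ.* d
    *-mono-< {a} {b} {c} {d} 0<b a<b c<d 0≤c = begin-strict
      a ℚ.* c   ≤⟨ ℚ.*-monoʳ-≤-nonNeg c {{ℚ.nonNegative 0≤c}} (ℚ.<⇒≤ a<b) ⟩
      b ℚ.* c   <⟨ ℚ.*-monoʳ-<-pos b {{ℚ.positive 0<b}} c<d ⟩
      b ℚ.* d   ∎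
      where open ℚ.≤-Reasoning

    *-rearrange : ∀ a b c d →
      (a ℚ.* b) ℚ.- (c ℚ.* d) ≡ a ℚ.* (b ℚ.- d) ℚ.+ d ℚ.* (a ℚ.- c)
    *-rearrange = solve 4 (λ a b c d →
      (a :* b) :- (c :* d) := a :* (b :- d) :+ d :* (a :- c)) refl
      where open +-*-Solver

    *-close : ∀ a b c d {B C δ} → 0ℚ ℚ.< B → 0ℚ ℚ.< C →
      ∣ a ∣ ℚ.< B → ∣ d ∣ ℚ.< C → ∣ b ℚ.- d ∣ ℚ.< δ → ∣ a ℚ.- c ∣ ℚ.< δ →
      ∣ a ℚ.* b ℚ.- c ℚ.* d ∣ ℚ.< B ℚ.* δ ℚ.+ C ℚ.* δ
    *-close a b c d {B} {C} {δ} 0<B 0<C a<B d<C b~d a~c = begin-strict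
      ∣ a ℚ.* b ℚ.- c ℚ.* d ∣
        ≡⟨ cong ∣_∣ (*-rearrange a b c d) ⟩
      ∣ a ℚ.* (b ℚ.- d) ℚ.+ d ℚ.* (a ℚ.- c) ∣
        ≤⟨ ℚ.∣p+q∣≤∣p∣+∣q∣ (a ℚ.* (b ℚ.- d)) (d ℚ.* (a ℚ.- c)) ⟩
      ∣ a ℚ.* (b ℚ.- d) ∣ ℚ.+ ∣ d ℚ.* (a ℚ.- c) ∣
        ≡⟨ cong₂ ℚ._+_ (ℚ.∣p*q∣≡∣p∣*∣q∣ a (b ℚ.- d)) (ℚ.∣p*q∣≡∣p∣*∣q∣ d (a ℚ.- c)) ⟩
      ∣ a ∣ ℚ.* ∣ b ℚ.- d ∣ ℚ.+ ∣ d ∣ ℚ.* ∣ a ℚ.- c ∣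
        <⟨ ℚ.+-mono-<
             (*-mono-< 0<B a<B b~d (ℚ.0≤∣p∣ (b ℚ.- d)))
             (*-mono-< 0<C d<C a~c (ℚ.0≤∣p∣ (a ℚ.- c))) ⟩
      B ℚ.* δ ℚ.+ C ℚ.* δ ∎
      where open ℚ.≤-Reasoning

    split : ∀ B C ε → 0ℚ ℚ.< B → 0ℚ ℚ.< C → 0ℚ ℚ.< ε →
      ∃ λ δ → 0ℚ ℚ.< δ × B ℚ.* δ ℚ.+ C ℚ.* δ ≡ ε
    split B C ε 0<B 0<C 0<ε = r ℚ.* ε ,
      subst (ℚ._< r ℚ.* ε) (ℚ.*-zeroʳ r)
        (ℚ.*-monoʳ-<-pos r {{ℚ.1/pos⇒pos (B ℚ.+ C)}} 0<ε) ,
      trans (sym (ℚ.*-distribʳ-+ (r ℚ.* ε) B C))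
        (trans (sym (ℚ.*-assoc (B ℚ.+ C) r ε))
        (trans (cong (ℚ._* ε) (ℚ.*-inverseʳ (B ℚ.+ C))) (ℚ.*-identityˡ ε)))
      where
      instance
        pos : ℚ.Positive (B ℚ.+ C)
        pos = ℚ.positive (ℚ.+-mono-< 0<B 0<C)
        nonZero : ℚ.NonZero (B ℚ.+ C)
        nonZero = ℚ.pos⇒nonZero (B ℚ.+ C)
      r : ℚ
      r = 1/ (B ℚ.+ C)

    *-cauchy : ∀ {f g} → Cauchy f → Cauchy g → Cauchy (λ n → f n ℚ.* g n)
    *-cauchy {f} {g} cf cg ε 0<ε =
      let B , 0<B , K , f<B = cauchy-bounded cf
          C , 0<C , L , g<C = cauchy-bounded cg
          δ , 0<δ , total   = split B C ε 0<B 0<C 0<ε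
          M , f-close       = cf δ 0<δ
          N , g-close       = cg δ 0<δ
      in (K ⊔ L) ⊔ (M ⊔ N) , λ m n p q →
        let p₁ = m⊔n≤⇒m≤ (K ⊔ L) (M ⊔ N) p
            q₁ = m⊔n≤⇒m≤ (K ⊔ L) (M ⊔ N) q
            p₂ = m⊔n≤⇒n≤ (K ⊔ L) (M ⊔ N) p
            q₂ = m⊔n≤⇒n≤ (K ⊔ L) (M ⊔ N) q
        in subst (∣ f m ℚ.* g m ℚ.- f n ℚ.* g n ∣ ℚ.<_) total
             (*-close (f m) (g m) (f n) (g n) 0<B 0<C
               (f<B m (m⊔n≤⇒m≤ K L p₁))
               (g<C n (m⊔n≤⇒n≤ K L q₁))
               (g-close m n (m⊔n≤⇒n≤ M N p₂) (m⊔n≤⇒n≤ M N q₂))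
               (f-close m n (m⊔n≤⇒m≤ M N p₂) (m⊔n≤⇒m≤ M N q₂)))

infixl 6 _+_ _-_
infixl 7 _*_
infix  8 -_

fromℚ : ℚ → ℝ
fromℚ q = mkℝ (λ _ → q) (const-cauchy q)

0ℝ 1ℝ : ℝ
0ℝ = fromℚ 0ℚ
1ℝ = fromℚ 1ℚ

_+_ _*_ : ℝ → ℝ → ℝ
x + y = mkℝ (λ n → seq x n ℚ.+ seq y n) (+-cauchy {seq x} {seq y} (cauchy x) (cauchy y))
x * y = mkℝ (λ n → seq x n ℚ.* seq y n) (*-cauchy {seq x} {seq y} (cauchy x) (cauchy y))

-_ : ℝ → ℝ
-_ x = mkℝ (λ n → ℚ.- seq x n) (neg-cauchy {seq x} (cauchy x))

_-_ : ℝ → ℝ → ℝ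
x - y = x + - y

ℝ-rawRing : RawRing 0ℓ 0ℓ
ℝ-rawRing = record
  { Carrier = ℝ
  ; _≈_     = _≈_
  ; _+_     = _+_
  ; _*_     = _*_
  ; -_      = -_
  ; 0#      = 0ℝ
  ; 1#      = 1ℝ
  }

open RawSemiringDefinitions (RawRing.rawSemiring ℝ-rawRing) public
  using (sum; product; _^_)

------------------------------------------------------------------------
-- Matrices and eigenvalues

Matrix : ℕ → Set
Matrix n = Fin n → Fin n → ℝ

identity : ∀ {n} → Matrix n
identity i j = if does (i Fin.≟ j) then 1ℝ else 0ℝ

_·_ : ∀ {n} → Matrix n → Vector ℝ n → Vector ℝ n
(M · z) i = sum λ j → M i j * z j

-- Laplace expansion along the first row.

det : ∀ {n} → Matrix n → ℝ
det {zero}  M = 1ℝ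
det {suc n} M = sum λ j →
  (- 1ℝ) ^ toℕ j * (M Fin.zero j * det λ i k → M (Fin.suc i) (punchIn j k))

charPoly : ∀ {n} → Matrix n → ℝ → ℝ
charPoly M t = det λ i j → t * identity i j - M i j

-- Λ lists the eigenvalues of M in non-increasing order and with
-- multiplicity, i.e. det (tI - M) = ∏ᵢ (t - Λᵢ).  Equality for every
-- real t is equality of polynomials, as ℝ is infinite.

record IsSpectrum {n} (M : Matrix n) (Λ : Vector ℝ n) : Set where
  field
    nonIncreasing : ∀ i j → i Fin.≤ j → Λ j ≤ Λ i
    splits        : ∀ t → charPoly M t ≈ product λ i → t - Λ i

-- x is the k-th largest eigenvalue of M, counting from k = 1.

IsKthEigenvalue : ∀ {n} → ℕ → Matrix n → ℝ → Set
IsKthEigenvalue k M x =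
  ∃ λ Λ → IsSpectrum M Λ × ∃ λ i → suc (toℕ i) ≡ k × x ≈ Λ i

record IsEigenvector {n} (M : Matrix n) (x : ℝ) (z : Vector ℝ n) : Set where
  field
    nonzero : ∃ λ i → z i # 0ℝ
    scales  : ∀ i → (M · z) i ≈ x * z i

V₊ V₋ : ∀ {n} → Vector ℝ n → Pred (Fin n) 0ℓ
V₊ z w = 0ℝ < z w
V₋ z w = z w < 0ℝ

------------------------------------------------------------------------
-- Graphs

record SimpleGraph (n : ℕ) : Set₁ where
  field
    Adj      : Rel (Fin n) 0ℓ
    adj?     : Decidable Adj
    adj-sym  : Symmetric Adj
    loopless : ∀ i → ¬ Adj i i

open SimpleGraph public

adjacencyMatrix : ∀ {n} → SimpleGraph n → Matrix n
adjacencyMatrix G i j = if does (adj? G i j) then 1ℝ else 0ℝ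

SameEdge : ∀ {n} → (u v i j : Fin n) → Set
SameEdge u v i j = (i ≡ u × j ≡ v) ⊎ (i ≡ v × j ≡ u)

sameEdge? : ∀ {n} (u v i j : Fin n) → Dec (SameEdge u v i j)
sameEdge? u v i j =
  (i Fin.≟ u ×-dec j Fin.≟ v) ⊎-dec (i Fin.≟ v ×-dec j Fin.≟ u)

deleteEdge : ∀ {n} → SimpleGraph n → Fin n → Fin n → SimpleGraph n
deleteEdge G u v = record
  { Adj      = λ i j → Adj G i j × ¬ SameEdge u v i j
  ; adj?     = λ i j → adj? G i j ×-dec ¬? (sameEdge? u v i j)
  ; adj-sym  = λ (e , ne) → adj-sym G e , λ where
      (inj₁ (p , q)) → ne (inj₂ (q , p))
      (inj₂ (p , q)) → ne (inj₁ (q , p))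
  ; loopless = λ i (e , _) → loopless G i e
  }

{-# OPTIONS --safe #-}

module Submission where

-- Write z = p + q with p its positive and q its nonpositive part, and let B
-- be the adjacency matrix without the edge uv.  For y = a p + b q, that is
-- yᵢ = sᵢ zᵢ with sᵢ ∈ {a , b}, the eigenvector equation gives
--   yᵀBy - λ₂ yᵀy = ½ Σᵢⱼ Bᵢⱼ (- zᵢ zⱼ) (sᵢ - sⱼ)² + d (a² + b²),  d = - zᵤ zᵥ > 0,
-- where every summand is nonnegative.  So the form of B exceeds λ₂ + ε on the
-- plane spanned by p and q, for any ε with ε zᵀz < d, and by Courant–Fischer
-- so does its second eigenvalue.
--
-- Courant–Fischer is obtained without the spectral theorem: a root of the
-- characteristic polynomial has an eigenvector v, the induced operator on the
-- quotient by v is self-adjoint for the quotient inner product, and its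
-- characteristic polynomial has the remaining roots.
--
-- Over the constructive reals, case distinctions are available only up to
-- double negation.  This suffices for λ₂ + ε ≤ λ₂′, a negation, and the
-- strict inequality follows since ε is found explicitly.

open import Algebra.Bundles using (CommutativeRing; Semiring)
import Algebra.Definitions.RawSemiring
import Algebra.Properties.Ring
import Algebra.Properties.Semiring.Sum
import Algebra.Solver.Ring
open import Algebra.Solver.Ring.AlmostCommutativeRing
  using (fromCommutativeRing; _-Raw-AlmostCommutative⟶_)
open import Data.Bool.Base using (if_then_else_; not)
open import Data.Fin.Base using (Fin; zero; suc; toℕ; punchIn; punchOut; inject₁)
open import Data.Fin.Induction using (<-weakInduction)
open import Data.Fin.Properties
  using (_≟_; suc-injective; punchInᵢ≢i; punchIn-injective; punchIn-punchOut; toℕ-inject₁)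
open import Data.Maybe.Base using (Maybe; just; nothing)
open import Data.Nat.Base as ℕ using (ℕ; zero; suc)
import Data.Nat.Properties as ℕ
open import Data.Product.Base using (∃; _×_; _,_; proj₁; proj₂)
open import Data.Rational.Base as ℚ using (ℚ; 0ℚ; 1ℚ; ½; 1/_; ∣_∣)
import Data.Rational.Properties as ℚ
import Data.Rational.Solver
open import Data.Sum.Base using (_⊎_; inj₁; inj₂)
open import Data.Vec.Functional using (Vector; head; tail; updateAt) renaming (_∷_ to _∷ᵛ_)
open import Data.Vec.Functional.Properties using (updateAt-updates; updateAt-minimal)
open import Function.Base using (_∘_; const)
open import Level using (0ℓ)
open import Relation.Binary.PropositionalEquality as ≡ using (_≡_; _≢_)
open import Relation.Nullary using (¬_; Dec; does; yes; no; contradiction)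
open import Relation.Nullary.Decidable using (dec-true; dec-false)
open import Relation.Unary using (_∈_)

-- The spectrum is given as a factorisation of the characteristic polynomial, so a step that removes
-- an eigenvector must also remove one linear factor. This favours a quotient over an orthogonal
-- complement: with `v zero` invertible, putting `v` in the zeroth column of the characteristic
-- matrix and taking a Schur complement exhibits the factor `t - Λ₀`, and no basis of the complement
-- has to be found. The price is that the quotient carries an inner product other than the dot
-- product, so operators are self-adjoint for an abstract one. The factor cancels pointwise only
-- where `t - Λ₀` is nonzero; the missing point is recovered because both sides are polynomials. The
-- identity for the form comes from multiplying the eigenvector equation at `i` by `sᵢ² zᵢ`. The
-- difference of the two double sums then has the coefficient `sᵢ sⱼ - sᵢ²` at `Bᵢⱼ zᵢ zⱼ`, and
-- adding the term with `i` and `j` exchanged gives `- (sᵢ - sⱼ)²`.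

record OrderedField : Set₁ where
  infix 4 _<_
  field
    commutativeRing : CommutativeRing 0ℓ 0ℓ
  open CommutativeRing commutativeRing public
  field
    -- Only there to provide the ring solver with decidable coefficients.
    fromℚ     : ℚ.+-*-rawRing -Raw-AlmostCommutative⟶ fromCommutativeRing commutativeRing
    _<_       : Carrier → Carrier → Set
    <-resp-≈  : ∀ {x x′ y y′} → x ≈ x′ → y ≈ y′ → x < y → x′ < y′
    <-asym    : ∀ {x y} → x < y → ¬ y < x
    <-cotrans : ∀ {x y} → x < y → ∀ z → x < z ⊎ z < y
    tight     : ∀ {x y} → ¬ x < y → ¬ y < x → x ≈ y
    0<1       : 0# < 1#
    +-monoˡ-< : ∀ {x y} z → x < y → x + z < y + z
    *-pos     : ∀ {x y} → 0# < x → 0# < y → 0# < x * y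
    inverse   : ∀ {x} → 0# < x → ∃ λ y → 0# < y × x * y ≈ 1#

module LinearAlgebra (F : OrderedField) where
  open OrderedField F hiding (zero)
  open Algebra.Properties.Ring ring using (-1*x≈-x; -0#≈0#)
  open Algebra.Properties.Semiring.Sum semiring
    using (sum; sum-cong-≋; sum-replicate-zero; ∑-distrib-+; *-distribˡ-sum; ∑-comm)
  open Algebra.Definitions.RawSemiring (Semiring.rawSemiring semiring) using (_^_; product)

  private
    decide : ∀ p q → Maybe (_-Raw-AlmostCommutative⟶_.⟦_⟧ fromℚ p ≈ _-Raw-AlmostCommutative⟶_.⟦_⟧ fromℚ q)
    decide p q with p ℚ.≟ q
    ... | yes ≡.refl = just refl
    ... | no _       = nothing

  open Algebra.Solver.Ring ℚ.+-*-rawRing (fromCommutativeRing commutativeRing) fromℚ decide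
    using (solve; _:=_; _:+_; _:*_; _:-_; :-_)
  open import Relation.Binary.Reasoning.Setoid setoid

  -- Sums and determinants

  Matrix : ℕ → Set
  Matrix n = Fin n → Fin n → Carrier

  -- Sums and determinants are opaque, as unfolding them at a size that is
  -- still a metavariable would block unification.
  opaque
    ∑ : ∀ {n} → Vector Carrier n → Carrier
    ∑ = sum

    ∑-cong : ∀ {n} {f g : Vector Carrier n} → (∀ i → f i ≈ g i) → ∑ f ≈ ∑ g
    ∑-cong = sum-cong-≋

    ∑-linear : ∀ {n} a b (f g : Vector Carrier n) → ∑ (λ i → a * f i + b * g i) ≈ a * ∑ f + b * ∑ g
    ∑-linear a b f g = trans (∑-distrib-+ (λ i → a * f i) (λ i → b * g i))
      (+-cong (sym (*-distribˡ-sum a f)) (sym (*-distribˡ-sum b g)))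

    *-distribˡ-∑ : ∀ {n} a (f : Vector Carrier n) → a * ∑ f ≈ ∑ (λ i → a * f i)
    *-distribˡ-∑ = *-distribˡ-sum

    ∑-swap : ∀ {m n} (f : Fin m → Fin n → Carrier) → ∑ (λ i → ∑ (f i)) ≈ ∑ (λ j → ∑ λ i → f i j)
    ∑-swap = ∑-comm

    ∑-empty : (f : Vector Carrier 0) → ∑ f ≈ 0#
    ∑-empty f = refl

    ∑-suc : ∀ {n} (f : Vector Carrier (suc n)) → ∑ f ≈ f zero + ∑ (tail f)
    ∑-suc f = refl

    ∑-zero : ∀ {n} {f : Vector Carrier n} → (∀ i → f i ≈ 0#) → ∑ f ≈ 0#
    ∑-zero {n} f≈0 = trans (∑-cong f≈0) (sum-replicate-zero n)

  minor : ∀ {n} → Matrix (suc n) → Fin (suc n) → Matrix n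
  minor M j i k = M (suc i) (punchIn j k)

  opaque
    det : ∀ {n} → Matrix n → Carrier
    det {zero}  M = 1#
    det {suc n} M = ∑ λ j → (- 1#) ^ toℕ j * (M zero j * det (minor M j))

    det-empty : (M : Matrix 0) → det M ≈ 1#
    det-empty M = refl

    det-suc : ∀ {n} (M : Matrix (suc n)) → det M ≈ ∑ λ j → (- 1#) ^ toℕ j * (M zero j * det (minor M j))
    det-suc M = refl

    det-cong : ∀ {n} {M N : Matrix n} → (∀ i j → M i j ≈ N i j) → det M ≈ det N
    det-cong {zero}  M≈N = refl
    det-cong {suc n} M≈N = ∑-cong λ j →
      *-congˡ (*-cong (M≈N zero j) (det-cong λ i k → M≈N (suc i) (punchIn j k)))

  -- In the expansion along the first row, the `k`-th term is linear in its entry and its minor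
  -- omits column `k`; every other term is linear in its minor, where column `k` reappears at
  -- `punchOut`.
  det-linear-col : ∀ {n} (k : Fin n) a b {M N P : Matrix n} →
    (∀ i → P i k ≈ a * M i k + b * N i k) →
    (∀ i j → j ≢ k → P i j ≈ M i j) → (∀ i j → j ≢ k → P i j ≈ N i j) →
    det P ≈ a * det M + b * det N
  det-linear-col {suc n} k a b {M} {N} {P} P≈aM+bN P≈M P≈N =
    trans (det-suc P) (trans (trans (∑-cong step) (∑-linear a b (term M) (term N)))
      (sym (+-cong (*-congˡ (det-suc M)) (*-congˡ (det-suc N)))))
    where
    term : Matrix (suc n) → Vector Carrier (suc n)
    term Q j = (- 1#) ^ toℕ j * (Q zero j * det (minor Q j))

    step : ∀ j → term P j ≈ a * term M j + b * term N j
    step j with j ≟ k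
    ... | yes ≡.refl = begin
      s * (P zero k * d)
        ≈⟨ *-congˡ (*-congʳ (P≈aM+bN zero)) ⟩
      s * ((a * M zero k + b * N zero k) * d)
        ≈⟨ solve 6 (λ s d a b m n → s :* ((a :* m :+ b :* n) :* d) :=
             a :* (s :* (m :* d)) :+ b :* (s :* (n :* d))) refl s d a b (M zero k) (N zero k) ⟩
      a * (s * (M zero k * d)) + b * (s * (N zero k * d))
        ≈⟨ +-cong (*-congˡ (*-congˡ (*-congˡ (det-cong λ i l → P≈M (suc i) _ (punchInᵢ≢i k l)))))
                  (*-congˡ (*-congˡ (*-congˡ (det-cong λ i l → P≈N (suc i) _ (punchInᵢ≢i k l))))) ⟩
      a * term M k + b * term N k ∎
      where
      s = (- 1#) ^ toℕ k
      d = det (minor P k)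
    ... | no j≢k = begin
      s * (p * det (minor P j))
        ≈⟨ *-congˡ (*-congˡ minors) ⟩
      s * (p * (a * dM + b * dN))
        ≈⟨ solve 6 (λ s p a b m n → s :* (p :* (a :* m :+ b :* n)) :=
             a :* (s :* (p :* m)) :+ b :* (s :* (p :* n))) refl s p a b dM dN ⟩
      a * (s * (p * dM)) + b * (s * (p * dN))
        ≈⟨ +-cong (*-congˡ (*-congˡ (*-congʳ (P≈M zero j j≢k)))) (*-congˡ (*-congˡ (*-congʳ (P≈N zero j j≢k)))) ⟩
      a * term M j + b * term N j ∎
      where
      s  = (- 1#) ^ toℕ j
      p  = P zero j
      dM = det (minor M j)
      dN = det (minor N j)
      k′ = punchOut j≢k

      k′↦k : punchIn j k′ ≡ k
      k′↦k = punchIn-punchOut j≢k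

      other : ∀ l → l ≢ k′ → punchIn j l ≢ k
      other l l≢k′ eq = l≢k′ (punchIn-injective j l k′ (≡.trans eq (≡.sym k′↦k)))

      minors : det (minor P j) ≈ a * dM + b * dN
      minors = det-linear-col k′ a b
        (λ i → ≡.subst (λ c → P (suc i) c ≈ a * M (suc i) c + b * N (suc i) c) (≡.sym k′↦k) (P≈aM+bN (suc i)))
        (λ i l l≢k′ → P≈M (suc i) _ (other l l≢k′))
        (λ i l l≢k′ → P≈N (suc i) _ (other l l≢k′))

  ∑-adjacent-cancel : ∀ {n} (k : Fin n) (f : Vector Carrier (suc n)) →
    f (inject₁ k) + f (suc k) ≈ 0# →
    (∀ j → j ≢ inject₁ k → j ≢ suc k → f j ≈ 0#) → ∑ f ≈ 0#
  ∑-adjacent-cancel zero f cancel other = begin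
    ∑ f
      ≈⟨ trans (∑-suc f) (+-congˡ (∑-suc (tail f))) ⟩
    f zero + (f (suc zero) + ∑ (tail (tail f)))
      ≈⟨ +-assoc _ _ _ ⟨
    f zero + f (suc zero) + ∑ (tail (tail f))
      ≈⟨ +-cong cancel (∑-zero λ i → other (suc (suc i)) (λ ()) (λ ())) ⟩
    0# + 0# ≈⟨ +-identityˡ 0# ⟩
    0# ∎
  ∑-adjacent-cancel (suc k) f cancel other = trans (∑-suc f) (trans
    (+-cong (other zero (λ ()) (λ ()))
      (∑-adjacent-cancel k (tail f) cancel λ j p q →
        other (suc j) (λ where ≡.refl → p ≡.refl) (λ where ≡.refl → q ≡.refl)))
    (+-identityˡ 0#))

  -- Deleting a column outside an adjacent pair leaves the pair adjacent. That `n` is a successor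
  -- emerges only from the case distinction, hence the transport along `eq`.
  adjacent-in-minor : ∀ {n} (j : Fin (suc n)) (k : Fin n) → j ≢ inject₁ k → j ≢ suc k →
    ∃ λ m → ∃ λ (k′ : Fin m) → ∃ λ (eq : suc m ≡ n) →
      punchIn j (≡.subst Fin eq (inject₁ k′)) ≡ inject₁ k × punchIn j (≡.subst Fin eq (suc k′)) ≡ suc k
  adjacent-in-minor zero          zero    p q = contradiction ≡.refl p
  adjacent-in-minor zero          (suc k) p q = _ , k , ≡.refl , ≡.refl , ≡.refl
  adjacent-in-minor (suc zero)    zero    p q = contradiction ≡.refl q
  adjacent-in-minor {suc (suc n)} (suc (suc j)) zero    p q = _ , zero , ≡.refl , ≡.refl , ≡.refl
  adjacent-in-minor (suc j)       (suc k) p q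
    with adjacent-in-minor j k (p ∘ ≡.cong suc) (q ∘ ≡.cong suc)
  ... | _ , k′ , ≡.refl , eq₁ , eq₂ = _ , suc k′ , ≡.refl , ≡.cong suc eq₁ , ≡.cong suc eq₂

  punchIn-adjacent : ∀ {n} (k l : Fin n) →
    punchIn (inject₁ k) l ≡ punchIn (suc k) l ⊎
    (punchIn (inject₁ k) l ≡ suc k × punchIn (suc k) l ≡ inject₁ k)
  punchIn-adjacent zero    zero    = inj₂ (≡.refl , ≡.refl)
  punchIn-adjacent zero    (suc l) = inj₁ ≡.refl
  punchIn-adjacent (suc k) zero    = inj₁ ≡.refl
  punchIn-adjacent (suc k) (suc l) with punchIn-adjacent k l
  ... | inj₁ eq        = inj₁ (≡.cong suc eq)
  ... | inj₂ (eq₁ , eq₂) = inj₂ (≡.cong suc eq₁ , ≡.cong suc eq₂)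

  -- Minors that omit a column outside the pair vanish by induction; the two that omit a column of
  -- the pair agree and enter with opposite signs.
  det-adjacent-cols : ∀ {n} (k : Fin n) (M : Matrix (suc n)) →
    (∀ i → M i (inject₁ k) ≈ M i (suc k)) → det M ≈ 0#
  det-adjacent-cols {n} k M eq = trans (det-suc M) (∑-adjacent-cancel k term cancel other)
    where
    term : Vector Carrier (suc n)
    term j = (- 1#) ^ toℕ j * (M zero j * det (minor M j))

    minors : det (minor M (inject₁ k)) ≈ det (minor M (suc k))
    minors = det-cong entry
      where
      entry : ∀ i l → M (suc i) (punchIn (inject₁ k) l) ≈ M (suc i) (punchIn (suc k) l)
      entry i l with punchIn-adjacent k l
      ... | inj₁ p       = reflexive (≡.cong (M (suc i)) p)
      ... | inj₂ (p , q) = begin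
        M (suc i) (punchIn (inject₁ k) l) ≡⟨ ≡.cong (M (suc i)) p ⟩
        M (suc i) (suc k)                 ≈⟨ eq (suc i) ⟨
        M (suc i) (inject₁ k)             ≡⟨ ≡.cong (M (suc i)) q ⟨
        M (suc i) (punchIn (suc k) l)     ∎

    cancel : term (inject₁ k) + term (suc k) ≈ 0#
    cancel = begin
      (- 1#) ^ toℕ (inject₁ k) * (M zero (inject₁ k) * det (minor M (inject₁ k))) + term (suc k)
        ≈⟨ +-congʳ (*-cong (reflexive (≡.cong ((- 1#) ^_) (toℕ-inject₁ k))) (*-cong (eq zero) minors)) ⟩
      s * (m * d) + (- 1# * s) * (m * d)
        ≈⟨ +-congˡ (*-congʳ (-1*x≈-x s)) ⟩
      s * (m * d) + (- s) * (m * d)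
        ≈⟨ distribʳ (m * d) s (- s) ⟨
      (s + - s) * (m * d)
        ≈⟨ *-congʳ (-‿inverseʳ s) ⟩
      0# * (m * d)
        ≈⟨ zeroˡ _ ⟩
      0# ∎
      where
      s = (- 1#) ^ toℕ k
      m = M zero (suc k)
      d = det (minor M (suc k))

    other : ∀ j → j ≢ inject₁ k → j ≢ suc k → term j ≈ 0#
    other j p q with adjacent-in-minor j k p q
    ... | _ , k′ , ≡.refl , eq₁ , eq₂ = trans (*-congˡ (trans (*-congˡ vanish) (zeroʳ _))) (zeroʳ _)
      where
      vanish : det (minor M j) ≈ 0#
      vanish = det-adjacent-cols k′ (minor M j) λ i →
        ≡.subst₂ (λ c d → M (suc i) c ≈ M (suc i) d) (≡.sym eq₁) (≡.sym eq₂) (eq (suc i))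

  1*x+1*y : ∀ x y → 1# * x + 1# * y ≈ x + y
  1*x+1*y x y = +-cong (*-identityˡ x) (*-identityˡ y)

  -- Induction on the distance of the two columns: exchanging adjacent columns only changes the
  -- sign, and brings the repeated column one place closer.
  det-equal-cols : ∀ {n} (k : Fin n) (M : Matrix (suc n)) →
    (∀ i → M i zero ≈ M i (suc k)) → det M ≈ 0#
  det-equal-cols {suc n} = <-weakInduction
    (λ k → (M : Matrix (suc (suc n))) → (∀ i → M i zero ≈ M i (suc k)) → det M ≈ 0#)
    (det-adjacent-cols zero) step
    where
    step : ∀ (k : Fin n) →
      ((M : Matrix (suc (suc n))) → (∀ i → M i zero ≈ M i (suc (inject₁ k))) → det M ≈ 0#) →
      (M : Matrix (suc (suc n))) → (∀ i → M i zero ≈ M i (suc (suc k))) → det M ≈ 0#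
    -- Of the four terms in the expansion of `det (W x+y x+y)`, two vanish because column `a`
    -- repeats column zero and one because columns `a` and `b` agree. The fourth is `det M`.
    step k IH M eq = begin
      det M                                   ≈⟨ det-cong M≈Wyx ⟩
      det (W y x)                             ≈⟨ +-identityˡ _ ⟨
      0# + det (W y x)                        ≈⟨ +-congʳ (IH (W x x) (λ i → sym (reflexive (W-a x x i)))) ⟨
      det (W x x) + det (W y x)               ≈⟨ +-identityʳ _ ⟨
      det (W x x) + det (W y x) + 0#          ≈⟨ +-congˡ (trans (+-cong
                                                    (IH (W x y) (λ i → sym (reflexive (W-a x y i))))
                                                    (adjacent y)) (+-identityˡ 0#)) ⟨
      det (W x x) + det (W y x) + (det (W x y) + det (W y y))
                                              ≈⟨ +-cong (additive-a x) (additive-a y) ⟨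
      det (W x+y x) + det (W x+y y)           ≈⟨ additive-b ⟨
      det (W x+y x+y)                         ≈⟨ adjacent x+y ⟩
      0#                                      ∎
      where
      a b : Fin (suc (suc n))
      a = suc (inject₁ k)
      b = suc (suc k)

      x y x+y : Vector Carrier (suc (suc n))
      x   i = M i zero
      y   i = M i a
      x+y i = x i + y i

      W : (p q : Vector Carrier (suc (suc n))) → Matrix (suc (suc n))
      W p q i = updateAt (updateAt (M i) a (const (p i))) b (const (q i))

      inject₁≢suc : ∀ {n} (k : Fin n) → inject₁ k ≢ suc k
      inject₁≢suc (suc k) eq = inject₁≢suc k (suc-injective eq)

      a≢b : a ≢ b
      a≢b eq = inject₁≢suc k (suc-injective eq)

      W-b : ∀ p q i → W p q i b ≡ q i
      W-b p q i = updateAt-updates b (updateAt (M i) a (const (p i)))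

      W-a : ∀ p q i → W p q i a ≡ p i
      W-a p q i = ≡.trans (updateAt-minimal a b (updateAt (M i) a (const (p i))) a≢b) (updateAt-updates a (M i))

      W-other : ∀ p q i j → j ≢ a → j ≢ b → W p q i j ≡ M i j
      W-other p q i j j≢a j≢b =
        ≡.trans (updateAt-minimal j b _ j≢b) (updateAt-minimal j a (M i) j≢a)

      adjacent : ∀ p → det (W p p) ≈ 0#
      adjacent p = det-adjacent-cols (suc k) (W p p)
        λ i → reflexive (≡.trans (W-a p p i) (≡.sym (W-b p p i)))

      M≈Wyx : ∀ i j → M i j ≈ W y x i j
      M≈Wyx i j with j ≟ a | j ≟ b
      ... | yes ≡.refl | _          = sym (reflexive (W-a y x i))
      ... | no _       | yes ≡.refl = trans (sym (eq i)) (sym (reflexive (W-b y x i)))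
      ... | no j≢a     | no j≢b     = sym (reflexive (W-other y x i j j≢a j≢b))

      additive-a : ∀ q → det (W x+y q) ≈ det (W x q) + det (W y q)
      additive-a q = trans
        (det-linear-col a 1# 1#
          (λ i → trans (reflexive (W-a x+y q i)) (sym (trans (1*x+1*y _ _)
            (+-cong (reflexive (W-a x q i)) (reflexive (W-a y q i))))))
          (same x) (same y))
        (1*x+1*y _ _)
        where
        same : ∀ p i j → j ≢ a → W x+y q i j ≈ W p q i j
        same p i j j≢a with j ≟ b
        ... | yes ≡.refl = reflexive (≡.trans (W-b x+y q i) (≡.sym (W-b p q i)))
        ... | no j≢b     = reflexive (≡.trans (W-other x+y q i j j≢a j≢b)
                                              (≡.sym (W-other p q i j j≢a j≢b)))

      additive-b : det (W x+y x+y) ≈ det (W x+y x) + det (W x+y y)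
      additive-b = trans
        (det-linear-col b 1# 1#
          (λ i → trans (reflexive (W-b x+y x+y i)) (sym (trans (1*x+1*y _ _)
            (+-cong (reflexive (W-b x+y x i)) (reflexive (W-b x+y y i))))))
          (same x) (same y))
        (1*x+1*y _ _)
        where
        same : ∀ q i j → j ≢ b → W x+y x+y i j ≈ W x+y q i j
        same q i j j≢b = reflexive (≡.trans (updateAt-minimal j b _ j≢b) (≡.sym (updateAt-minimal j b _ j≢b)))

  -- Dot products and column operations

  infix 8 _∙_
  _∙_ : ∀ {n} → Vector Carrier n → Vector Carrier n → Carrier
  x ∙ y = ∑ λ i → x i * y i

  infix 9 _·_
  _·_ : ∀ {m n} → (Fin m → Vector Carrier n) → Vector Carrier n → Vector Carrier m
  (M · x) i = M i ∙ x

  ∙-cong : ∀ {n} {x x′ y y′ : Vector Carrier n} →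
    (∀ i → x i ≈ x′ i) → (∀ i → y i ≈ y′ i) → x ∙ y ≈ x′ ∙ y′
  ∙-cong x≈x′ y≈y′ = ∑-cong λ i → *-cong (x≈x′ i) (y≈y′ i)

  ∙-comm : ∀ {n} (x y : Vector Carrier n) → x ∙ y ≈ y ∙ x
  ∙-comm x y = ∑-cong λ i → *-comm (x i) (y i)

  ∙-linearʳ : ∀ {n} a b (x y z : Vector Carrier n) →
    x ∙ (λ i → a * y i + b * z i) ≈ a * x ∙ y + b * x ∙ z
  ∙-linearʳ a b x y z = trans
    (∑-cong λ i → solve 5 (λ a b x y z → x :* (a :* y :+ b :* z) := a :* (x :* y) :+ b :* (x :* z))
      refl a b (x i) (y i) (z i))
    (∑-linear a b _ _)

  ∙-linearˡ : ∀ {n} a b (x y z : Vector Carrier n) →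
    (λ i → a * x i + b * y i) ∙ z ≈ a * x ∙ z + b * y ∙ z
  ∙-linearˡ a b x y z = trans (∙-comm _ z)
    (trans (∙-linearʳ a b z x y) (+-cong (*-congˡ (∙-comm z x)) (*-congˡ (∙-comm z y))))

  ∙-suc : ∀ {n} (x y : Vector Carrier (suc n)) → x ∙ y ≈ x zero * y zero + tail x ∙ tail y
  ∙-suc x y = ∑-suc _

  0*x+0*y : ∀ x y → 0# * x + 0# * y ≈ 0#
  0*x+0*y x y = trans (+-cong (zeroˡ x) (zeroˡ y)) (+-identityˡ 0#)

  setCol₀ : ∀ {m n} → (Fin m → Vector Carrier (suc n)) → Vector Carrier m → Fin m → Vector Carrier (suc n)
  setCol₀ M x i = x i ∷ᵛ tail (M i)

  setCol₀-cong : ∀ {m n} (M : Fin m → Vector Carrier (suc n)) {x y : Vector Carrier m} →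
    (∀ i → x i ≈ y i) → ∀ i j → setCol₀ M x i j ≈ setCol₀ M y i j
  setCol₀-cong M x≈y i zero    = x≈y i
  setCol₀-cong M x≈y i (suc j) = refl

  det-setCol₀-linear : ∀ {n} (M : Matrix (suc n)) a b (x y : Vector Carrier (suc n)) →
    det (setCol₀ M (λ i → a * x i + b * y i)) ≈ a * det (setCol₀ M x) + b * det (setCol₀ M y)
  det-setCol₀-linear M a b x y = det-linear-col zero a b (λ i → refl) (same x) (same y)
    where
    same : ∀ z i j → j ≢ zero → setCol₀ M (λ i → a * x i + b * y i) i j ≈ setCol₀ M z i j
    same z i zero    0≢0 = contradiction ≡.refl 0≢0
    same z i (suc j) _   = refl

  det-setCol₀-∑ : ∀ {m n} (M : Matrix (suc n)) (c : Vector Carrier m) (x : Fin m → Vector Carrier (suc n)) →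
    det (setCol₀ M (λ i → c ∙ λ j → x j i)) ≈ c ∙ λ j → det (setCol₀ M (x j))
  det-setCol₀-∑ {zero} M c x = begin
    det (setCol₀ M (λ i → c ∙ λ j → x j i))
      ≈⟨ det-cong (setCol₀-cong M λ i → trans (∑-empty _) (sym (0*x+0*y 0# 0#))) ⟩
    det (setCol₀ M (λ i → 0# * 0# + 0# * 0#))
      ≈⟨ det-setCol₀-linear M 0# 0# _ _ ⟩
    0# * det (setCol₀ M (λ i → 0#)) + 0# * det (setCol₀ M (λ i → 0#))
      ≈⟨ 0*x+0*y _ _ ⟩
    0#
      ≈⟨ ∑-empty _ ⟨
    (c ∙ λ j → det (setCol₀ M (x j))) ∎
  det-setCol₀-∑ {suc m} {n} M c x = begin
    det (setCol₀ M (λ i → c ∙ λ j → x j i))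
      ≈⟨ det-cong (setCol₀-cong M λ i → trans (∙-suc _ _) (+-congˡ (sym (*-identityˡ _)))) ⟩
    det (setCol₀ M (λ i → c zero * x zero i + 1# * rest i))
      ≈⟨ det-setCol₀-linear M (c zero) 1# (x zero) rest ⟩
    c zero * det (setCol₀ M (x zero)) + 1# * det (setCol₀ M rest)
      ≈⟨ +-congˡ (trans (*-identityˡ _) (det-setCol₀-∑ M (tail c) (tail x))) ⟩
    c zero * det (setCol₀ M (x zero)) + (tail c ∙ λ j → det (setCol₀ M (x (suc j))))
      ≈⟨ ∙-suc _ _ ⟨
    (c ∙ λ j → det (setCol₀ M (x j))) ∎
    where
    rest : Vector Carrier (suc n)
    rest i = tail c ∙ λ j → x (suc j) i

  -- `M · v` is the combination of the columns with coefficients `v`; every column other than the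
  -- zeroth contributes a determinant with a repeated column.
  det-combine-cols : ∀ {n} (M : Matrix (suc n)) (v : Vector Carrier (suc n)) →
    det (setCol₀ M (M · v)) ≈ v zero * det M
  det-combine-cols M v = begin
    det (setCol₀ M (M · v))
      ≈⟨ det-cong (setCol₀-cong M λ i → ∙-comm (M i) v) ⟩
    det (setCol₀ M (λ i → v ∙ M i))
      ≈⟨ det-setCol₀-∑ M v (λ j i → M i j) ⟩
    (v ∙ λ j → det (setCol₀ M (λ i → M i j)))
      ≈⟨ ∙-suc _ _ ⟩
    v zero * det (setCol₀ M (λ i → M i zero)) + (tail v ∙ λ j → det (setCol₀ M (λ i → M i (suc j))))
      ≈⟨ +-cong (*-congˡ (det-cong λ where
           i zero    → refl
           i (suc j) → refl))
         (∑-zero λ j → trans (*-congˡ (det-equal-cols j _ λ i → refl)) (zeroʳ _)) ⟩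
    v zero * det M + 0#
      ≈⟨ +-identityʳ _ ⟩
    v zero * det M ∎

  -- Builds a vector from zero by changing one entry at a time. `P` must respect pointwise equality,
  -- as vectors are functions and are compared only pointwise.
  Vector-induction : ∀ {n} (P : Vector Carrier n → Set) →
    (∀ {x y} → (∀ i → x i ≈ y i) → P x → P y) →
    P (const 0#) → (∀ x k a → P x → P (updateAt x k (const a))) → ∀ x → P x
  Vector-induction {zero}  P resp P0 step x = resp (λ ()) P0
  Vector-induction {suc n} P resp P0 step x = resp
    (λ where
      zero    → refl
      (suc i) → refl)
    (step (0# ∷ᵛ tail x) zero (head x)
      (Vector-induction (λ y → P (0# ∷ᵛ y))
        (λ eq → resp λ where
          zero    → refl
          (suc i) → eq i)
        (resp (λ where
          zero    → refl
          (suc i) → refl) P0)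
        (λ y k a Py → resp (λ where
          zero    → refl
          (suc i) → refl) (step (0# ∷ᵛ y) (suc k) a Py))
        (tail x)))

  addCol₀ : ∀ {m n} → (Fin m → Vector Carrier (suc n)) → Vector Carrier n → Fin m → Vector Carrier (suc n)
  addCol₀ M c i = M i zero ∷ᵛ λ j → M i (suc j) + c j * M i zero

  -- Changing one coefficient of `c` alters one column by a multiple of the zeroth, so by linearity
  -- the determinant changes by a multiple of one with a repeated column.
  det-addCol₀ : ∀ {n} (M : Matrix (suc n)) (c : Vector Carrier n) → det (addCol₀ M c) ≈ det M
  det-addCol₀ {n} M = Vector-induction (λ c → det (addCol₀ M c) ≈ det M)
    (λ {x} {y} x≈y → trans (det-cong λ where
      i zero    → refl
      i (suc j) → +-congˡ (*-congʳ (sym (x≈y j)))))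
    (det-cong λ where
      i zero    → refl
      i (suc j) → trans (+-congˡ (zeroˡ _)) (+-identityʳ _))
    step
    where
    step : ∀ c k a → det (addCol₀ M c) ≈ det M → det (addCol₀ M (updateAt c k (const a))) ≈ det M
    step c k a IH = begin
      det (addCol₀ M c′)
        ≈⟨ det-linear-col (suc k) 1# (a - c k) col same₁ same₂ ⟩
      1# * det (addCol₀ M c) + (a - c k) * det N
        ≈⟨ +-cong (*-identityˡ _) (trans (*-congˡ
             (det-equal-cols k N λ i → sym (reflexive (updateAt-updates (suc k) (addCol₀ M c i))))) (zeroʳ _)) ⟩
      det (addCol₀ M c) + 0#
        ≈⟨ +-identityʳ _ ⟩
      det (addCol₀ M c)
        ≈⟨ IH ⟩
      det M ∎
      where
      c′ : Vector Carrier n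
      c′ = updateAt c k (const a)

      N : Matrix (suc n)
      N i = updateAt (addCol₀ M c i) (suc k) (const (M i zero))

      col : ∀ i → M i (suc k) + c′ k * M i zero ≈
        1# * (M i (suc k) + c k * M i zero) + (a - c k) * N i (suc k)
      col i = begin
        M i (suc k) + c′ k * M i zero
          ≈⟨ +-congˡ (*-congʳ (reflexive (updateAt-updates k c))) ⟩
        M i (suc k) + a * M i zero
          ≈⟨ solve 4 (λ x y a b → x :+ a :* y := x :+ b :* y :+ (a :- b) :* y) refl
               (M i (suc k)) (M i zero) a (c k) ⟩
        M i (suc k) + c k * M i zero + (a - c k) * M i zero
          ≈⟨ +-cong (*-identityˡ _) (*-congˡ (reflexive (updateAt-updates (suc k) (addCol₀ M c i)))) ⟨
        1# * (M i (suc k) + c k * M i zero) + (a - c k) * N i (suc k) ∎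

      same₁ : ∀ i j → j ≢ suc k → addCol₀ M c′ i j ≈ addCol₀ M c i j
      same₁ i zero    _ = refl
      same₁ i (suc j) p = +-congˡ (*-congʳ (reflexive (updateAt-minimal j k c (p ∘ ≡.cong suc))))

      same₂ : ∀ i j → j ≢ suc k → addCol₀ M c′ i j ≈ N i j
      same₂ i j p = trans (same₁ i j p) (sym (reflexive (updateAt-minimal j (suc k) (addCol₀ M c i) p)))

  -- The Schur complement of the corner entry, with `r` in the role of its inverse. As an argument,
  -- `r` may come from under a double negation. The rectangular shape serves `wide-kernel`.
  schur : ∀ {m n} → (Fin (suc m) → Vector Carrier (suc n)) → Carrier → Fin m → Vector Carrier n
  schur K r i j = K (suc i) (suc j) - K (suc i) zero * (r * K zero (suc j))

  det-first-row : ∀ {n} (M : Matrix (suc n)) → (∀ j → M zero (suc j) ≈ 0#) →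
    det M ≈ M zero zero * det (minor M zero)
  det-first-row M eq = begin
    det M
      ≈⟨ trans (det-suc M) (∑-suc _) ⟩
    1# * (M zero zero * det (minor M zero)) + ∑ _
      ≈⟨ +-cong (*-identityˡ _) (∑-zero λ j →
           trans (*-congˡ (trans (*-congʳ (eq j)) (zeroˡ _))) (zeroʳ _)) ⟩
    M zero zero * det (minor M zero) + 0#
      ≈⟨ +-identityʳ _ ⟩
    M zero zero * det (minor M zero) ∎

  -- Multiples of the zeroth column clear the rest of the first row, and what remains in the minor
  -- is the Schur complement.
  det-schur : ∀ {n} (K : Matrix (suc n)) r → K zero zero * r ≈ 1# → det K ≈ K zero zero * det (schur K r)
  det-schur {n} K r inv = begin
    det K
      ≈⟨ det-addCol₀ K c ⟨
    det (addCol₀ K c)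
      ≈⟨ det-first-row (addCol₀ K c) (λ j → begin
           K zero (suc j) + - (r * K zero (suc j)) * K zero zero
             ≈⟨ solve 3 (λ k r a → k :+ :- (r :* k) :* a := k :- (a :* r) :* k) refl _ _ _ ⟩
           K zero (suc j) - K zero zero * r * K zero (suc j)
             ≈⟨ +-congˡ (-‿cong (trans (*-congʳ inv) (*-identityˡ _))) ⟩
           K zero (suc j) - K zero (suc j)
             ≈⟨ -‿inverseʳ _ ⟩
           0# ∎) ⟩
    K zero zero * det (minor (addCol₀ K c) zero)
      ≈⟨ *-congˡ (det-cong λ i j →
           solve 4 (λ k r a b → k :+ :- (r :* a) :* b := k :- b :* (r :* a)) refl _ _ _ _) ⟩
    K zero zero * det (schur K r) ∎
    where
    c : Vector Carrier n
    c j = - (r * K zero (suc j))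

  -- Order

  -- _≤_ is a negation and _≈_ is tight, so goals of either form may be
  -- proved in the double-negation monad.
  infix 4 _≤_
  _≤_ : Carrier → Carrier → Set
  x ≤ y = ¬ y < x

  infixl 1 _>>=_
  _>>=_ : ∀ {A B : Set} → ¬ ¬ A → (A → ¬ B) → ¬ B
  (m >>= f) b = m λ a → f a b

  return : ∀ {A : Set} → A → ¬ ¬ A
  return a k = k a

  excluded-middle : ∀ (A : Set) → ¬ ¬ (A ⊎ ¬ A)
  excluded-middle A k = k (inj₂ (k ∘ inj₁))

  <-irrefl : ∀ {x y} → x ≈ y → ¬ x < y
  <-irrefl x≈y x<y = <-asym x<y (<-resp-≈ x≈y (sym x≈y) x<y)

  ≈-stable : ∀ {x y} → ¬ ¬ x ≈ y → x ≈ y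
  ≈-stable ¬¬x≈y = tight (λ x<y → ¬¬x≈y λ x≈y → <-irrefl x≈y x<y)
                         (λ y<x → ¬¬x≈y λ x≈y → <-irrefl (sym x≈y) y<x)

  ≤-reflexive : ∀ {x y} → x ≈ y → x ≤ y
  ≤-reflexive x≈y = <-irrefl (sym x≈y)

  ≤-trans : ∀ {x y z} → x ≤ y → y ≤ z → x ≤ z
  ≤-trans {y = y} x≤y y≤z z<x with <-cotrans z<x y
  ... | inj₁ z<y = y≤z z<y
  ... | inj₂ y<x = x≤y y<x

  <-≤-trans : ∀ {x y z} → x < y → y ≤ z → x < z
  <-≤-trans {z = z} x<y y≤z with <-cotrans x<y z
  ... | inj₁ x<z = x<z
  ... | inj₂ z<y = contradiction z<y y≤z

  <⇒≤ : ∀ {x y} → x < y → x ≤ y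
  <⇒≤ = <-asym

  <⇒≉ : ∀ {x y} → x < y → ¬ y ≈ x
  <⇒≉ x<y y≈x = <-irrefl (sym y≈x) x<y

  ≤-resp-≈ : ∀ {x x′ y y′} → x ≈ x′ → y ≈ y′ → x ≤ y → x′ ≤ y′
  ≤-resp-≈ x≈x′ y≈y′ x≤y y′<x′ = x≤y (<-resp-≈ (sym y≈y′) (sym x≈x′) y′<x′)

  x<y⇒0<y-x : ∀ {x y} → x < y → 0# < y - x
  x<y⇒0<y-x {x} x<y = <-resp-≈ (-‿inverseʳ x) refl (+-monoˡ-< (- x) x<y)

  0<y-x⇒x<y : ∀ {x y} → 0# < y - x → x < y
  0<y-x⇒x<y {x} {y} 0<y-x = <-resp-≈ (+-identityˡ x)
    (solve 2 (λ x y → y :- x :+ x := y) refl x y) (+-monoˡ-< x 0<y-x)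

  x≤y⇒0≤y-x : ∀ {x y} → x ≤ y → 0# ≤ y - x
  x≤y⇒0≤y-x {x} {y} x≤y y-x<0 = x≤y (<-resp-≈
    (solve 2 (λ x y → y :- x :+ x := y) refl x y) (+-identityˡ x) (+-monoˡ-< x y-x<0))

  0≤y-x⇒x≤y : ∀ {x y} → 0# ≤ y - x → x ≤ y
  0≤y-x⇒x≤y {x} 0≤y-x y<x = 0≤y-x (<-resp-≈ refl (-‿inverseʳ x) (+-monoˡ-< (- x) y<x))

  x<0⇒0<-x : ∀ {x} → x < 0# → 0# < - x
  x<0⇒0<-x {x} x<0 = <-resp-≈ refl (+-identityˡ (- x)) (x<y⇒0<y-x x<0)

  +-mono-≤ : ∀ {x y u v} → x ≤ y → u ≤ v → x + u ≤ y + v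
  +-mono-≤ {x} {y} {u} {v} x≤y u≤v = ≤-trans
    (shift x≤y (solve 3 (λ x y u → y :- x := (y :+ u) :- (x :+ u)) refl x y u))
    (shift u≤v (solve 3 (λ u v y → v :- u := (y :+ v) :- (y :+ u)) refl u v y))
    where
    shift : ∀ {a b c d} → a ≤ b → b - a ≈ d - c → c ≤ d
    shift a≤b eq = 0≤y-x⇒x≤y (≤-resp-≈ refl eq (x≤y⇒0≤y-x a≤b))

  +-nonneg : ∀ {x y} → 0# ≤ x → 0# ≤ y → 0# ≤ x + y
  +-nonneg 0≤x 0≤y = ≤-resp-≈ (+-identityˡ 0#) refl (+-mono-≤ 0≤x 0≤y)

  ≤⇒<⊎≈ : ∀ {x y} → x ≤ y → ¬ ¬ (x < y ⊎ x ≈ y)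
  ≤⇒<⊎≈ x≤y k = k (inj₂ (tight (k ∘ inj₁) x≤y))

  *-nonneg : ∀ {x y} → 0# ≤ x → 0# ≤ y → 0# ≤ x * y
  *-nonneg {x} {y} 0≤x 0≤y = ≤⇒<⊎≈ 0≤x >>= λ where
    (inj₂ 0≈x) → ≤-reflexive (sym (trans (*-congʳ (sym 0≈x)) (zeroˡ y)))
    (inj₁ 0<x) → ≤⇒<⊎≈ 0≤y >>= λ where
      (inj₂ 0≈y) → ≤-reflexive (sym (trans (*-congˡ (sym 0≈y)) (zeroʳ x)))
      (inj₁ 0<y) → <⇒≤ (*-pos 0<x 0<y)

  *-monoˡ-≤ : ∀ {a x y} → 0# ≤ a → x ≤ y → a * x ≤ a * y
  *-monoˡ-≤ {a} {x} {y} 0≤a x≤y = 0≤y-x⇒x≤y (≤-resp-≈ refl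
    (solve 3 (λ a x y → a :* (y :- x) := a :* y :- a :* x) refl a x y) (*-nonneg 0≤a (x≤y⇒0≤y-x x≤y)))

  x*x-nonneg : ∀ x → 0# ≤ x * x
  x*x-nonneg x = excluded-middle (x < 0#) >>= λ where
    (inj₁ x<0) → ≤-resp-≈ refl (solve 1 (λ x → :- x :* :- x := x :* x) refl x)
                   (<⇒≤ (*-pos (x<0⇒0<-x x<0) (x<0⇒0<-x x<0)))
    (inj₂ 0≤x) → *-nonneg 0≤x 0≤x

  -- `inverse` needs a positive element, and for a nonzero `x` the sign is known only up to double
  -- negation.
  reciprocal : ∀ {x} → ¬ x ≈ 0# → ¬ ¬ ∃ λ y → x * y ≈ 1#
  reciprocal {x} x≉0 k = x≉0 (tight
    (λ x<0 → let y , _ , -xy≈1 = inverse (x<0⇒0<-x x<0) in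
      k (- y , trans (solve 2 (λ x y → x :* :- y := :- x :* y) refl x y) -xy≈1))
    (λ 0<x → let y , _ , xy≈1 = inverse 0<x in k (y , xy≈1)))

  *-cancelˡ-0 : ∀ {x y} → ¬ x ≈ 0# → x * y ≈ 0# → y ≈ 0#
  *-cancelˡ-0 {x} {y} x≉0 xy≈0 = ≈-stable do
    r , xr≈1 ← reciprocal x≉0
    return (begin
      y            ≈⟨ *-identityˡ y ⟨
      1# * y       ≈⟨ *-congʳ xr≈1 ⟨
      x * r * y    ≈⟨ solve 3 (λ x r y → x :* r :* y := r :* (x :* y)) refl x r y ⟩
      r * (x * y)  ≈⟨ *-congˡ xy≈0 ⟩
      r * 0#       ≈⟨ zeroʳ r ⟩
      0#           ∎)

  *-cancelˡ : ∀ {a x y} → ¬ a ≈ 0# → a * x ≈ a * y → x ≈ y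
  *-cancelˡ {a} {x} {y} a≉0 ax≈ay = begin
    x         ≈⟨ solve 2 (λ x y → x := (x :- y) :+ y) refl x y ⟩
    x - y + y ≈⟨ +-congʳ (*-cancelˡ-0 a≉0 (begin
      a * (x - y)   ≈⟨ solve 3 (λ a x y → a :* (x :- y) := a :* x :- a :* y) refl a x y ⟩
      a * x - a * y ≈⟨ +-congʳ ax≈ay ⟩
      a * y - a * y ≈⟨ -‿inverseʳ _ ⟩
      0#            ∎)) ⟩
    0# + y    ≈⟨ +-identityˡ y ⟩
    y         ∎

  NonZero : ∀ {n} → Vector Carrier n → Set
  NonZero x = ∃ λ i → ¬ x i ≈ 0#

  zero⊎nonZero : ∀ {n} (x : Vector Carrier n) → ¬ ¬ ((∀ i → x i ≈ 0#) ⊎ NonZero x)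
  zero⊎nonZero x = excluded-middle (NonZero x) >>= λ where
    (inj₁ x≉0) → return (inj₂ x≉0)
    (inj₂ x≈0) → return (inj₁ λ i → ≈-stable λ xᵢ≉0 → x≈0 (i , xᵢ≉0))

  nonZero-⇒ : ∀ {m n} {x : Vector Carrier m} {y : Vector Carrier n} → NonZero x →
    ((∀ i → y i ≈ 0#) → ∀ i → x i ≈ 0#) → ¬ ¬ NonZero y
  nonZero-⇒ {y = y} (i , xᵢ≉0) impl = zero⊎nonZero y >>= λ where
    (inj₁ y≈0) → λ _ → xᵢ≉0 (impl y≈0 i)
    (inj₂ y≉0) → return y≉0

  ∑-nonneg : ∀ {n} (f : Vector Carrier n) → (∀ i → 0# ≤ f i) → 0# ≤ ∑ f
  ∑-nonneg {zero}  f 0≤f = ≤-reflexive (sym (∑-empty f))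
  ∑-nonneg {suc n} f 0≤f = ≤-resp-≈ refl (sym (∑-suc f))
    (+-nonneg (0≤f zero) (∑-nonneg (tail f) (0≤f ∘ suc)))

  ∑-mono-≤ : ∀ {n} {f g : Vector Carrier n} → (∀ i → f i ≤ g i) → ∑ f ≤ ∑ g
  ∑-mono-≤ {zero}          f≤g = ≤-reflexive (trans (∑-empty _) (sym (∑-empty _)))
  ∑-mono-≤ {suc n} {f} {g} f≤g = ≤-resp-≈ (sym (∑-suc f)) (sym (∑-suc g))
    (+-mono-≤ (f≤g zero) (∑-mono-≤ (f≤g ∘ suc)))

  ∑-term-≤ : ∀ {n} (f : Vector Carrier n) → (∀ i → 0# ≤ f i) → ∀ i → f i ≤ ∑ f
  ∑-term-≤ f 0≤f zero    = ≤-resp-≈ (+-identityʳ _) (sym (∑-suc f))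
    (+-mono-≤ (≤-reflexive refl) (∑-nonneg (tail f) (0≤f ∘ suc)))
  ∑-term-≤ f 0≤f (suc i) = ≤-resp-≈ (+-identityˡ _) (sym (∑-suc f))
    (+-mono-≤ (0≤f zero) (∑-term-≤ (tail f) (0≤f ∘ suc) i))

  x*x≤0⇒x≈0 : ∀ {x} → x * x ≤ 0# → x ≈ 0#
  x*x≤0⇒x≈0 {x} x*x≤0 = ≈-stable λ x≉0 → x≉0 (*-cancelˡ-0 x≉0 (tight x*x≤0′ x*x≤0))
    where x*x≤0′ = x*x-nonneg x

  ∙-definite : ∀ {n} (x : Vector Carrier n) → x ∙ x ≤ 0# → ∀ i → x i ≈ 0#
  ∙-definite x x∙x≤0 i = x*x≤0⇒x≈0 (≤-trans (∑-term-≤ _ (λ i → x*x-nonneg (x i)) i) x∙x≤0)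

  -- Gaussian elimination

  ∙-zeroʳ : ∀ {n} (x : Vector Carrier n) {y : Vector Carrier n} → (∀ i → y i ≈ 0#) → x ∙ y ≈ 0#
  ∙-zeroʳ x y≈0 = ∑-zero λ i → trans (*-congˡ (y≈0 i)) (zeroʳ (x i))

  ∙-zeroˡ : ∀ {n} {x : Vector Carrier n} (y : Vector Carrier n) → (∀ i → x i ≈ 0#) → x ∙ y ≈ 0#
  ∙-zeroˡ y x≈0 = trans (∙-comm _ y) (∙-zeroʳ y x≈0)

  ∙-assoc : ∀ {m n} (u : Vector Carrier m) (K : Fin m → Vector Carrier n) (v : Vector Carrier n) →
    u ∙ (K · v) ≈ (λ j → u ∙ λ i → K i j) ∙ v
  ∙-assoc u K v = begin
    ∑ (λ i → u i * ∑ λ j → K i j * v j)   ≈⟨ ∑-cong (λ i → *-distribˡ-∑ (u i) _) ⟩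
    ∑ (λ i → ∑ λ j → u i * (K i j * v j)) ≈⟨ ∑-swap _ ⟩
    ∑ (λ j → ∑ λ i → u i * (K i j * v j))
      ≈⟨ ∑-cong (λ j → trans
           (∑-cong λ i → solve 3 (λ u k v → u :* (k :* v) := v :* (u :* k)) refl (u i) (K i j) (v j))
           (trans (sym (*-distribˡ-∑ (v j) _)) (*-comm _ _))) ⟩
    ∑ (λ j → (∑ λ i → u i * K i j) * v j) ∎

  -- Replaces the exchange of columns in Gaussian elimination: a combination of the other entries is
  -- added to the zeroth. If `x zero` vanishes, the coefficients `tail x` serve, since they produce
  -- the sum of the squares of the entries.
  pivot : ∀ {n} (x : Vector Carrier (suc n)) → NonZero x → ¬ ¬ ∃ λ c → ¬ x ∙ (1# ∷ᵛ c) ≈ 0#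
  pivot x x≉0 = excluded-middle (x zero ≈ 0#) >>= λ where
      (inj₂ x₀≉0) → return (const 0# , λ eq → x₀≉0 (begin
        x zero                               ≈⟨ trans (+-congʳ (*-identityʳ _)) (+-identityʳ _) ⟨
        x zero * 1# + 0#                     ≈⟨ +-congˡ (∙-zeroʳ (tail x) λ _ → refl) ⟨
        x zero * 1# + tail x ∙ const 0#      ≈⟨ ∙-suc _ _ ⟨
        x ∙ (1# ∷ᵛ const 0#)                 ≈⟨ eq ⟩
        0#                                   ∎))
      (inj₁ x₀≈0) → nonZero-tail x₀≈0 >>= λ (i , xᵢ≉0) → return (tail x , λ eq →
        xᵢ≉0 (∙-definite (tail x) (≤-reflexive (begin
          tail x ∙ tail x                    ≈⟨ +-identityˡ _ ⟨
          0# + tail x ∙ tail x               ≈⟨ +-congʳ (trans (*-identityʳ _) x₀≈0) ⟨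
          x zero * 1# + tail x ∙ tail x      ≈⟨ ∙-suc _ _ ⟨
          x ∙ (1# ∷ᵛ tail x)                 ≈⟨ eq ⟩
          0#                                 ∎)) i))
    where
    nonZero-tail : x zero ≈ 0# → ¬ ¬ NonZero (tail x)
    nonZero-tail x₀≈0 = nonZero-⇒ x≉0 λ where
      x₊≈0 zero    → x₀≈0
      x₊≈0 (suc i) → x₊≈0 i

  IsKernel : ∀ {m n} → (Fin m → Vector Carrier n) → Vector Carrier n → Set
  IsKernel K v = NonZero v × ∀ i → (K · v) i ≈ 0#

  pivoted : ∀ {m n} → (Fin m → Vector Carrier (suc n)) → Vector Carrier n → Fin m → Vector Carrier (suc n)
  pivoted K c = setCol₀ K (K · (1# ∷ᵛ c))

  -- Back substitution: `v₀` solves the zeroth equation, and inserting it into the others leaves the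
  -- equations of the Schur complement.
  schur-kernel : ∀ {m n} (K : Fin (suc m) → Vector Carrier (suc n)) c r →
    pivoted K c zero zero * r ≈ 1# →
    ∀ y → IsKernel (schur (pivoted K c) r) y → ¬ ¬ ∃ (IsKernel K)
  schur-kernel {m} {n} K c r inv y (y≉0 , Sy≈0) =
    nonZero-⇒ {y = v} y≉0 v≈0⇒y≈0 >>= λ v≉0 → return (v , v≉0 , Kv≈0)
    where
    s v₀ : Carrier
    s  = tail (K zero) ∙ y
    v₀ = - (r * s)

    K′ : Fin (suc m) → Vector Carrier (suc n)
    K′ = pivoted K c

    v : Vector Carrier (suc n)
    -- The multiple of `c` undoes the column operation in `pivoted`: `K · v` is `K′` applied to
    -- `v₀ ∷ᵛ y`.
    v = v₀ ∷ᵛ λ j → 1# * y j + v₀ * c j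

    v≈0⇒y≈0 : (∀ i → v i ≈ 0#) → ∀ i → y i ≈ 0#
    v≈0⇒y≈0 v≈0 i = begin
      y i                      ≈⟨ +-identityʳ _ ⟨
      y i + 0#                 ≈⟨ +-cong (*-identityˡ _) (trans (*-congʳ (v≈0 zero)) (zeroˡ _)) ⟨
      1# * y i + v₀ * c i      ≈⟨ v≈0 (suc i) ⟩
      0#                       ∎

    Kv : ∀ i → (K · v) i ≈ v₀ * K′ i zero + tail (K i) ∙ y
    Kv i = begin
      K i ∙ v
        ≈⟨ ∙-suc _ _ ⟩
      K i zero * v₀ + (tail (K i) ∙ λ j → 1# * y j + v₀ * c j)
        ≈⟨ +-congˡ (trans (∙-linearʳ 1# v₀ _ y c) (+-congʳ (*-identityˡ _))) ⟩
      K i zero * v₀ + (tail (K i) ∙ y + v₀ * tail (K i) ∙ c)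
        ≈⟨ solve 4 (λ k v y c → k :* v :+ (y :+ v :* c) := v :* (k :+ c) :+ y) refl _ _ _ _ ⟩
      v₀ * (K i zero + tail (K i) ∙ c) + tail (K i) ∙ y
        ≈⟨ +-congʳ (*-congˡ (trans (∙-suc _ _) (+-congʳ (*-identityʳ _)))) ⟨
      v₀ * K′ i zero + tail (K i) ∙ y ∎

    Kv≈0 : ∀ i → (K · v) i ≈ 0#
    Kv≈0 zero = begin
      (K · v) zero                        ≈⟨ Kv zero ⟩
      - (r * s) * K′ zero zero + s        ≈⟨ solve 3 (λ r s k → :- (r :* s) :* k :+ s := s :- k :* r :* s) refl r s _ ⟩
      s - K′ zero zero * r * s            ≈⟨ +-congˡ (-‿cong (trans (*-congʳ inv) (*-identityˡ s))) ⟩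
      s - s                               ≈⟨ -‿inverseʳ s ⟩
      0#                                  ∎
    Kv≈0 (suc i) = begin
      (K · v) (suc i)
        ≈⟨ Kv (suc i) ⟩
      - (r * s) * k + tail (K (suc i)) ∙ y
        ≈⟨ solve 4 (λ r s k t → :- (r :* s) :* k :+ t := t :+ :- (k :* r) :* s) refl r s k _ ⟩
      tail (K (suc i)) ∙ y + - (k * r) * s
        ≈⟨ +-congʳ (*-identityˡ _) ⟨
      1# * tail (K (suc i)) ∙ y + - (k * r) * s
        ≈⟨ ∙-linearˡ 1# (- (k * r)) _ _ y ⟨
      (λ j → 1# * K (suc i) (suc j) + - (k * r) * K zero (suc j)) ∙ y
        ≈⟨ ∙-cong (λ j → trans (+-congʳ (*-identityˡ _))
             (solve 4 (λ t k r z → t :+ :- (k :* r) :* z := t :- k :* (r :* z)) refl _ k r _)) (λ _ → refl) ⟩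
      (schur K′ r · y) i
        ≈⟨ Sy≈0 i ⟩
      0# ∎
      where k = K′ (suc i) zero

  -- A vanishing top row is dropped together with a column, and the kernel vector is extended by
  -- zero; otherwise the Schur complement again has one column more than rows.
  wide-kernel : ∀ {n} (K : Fin n → Vector Carrier (suc n)) → ¬ ¬ ∃ (IsKernel K)
  wide-kernel {zero}  K = return (const 1# , (zero , <⇒≉ 0<1) , λ ())
  wide-kernel {suc n} K = zero⊎nonZero (K zero) >>= λ where
    (inj₁ K₀≈0) → do
      v , (i , vᵢ≉0) , Kv≈0 ← wide-kernel (λ i → tail (K (suc i)))
      return (0# ∷ᵛ v , (suc i , vᵢ≉0) , λ where
        zero    → ∙-zeroˡ _ K₀≈0
        (suc i) → trans (∙-suc _ _) (trans (+-cong (zeroʳ _) (Kv≈0 i)) (+-identityˡ 0#)))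
    (inj₂ K₀≉0) → do
      c , p≉0 ← pivot (K zero) K₀≉0
      r , pr≈1 ← reciprocal p≉0
      y , Sy≈0 ← wide-kernel (schur (pivoted K c) r)
      schur-kernel K c r pr≈1 y Sy≈0

  det-pivoted : ∀ {n} (K : Matrix (suc n)) c → det (pivoted K c) ≈ det K
  det-pivoted K c = trans (det-combine-cols K (1# ∷ᵛ c)) (*-identityˡ _)

  -- If the top row vanishes, the remaining rows form a wide matrix; otherwise the pivot cancels
  -- from the determinant and the Schur complement is singular too.
  singular⇒kernel : ∀ {n} (K : Matrix n) → det K ≈ 0# → ¬ ¬ ∃ (IsKernel K)
  singular⇒kernel {zero}  K detK≈0 = λ _ → <⇒≉ 0<1 (trans (sym (det-empty K)) detK≈0)
  singular⇒kernel {suc n} K detK≈0 = zero⊎nonZero (K zero) >>= λ where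
    (inj₁ K₀≈0) → do
      v , v≉0 , Kv≈0 ← wide-kernel (tail K)
      return (v , v≉0 , λ where
        zero    → ∙-zeroˡ _ K₀≈0
        (suc i) → Kv≈0 i)
    (inj₂ K₀≉0) → do
      c , p≉0 ← pivot (K zero) K₀≉0
      r , pr≈1 ← reciprocal p≉0
      y , Sy≈0 ← singular⇒kernel (schur (pivoted K c) r)
        (*-cancelˡ-0 p≉0 (trans (sym (det-schur (pivoted K c) r pr≈1)) (trans (det-pivoted K c) detK≈0)))
      schur-kernel K c r pr≈1 y Sy≈0

  -- Gives access to row operations without transposing determinants. The relation `u` survives
  -- `pivoted`, and its tail is a relation for the Schur complement; the tail is nonzero because the
  -- zeroth column, with its nonzero pivot, determines `u zero` from it.
  dependent-rows⇒singular : ∀ {n} (K : Matrix n) (u : Vector Carrier n) → NonZero u →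
    (∀ j → (u ∙ λ i → K i j) ≈ 0#) → det K ≈ 0#
  dependent-rows⇒singular {suc n} K u u≉0 uK≈0 = ≈-stable (zero⊎nonZero (K zero) >>= λ where
      (inj₁ K₀≈0) → return (trans (det-first-row K (K₀≈0 ∘ suc)) (trans (*-congʳ (K₀≈0 zero)) (zeroˡ _)))
      (inj₂ K₀≉0) → do
        c , p≉0 ← pivot (K zero) K₀≉0
        r , pr≈1 ← reciprocal p≉0
        u₊≉0 ← nonZero-⇒ {y = tail u} u≉0 (tail-zero c p≉0)
        return (begin
          det K                                     ≈⟨ det-pivoted K c ⟨
          det (pivoted K c)                         ≈⟨ det-schur (pivoted K c) r pr≈1 ⟩
          pivoted K c zero zero * det (schur (pivoted K c) r)
            ≈⟨ *-congˡ (dependent-rows⇒singular (schur (pivoted K c) r) (tail u) u₊≉0 (uS≈0 c r pr≈1)) ⟩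
          pivoted K c zero zero * 0#                ≈⟨ zeroʳ _ ⟩
          0#                                        ∎))
    where
    uK′≈0 : ∀ c j → (u ∙ λ i → pivoted K c i j) ≈ 0#
    uK′≈0 c (suc j) = uK≈0 (suc j)
    uK′≈0 c zero    = trans (∙-assoc u K (1# ∷ᵛ c)) (∙-zeroˡ _ uK≈0)

    tail-zero : ∀ c → ¬ pivoted K c zero zero ≈ 0# → (∀ i → tail u i ≈ 0#) → ∀ i → u i ≈ 0#
    tail-zero c p≉0 u₊≈0 (suc i) = u₊≈0 i
    tail-zero c p≉0 u₊≈0 zero    = *-cancelˡ-0 p≉0 (begin
      pivoted K c zero zero * u zero      ≈⟨ trans (*-comm _ _) (sym (+-identityʳ _)) ⟩
      u zero * pivoted K c zero zero + 0# ≈⟨ +-congˡ (∙-zeroˡ _ u₊≈0) ⟨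
      u zero * pivoted K c zero zero + (tail u ∙ λ i → pivoted K c (suc i) zero)
                                          ≈⟨ ∙-suc _ _ ⟨
      (u ∙ λ i → pivoted K c i zero)      ≈⟨ uK′≈0 c zero ⟩
      0#                                  ∎)

    uS≈0 : ∀ c r → pivoted K c zero zero * r ≈ 1# → ∀ j → (tail u ∙ λ i → schur (pivoted K c) r i j) ≈ 0#
    uS≈0 c r pr≈1 j = begin
      (tail u ∙ λ i → K (suc i) (suc j) - K′ (suc i) zero * (r * K zero (suc j)))
        ≈⟨ ∙-cong {x = tail u} (λ _ → refl) (λ i → trans
             (solve 4 (λ t k r z → t :- k :* (r :* z) := t :+ :- (r :* z) :* k) refl _ _ _ _)
             (+-congʳ (sym (*-identityˡ _)))) ⟩
      (tail u ∙ λ i → 1# * K (suc i) (suc j) + - (r * K zero (suc j)) * K′ (suc i) zero)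
        ≈⟨ trans (∙-linearʳ 1# _ (tail u) _ _) (+-congʳ (*-identityˡ _)) ⟩
      a + - (r * k) * b
        -- The first two brackets become the dot products of `u` with columns of `K` and `K′`; the
        -- last one vanishes because `p * r ≈ 1#`.
        ≈⟨ solve 6 (λ a r k b u p → a :+ :- (r :* k) :* b :=
             (u :* k :+ a) :- (r :* k) :* (u :* p :+ b) :- (u :* k :- p :* r :* (u :* k))) refl a r k b (u zero) p ⟩
      (u zero * k + a) - (r * k) * (u zero * p + b) - (u zero * k - p * r * (u zero * k))
        ≈⟨ +-cong (+-cong (trans (sym (∙-suc _ _)) (uK≈0 (suc j)))
             (-‿cong (trans (*-congˡ (trans (sym (∙-suc _ _)) (uK′≈0 c zero))) (zeroʳ _))))
             (-‿cong (trans (+-congˡ (-‿cong (trans (*-congʳ pr≈1) (*-identityˡ _)))) (-‿inverseʳ _))) ⟩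
      0# - 0# - 0#
        ≈⟨ trans (+-cong (-‿inverseʳ 0#) -0#≈0#) (+-identityˡ 0#) ⟩
      0# ∎
      where
      K′ = pivoted K c
      p  = K′ zero zero
      k  = K zero (suc j)
      a  = tail u ∙ λ i → K (suc i) (suc j)
      b  = tail u ∙ λ i → K′ (suc i) zero

  -- Polynomial functions

  -- A constructive stand-in for "f is a polynomial": f can be divided by
  -- t - a for every a, and iterating this terminates.
  data IsPolynomial (f : Carrier → Carrier) : Set where
    constant : (∀ s t → f s ≈ f t) → IsPolynomial f
    division : (q : Carrier → Carrier → Carrier) → (∀ a → IsPolynomial (q a)) →
               (∀ a t → f t ≈ f a + (t - a) * q a t) → IsPolynomial f

  polynomial-cong : ∀ {f g} → (∀ t → f t ≈ g t) → IsPolynomial f → IsPolynomial g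
  polynomial-cong f≈g (constant c)      = constant λ s t → trans (sym (f≈g s)) (trans (c s t) (f≈g t))
  polynomial-cong f≈g (division q p eq) = division q p λ a t →
    trans (sym (f≈g t)) (trans (eq a t) (+-congʳ (f≈g a)))

  polynomial-scale : ∀ c {f} → IsPolynomial f → IsPolynomial (λ t → c * f t)
  polynomial-scale c (constant k)          = constant λ s t → *-congˡ (k s t)
  polynomial-scale c {f} (division q p eq) = division (λ a t → c * q a t) (λ a → polynomial-scale c (p a)) λ a t →
    trans (*-congˡ (eq a t))
      (solve 4 (λ c x y z → c :* (x :+ y :* z) := c :* x :+ y :* (c :* z)) refl c (f a) (t - a) (q a t))

  polynomial-+ : ∀ {f g} → IsPolynomial f → IsPolynomial g → IsPolynomial (λ t → f t + g t)
  polynomial-+ (constant c) (constant d) = constant λ s t → +-cong (c s t) (d s t)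
  polynomial-+ {f} {g} (constant c) (division q p eq) = division q p λ a t →
    trans (+-cong (c t a) (eq a t)) (sym (+-assoc (f a) (g a) _))
  polynomial-+ {f} {g} (division q p eq) (constant d) = division q p λ a t →
    trans (+-cong (eq a t) (d t a))
      (solve 3 (λ x y z → x :+ z :+ y := x :+ y :+ z) refl (f a) (g a) _)
  polynomial-+ {f} {g} (division q p eq) (division q′ p′ eq′) =
    division (λ a t → q a t + q′ a t) (λ a → polynomial-+ (p a) (p′ a)) λ a t →
      trans (+-cong (eq a t) (eq′ a t))
        (solve 5 (λ x y z u v → x :+ z :* u :+ (y :+ z :* v) := x :+ y :+ z :* (u :+ v))
          refl (f a) (g a) (t - a) (q a t) (q′ a t))

  -- The product rule for divided differences. Leaving `f t` undivided in the first summand keeps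
  -- the recursion on the second argument.
  polynomial-* : ∀ {f g} → IsPolynomial f → IsPolynomial g → IsPolynomial (λ t → f t * g t)
  polynomial-* {f} {g} (constant c) pg = polynomial-cong (λ t → *-congʳ (c 0# t)) (polynomial-scale (f 0#) pg)
  polynomial-* {f} {g} pf@(division _ _ _) (constant d) =
    polynomial-cong (λ t → trans (*-comm _ _) (*-congˡ (d 0# t))) (polynomial-scale (g 0#) pf)
  polynomial-* {f} {g} pf@(division q p eq) (division q′ p′ eq′) = division
    (λ a t → f t * q′ a t + g a * q a t)
    (λ a → polynomial-+ (polynomial-* pf (p′ a)) (polynomial-scale (g a) (p a)))
    λ a t → begin
      f t * g t
        ≈⟨ *-congˡ (eq′ a t) ⟩
      f t * (g a + (t - a) * q′ a t)
        ≈⟨ solve 4 (λ x y z u → x :* (y :+ z :* u) := x :* y :+ z :* (x :* u)) refl (f t) (g a) (t - a) (q′ a t) ⟩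
      f t * g a + (t - a) * (f t * q′ a t)
        ≈⟨ +-congʳ (*-congʳ (eq a t)) ⟩
      (f a + (t - a) * q a t) * g a + (t - a) * (f t * q′ a t)
        ≈⟨ solve 5 (λ x z u y w → (x :+ z :* u) :* y :+ z :* w := x :* y :+ z :* (w :+ y :* u))
             refl (f a) (t - a) (q a t) (g a) (f t * q′ a t) ⟩
      f a * g a + (t - a) * (f t * q′ a t + g a * q a t) ∎

  polynomial-∑ : ∀ {n} (f : Fin n → Carrier → Carrier) → (∀ i → IsPolynomial (f i)) →
    IsPolynomial (λ t → ∑ λ i → f i t)
  polynomial-∑ {zero}  f p = constant λ s t → trans (∑-empty _) (sym (∑-empty _))
  polynomial-∑ {suc n} f p = polynomial-cong (λ t → sym (∑-suc _))
    (polynomial-+ (p zero) (polynomial-∑ (f ∘ suc) (p ∘ suc)))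

  polynomial-det : ∀ {n} (K : Carrier → Matrix n) → (∀ i j → IsPolynomial (λ t → K t i j)) →
    IsPolynomial (λ t → det (K t))
  polynomial-det {zero}  K p = constant λ s t → trans (det-empty _) (sym (det-empty _))
  polynomial-det {suc n} K p = polynomial-cong (λ t → sym (det-suc (K t)))
    (polynomial-∑ _ λ j → polynomial-scale _ (polynomial-* (p zero j)
      (polynomial-det (λ t → minor (K t) j) λ i k → p (suc i) (punchIn j k))))

  polynomial-linear : ∀ a b → IsPolynomial (λ t → t * a + b)
  polynomial-linear a b = division (λ _ _ → a) (λ _ → constant λ _ _ → refl) λ s t →
    solve 4 (λ s t a b → t :* a :+ b := s :* a :+ b :+ (t :- s) :* a) refl s t a b

  polynomial-product : ∀ {n} (Λ : Vector Carrier n) → IsPolynomial (λ t → product λ i → t - Λ i)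
  polynomial-product {zero}  Λ = constant λ _ _ → refl
  polynomial-product {suc n} Λ = polynomial-*
    (polynomial-cong (λ t → +-congʳ (*-identityʳ t)) (polynomial-linear 1# (- Λ zero)))
    (polynomial-product (tail Λ))

  x<x+1 : ∀ x → x < x + 1#
  x<x+1 x = <-resp-≈ (+-identityˡ x) (+-comm 1# x) (+-monoˡ-< x 0<1)

  x<y⇒y-x≉0 : ∀ {x y} → x < y → ¬ y - x ≈ 0#
  x<y⇒y-x≉0 x<y = <⇒≉ (x<y⇒0<y-x x<y)

  -- Division at the root `L + 1#` leaves a quotient that vanishes beyond it, where `s - a` is
  -- nonzero; by induction the quotient vanishes everywhere.
  polynomial-vanishes : ∀ {f} → IsPolynomial f → ∀ L → (∀ t → L < t → f t ≈ 0#) → ∀ t → f t ≈ 0#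
  polynomial-vanishes (constant c) L f≈0 t = trans (c t (L + 1#)) (f≈0 (L + 1#) (x<x+1 L))
  polynomial-vanishes {f} (division q p eq) L f≈0 t = begin
    f t                   ≈⟨ eq a t ⟩
    f a + (t - a) * q a t ≈⟨ +-cong fa≈0 (trans (*-congˡ (polynomial-vanishes (p a) a qa≈0 t)) (zeroʳ _)) ⟩
    0# + 0#               ≈⟨ +-identityˡ 0# ⟩
    0#                    ∎
    where
    a = L + 1#

    fa≈0 : f a ≈ 0#
    fa≈0 = f≈0 a (x<x+1 L)

    qa≈0 : ∀ s → a < s → q a s ≈ 0#
    qa≈0 s a<s = *-cancelˡ-0 (x<y⇒y-x≉0 a<s) (begin
      (s - a) * q a s        ≈⟨ +-identityˡ _ ⟨
      0# + (s - a) * q a s   ≈⟨ +-congʳ fa≈0 ⟨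
      f a + (s - a) * q a s  ≈⟨ eq a s ⟨
      f s                    ≈⟨ f≈0 s L<s ⟩
      0#                     ∎)
      where
      L<s : L < s
      L<s = <-≤-trans (x<x+1 L) (<⇒≤ a<s)

  -- To the right of `a` the factor is nonzero and cancels. The difference is a polynomial that
  -- vanishes there, hence also at `a` and to its left.
  polynomial-cancel : ∀ {f g} → IsPolynomial f → IsPolynomial g → ∀ a →
    (∀ t → (t - a) * f t ≈ (t - a) * g t) → ∀ t → f t ≈ g t
  polynomial-cancel {f} {g} pf pg a eq t = begin
    f t                       ≈⟨ solve 2 (λ x y → x := (x :- y) :+ y) refl (f t) (g t) ⟩
    f t - g t + g t           ≈⟨ +-congʳ (+-congˡ (-1*x≈-x _)) ⟨
    f t + - 1# * g t + g t    ≈⟨ +-congʳ (polynomial-vanishes (polynomial-+ pf (polynomial-scale (- 1#) pg)) a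
                                   (λ s a<s → trans (+-cong (*-cancelˡ (x<y⇒y-x≉0 a<s) (eq s)) (-1*x≈-x _)) (-‿inverseʳ _)) t) ⟩
    0# + g t                  ≈⟨ +-identityˡ _ ⟩
    g t                       ∎

  -- Characteristic polynomials

  identity : ∀ {n} → Matrix n
  identity i j = if does (i ≟ j) then 1# else 0#

  charPoly : ∀ {n} → Matrix n → Carrier → Carrier
  charPoly M t = det λ i j → t * identity i j - M i j

  polynomial-charPoly : ∀ {n} (M : Matrix n) → IsPolynomial (charPoly M)
  polynomial-charPoly M = polynomial-det _ λ i j → polynomial-linear (identity i j) (- M i j)

  identity-∙ : ∀ {n} (i : Fin n) (x : Vector Carrier n) → identity i ∙ x ≈ x i
  identity-∙ zero    x = trans (∙-suc _ _)
    (trans (+-cong (*-identityˡ _) (∙-zeroˡ _ λ _ → refl)) (+-identityʳ _))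
  identity-∙ (suc i) x = trans (∙-suc _ _)
    (trans (+-cong (zeroˡ _) (identity-∙ i (tail x))) (+-identityˡ _))

  charMatrix-· : ∀ {n} (M : Matrix n) t (x : Vector Carrier n) i →
    (λ j → t * identity i j - M i j) ∙ x ≈ t * x i - (M · x) i
  charMatrix-· M t x i = begin
    (λ j → t * identity i j - M i j) ∙ x
      ≈⟨ ∙-cong (λ j → +-congˡ (sym (-1*x≈-x _))) (λ _ → refl) ⟩
    (λ j → t * identity i j + - 1# * M i j) ∙ x
      ≈⟨ ∙-linearˡ t (- 1#) _ _ x ⟩
    t * identity i ∙ x + - 1# * (M · x) i
      ≈⟨ +-cong (*-congˡ (identity-∙ i x)) (-1*x≈-x _) ⟩
    t * x i - (M · x) i ∎

  det-row₀-+ : ∀ {n} (M : Fin n → Vector Carrier (suc n)) (x y : Vector Carrier (suc n)) →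
    det ((λ j → x j + y j) ∷ᵛ M) ≈ det (x ∷ᵛ M) + det (y ∷ᵛ M)
  det-row₀-+ M x y = begin
    det ((λ j → x j + y j) ∷ᵛ M)
      ≈⟨ det-suc _ ⟩
    ∑ (λ j → s j * ((x j + y j) * d j))
      ≈⟨ ∑-cong (λ j → trans (solve 4 (λ s x y d → s :* ((x :+ y) :* d) := s :* (x :* d) :+ s :* (y :* d))
           refl (s j) (x j) (y j) (d j)) (sym (1*x+1*y _ _))) ⟩
    ∑ (λ j → 1# * (s j * (x j * d j)) + 1# * (s j * (y j * d j)))
      ≈⟨ trans (∑-linear 1# 1# _ _) (1*x+1*y _ _) ⟩
    ∑ (λ j → s j * (x j * d j)) + ∑ (λ j → s j * (y j * d j))
      ≈⟨ +-cong (det-suc _) (det-suc _) ⟨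
    det (x ∷ᵛ M) + det (y ∷ᵛ M) ∎
    where
    s d : Vector Carrier _
    s j = (- 1#) ^ toℕ j
    d j = det (λ i k → M i (punchIn j k))

  -- The relation between the rows is the difference of the unit vectors at `zero` and `suc k`.
  det-equal-rows : ∀ {n} (k : Fin n) (M : Matrix (suc n)) →
    (∀ j → M zero j ≈ M (suc k) j) → det M ≈ 0#
  det-equal-rows k M eq = dependent-rows⇒singular M (1# ∷ᵛ λ i → - 1# * identity k i)
    (zero , <⇒≉ 0<1) λ j → begin
      ((1# ∷ᵛ λ i → - 1# * identity k i) ∙ λ i → M i j)
        ≈⟨ ∙-suc _ _ ⟩
      1# * M zero j + ((λ i → - 1# * identity k i) ∙ λ i → M (suc i) j)
        ≈⟨ +-cong (*-identityˡ _) (trans (∑-cong λ i → *-assoc _ _ _) (sym (*-distribˡ-∑ (- 1#) _))) ⟩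
      M zero j + - 1# * (identity k ∙ λ i → M (suc i) j)
        ≈⟨ +-cong (eq j) (trans (-1*x≈-x _) (-‿cong (identity-∙ k _))) ⟩
      M (suc k) j - M (suc k) j
        ≈⟨ -‿inverseʳ _ ⟩
      0# ∎

  det-addRow : ∀ {n} (k : Fin n) (M : Matrix (suc n)) →
    det ((λ j → M zero j + M (suc k) j) ∷ᵛ tail M) ≈ det M
  det-addRow k M = begin
    det ((λ j → M zero j + M (suc k) j) ∷ᵛ tail M)
      ≈⟨ det-row₀-+ (tail M) (M zero) (M (suc k)) ⟩
    det (M zero ∷ᵛ tail M) + det (M (suc k) ∷ᵛ tail M)
      ≈⟨ +-cong (det-cong λ where
           zero    j → refl
           (suc i) j → refl) (det-equal-rows k _ λ _ → refl) ⟩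
    det M + 0#
      ≈⟨ +-identityʳ _ ⟩
    det M ∎

  -- Deflation eliminates the zeroth coordinate with an eigenvector v.  If
  -- v₀ vanishes, conjugation by the shear x ↦ x + xₖ₊₁ e₀ makes it nonzero.

  shear unshear : ∀ {n} → Fin n → Vector Carrier (suc n) → Vector Carrier (suc n)
  shear   k x = (x zero + x (suc k)) ∷ᵛ tail x
  unshear k x = (x zero - x (suc k)) ∷ᵛ tail x

  -- The product of `M` with the matrix of `unshear k`; `conjugate` multiplies it by the shear from
  -- the left.
  clearShear : ∀ {n} → Fin n → Matrix (suc n) → Matrix (suc n)
  clearShear k M i j = M i j - M i zero * identity (suc k) j

  conjugate : ∀ {n} → Fin n → Matrix (suc n) → Matrix (suc n)
  conjugate k M = (λ j → clearShear k M zero j + clearShear k M (suc k) j) ∷ᵛ tail (clearShear k M)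

  det-clearShear : ∀ {n} (k : Fin n) (M : Matrix (suc n)) → det (clearShear k M) ≈ det M
  det-clearShear k M = trans
    (det-cong λ where
      i zero    → trans (+-congˡ (trans (-‿cong (zeroʳ _)) -0#≈0#)) (+-identityʳ _)
      i (suc j) → +-congˡ (solve 2 (λ m e → :- (m :* e) := :- e :* m) refl _ _))
    (det-addCol₀ M λ j → - identity k j)

  charPoly-conjugate : ∀ {n} (k : Fin n) (M : Matrix (suc n)) t → charPoly (conjugate k M) t ≈ charPoly M t
  charPoly-conjugate {n} k M t = begin
    charPoly (conjugate k M) t ≈⟨ det-cong entries ⟩
    det (conjugate k K)        ≈⟨ det-addRow k (clearShear k K) ⟩
    det (clearShear k K)       ≈⟨ det-clearShear k K ⟩
    charPoly M t               ∎
    where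
    K : Matrix (suc n)
    K i j = t * identity i j - M i j

    0-x : ∀ x → t * 0# - x ≈ - x
    0-x x = trans (+-congʳ (zeroʳ t)) (+-identityˡ _)

    -- Conjugation fixes multiples of the identity, so it commutes with forming the characteristic
    -- matrix.
    entries : ∀ i j → t * identity i j - conjugate k M i j ≈ conjugate k K i j
    entries zero j = begin
      t * δ₀ - (m₀ - m₀₀ * δₖ + (mₖ - mₖ₀ * δₖ))
        ≈⟨ solve 7 (λ t δ₀ δₖ m₀ m₀₀ mₖ mₖ₀ → t :* δ₀ :- (m₀ :- m₀₀ :* δₖ :+ (mₖ :- mₖ₀ :* δₖ)) :=
             t :* δ₀ :- m₀ :- (t :- m₀₀) :* δₖ :+ (t :* δₖ :- mₖ :- :- mₖ₀ :* δₖ))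
             refl t δ₀ δₖ m₀ m₀₀ mₖ mₖ₀ ⟩
      t * δ₀ - m₀ - (t - m₀₀) * δₖ + (t * δₖ - mₖ - - mₖ₀ * δₖ)
        ≈⟨ +-cong (+-congˡ (-‿cong (*-congʳ (+-congʳ (*-identityʳ t)))))
                  (+-congˡ (-‿cong (*-congʳ (0-x mₖ₀)))) ⟨
      conjugate k K zero j ∎
      where
      δ₀  = identity zero j
      δₖ  = identity (suc k) j
      m₀  = M zero j
      m₀₀ = M zero zero
      mₖ  = M (suc k) j
      mₖ₀ = M (suc k) zero
    entries (suc i) j = begin
      t * δ - (m - m₀ * δₖ)
        ≈⟨ solve 5 (λ t δ δₖ m m₀ → t :* δ :- (m :- m₀ :* δₖ) := t :* δ :- m :- :- m₀ :* δₖ) refl t δ δₖ m m₀ ⟩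
      t * δ - m - - m₀ * δₖ
        ≈⟨ +-congˡ (-‿cong (*-congʳ (0-x m₀))) ⟨
      conjugate k K (suc i) j ∎
      where
      δ  = identity (suc i) j
      δₖ = identity (suc k) j
      m  = M (suc i) j
      m₀ = M (suc i) zero

  clearShear-· : ∀ {n} (k : Fin n) (M : Matrix (suc n)) x i → (clearShear k M · x) i ≈ (M · unshear k x) i
  clearShear-· k M x i = begin
    (λ j → M i j - M i zero * identity (suc k) j) ∙ x
      ≈⟨ ∙-cong (λ j → trans (solve 3 (λ a m e → a :- m :* e := a :+ :- m :* e) refl _ _ _)
           (+-congʳ (sym (*-identityˡ _)))) (λ _ → refl) ⟩
    (λ j → 1# * M i j + - M i zero * identity (suc k) j) ∙ x
      ≈⟨ ∙-linearˡ 1# (- M i zero) _ _ x ⟩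
    1# * M i ∙ x + - M i zero * identity (suc k) ∙ x
      ≈⟨ +-cong (trans (*-identityˡ _) (∙-suc _ _)) (*-congˡ (identity-∙ (suc k) x)) ⟩
    M i zero * x zero + tail (M i) ∙ tail x + - M i zero * x (suc k)
      ≈⟨ solve 4 (λ m a b c → m :* a :+ b :+ :- m :* c := m :* (a :- c) :+ b) refl _ _ _ _ ⟩
    M i zero * (x zero - x (suc k)) + tail (M i) ∙ tail x
      ≈⟨ ∙-suc _ _ ⟨
    M i ∙ unshear k x ∎

  conjugate-· : ∀ {n} (k : Fin n) (M : Matrix (suc n)) x i →
    (conjugate k M · x) i ≈ shear k (M · unshear k x) i
  conjugate-· k M x (suc i) = clearShear-· k M x (suc i)
  conjugate-· k M x zero    = begin
    (λ j → clearShear k M zero j + clearShear k M (suc k) j) ∙ x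
      ≈⟨ ∙-cong (λ j → sym (1*x+1*y _ _)) (λ _ → refl) ⟩
    (λ j → 1# * clearShear k M zero j + 1# * clearShear k M (suc k) j) ∙ x
      ≈⟨ trans (∙-linearˡ 1# 1# _ _ x) (1*x+1*y _ _) ⟩
    (clearShear k M · x) zero + (clearShear k M · x) (suc k)
      ≈⟨ +-cong (clearShear-· k M x zero) (clearShear-· k M x (suc k)) ⟩
    shear k (M · unshear k x) zero ∎

  -- Self-adjoint operators and deflation

  _≋_ : ∀ {n} → Vector Carrier n → Vector Carrier n → Set
  x ≋ y = ∀ i → x i ≈ y i

  infix 4 _≋_

  combine : ∀ {n} → Carrier → Carrier → Vector Carrier n → Vector Carrier n → Vector Carrier n
  combine a b x y i = a * x i + b * y i

  ·-cong : ∀ {m n} (M : Fin m → Vector Carrier n) {x y} → x ≋ y → M · x ≋ M · y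
  ·-cong M x≋y i = ∙-cong (λ _ → refl) x≋y

  -- `definite` covers positivity too: a negative `⟪ x , x ⟫` would force `x`, and with it this
  -- value, to be zero.
  record InnerProduct (n : ℕ) : Set where
    infix 10 ⟪_,_⟫
    field
      ⟪_,_⟫    : Vector Carrier n → Vector Carrier n → Carrier
      ⟪⟫-cong  : ∀ {x x′ y y′} → x ≋ x′ → y ≋ y′ → ⟪ x , y ⟫ ≈ ⟪ x′ , y′ ⟫
      ⟪⟫-sym   : ∀ x y → ⟪ x , y ⟫ ≈ ⟪ y , x ⟫
      linearˡ  : ∀ a b x y z → ⟪ combine a b x y , z ⟫ ≈ a * ⟪ x , z ⟫ + b * ⟪ y , z ⟫
      definite : ∀ x → ⟪ x , x ⟫ ≤ 0# → ∀ i → x i ≈ 0#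

    linearʳ : ∀ a b x y z → ⟪ x , combine a b y z ⟫ ≈ a * ⟪ x , y ⟫ + b * ⟪ x , z ⟫
    linearʳ a b x y z = trans (⟪⟫-sym x _) (trans (linearˡ a b y z x)
      (+-cong (*-congˡ (⟪⟫-sym y x)) (*-congˡ (⟪⟫-sym z x))))

    scaleˡ : ∀ {a x y} z → x ≋ (λ i → a * y i) → ⟪ x , z ⟫ ≈ a * ⟪ y , z ⟫
    scaleˡ {a} {x} {y} z x≋ay = begin
      ⟪ x , z ⟫                     ≈⟨ ⟪⟫-cong (λ i → trans (x≋ay i) (sym (trans (+-congˡ (zeroˡ _)) (+-identityʳ _)))) (λ _ → refl) ⟩
      ⟪ combine a 0# y y , z ⟫      ≈⟨ linearˡ a 0# y y z ⟩
      a * ⟪ y , z ⟫ + 0# * ⟪ y , z ⟫ ≈⟨ trans (+-congˡ (zeroˡ _)) (+-identityʳ _) ⟩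
      a * ⟪ y , z ⟫                 ∎

  record SelfAdjoint (n : ℕ) : Set where
    field
      matrix       : Matrix n
      innerProduct : InnerProduct n
    open InnerProduct innerProduct public
    field
      selfAdjoint  : ∀ x y → ⟪ matrix · x , y ⟫ ≈ ⟪ x , matrix · y ⟫

    form : Vector Carrier n → Carrier
    form x = ⟪ x , matrix · x ⟫

    norm : Vector Carrier n → Carrier
    norm x = ⟪ x , x ⟫

  -- S splits orthogonally into an eigenline for Λ₀ and the operator rest.
  -- For an eigenvector v, coordinate x is ⟪ x , v ⟫ and weight is 1/⟪ v , v ⟫.
  record Deflation {n} (S : SelfAdjoint (suc n)) (Λ₀ : Carrier) : Set where
    private module S = SelfAdjoint S
    field
      rest              : SelfAdjoint n
      weight            : Carrier
      coordinate        : Vector Carrier (suc n) → Carrier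
      project           : Vector Carrier (suc n) → Vector Carrier n
    private module R = SelfAdjoint rest
    field
      charPoly-rest     : ∀ t → charPoly S.matrix t ≈ (t - Λ₀) * charPoly R.matrix t
      weight-nonneg     : 0# ≤ weight
      coordinate-cong   : ∀ {x y} → x ≋ y → coordinate x ≈ coordinate y
      coordinate-linear : ∀ a b x y → coordinate (combine a b x y) ≈ a * coordinate x + b * coordinate y
      split-norm        : ∀ x → S.norm x ≈ weight * (coordinate x * coordinate x) + R.norm (project x)
      split-form        : ∀ x → S.form x ≈ Λ₀ * (weight * (coordinate x * coordinate x)) + R.form (project x)

  module _ {n} (S : SelfAdjoint (suc n)) (Λ₀ : Carrier) (v : Vector Carrier (suc n))
           (eigen : ∀ i → (SelfAdjoint.matrix S · v) i ≈ Λ₀ * v i)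
           (r : Carrier) (v₀r≈1 : v zero * r ≈ 1#)
           (e : Carrier) (de≈1 : SelfAdjoint.norm S v * e ≈ 1#) (0≤e : 0# ≤ e) where

    open SelfAdjoint S renaming (matrix to M)

    private
      v₀≉0 : ¬ v zero ≈ 0#
      v₀≉0 v₀≈0 = <⇒≉ 0<1 (trans (sym v₀r≈1) (trans (*-congʳ v₀≈0) (zeroˡ r)))

    -- The operator induced by M on the quotient by v, whose coordinates
    -- are obtained by eliminating the zeroth one with v.
    quotientMatrix : Matrix n
    quotientMatrix i j = M (suc i) (suc j) - v (suc i) * (r * M zero (suc j))

    -- For the characteristic matrix `K`, the vector `K · v` is `t - Λ₀` times `v`. Putting it in
    -- the zeroth column multiplies the determinant by `v zero`, which returns as the pivot of the
    -- Schur complement and cancels.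
    charPoly-quotient : ∀ t → charPoly M t ≈ (t - Λ₀) * charPoly quotientMatrix t
    charPoly-quotient t = *-cancelˡ v₀≉0 (begin
      v zero * det K
        ≈⟨ det-combine-cols K v ⟨
      det (setCol₀ K (K · v))
        ≈⟨ det-cong (setCol₀-cong K λ i → trans (charMatrix-· M t v i)
             (trans (+-congˡ (-‿cong (eigen i)))
               -- The vanishing summand supplies the second term of the two-term linearity.
               (solve 3 (λ t Λ x → t :* x :- Λ :* x := (t :- Λ) :* x :+ (x :- x) :* x) refl t Λ₀ (v i)))) ⟩
      det (setCol₀ K (λ i → (t - Λ₀) * v i + (v i - v i) * v i))
        ≈⟨ det-cong (setCol₀-cong K λ i → +-congˡ (*-congʳ (-‿inverseʳ (v i)))) ⟩
      det (setCol₀ K (λ i → (t - Λ₀) * v i + 0# * v i))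
        ≈⟨ det-setCol₀-linear K (t - Λ₀) 0# v v ⟩
      (t - Λ₀) * det (setCol₀ K v) + 0# * det (setCol₀ K v)
        ≈⟨ trans (+-congˡ (zeroˡ _)) (+-identityʳ _) ⟩
      (t - Λ₀) * det (setCol₀ K v)
        ≈⟨ *-congˡ (det-schur (setCol₀ K v) r v₀r≈1) ⟩
      (t - Λ₀) * (v zero * det (schur (setCol₀ K v) r))
        ≈⟨ *-congˡ (*-congˡ (det-cong entries)) ⟩
      (t - Λ₀) * (v zero * charPoly quotientMatrix t)
        ≈⟨ solve 3 (λ x y z → x :* (y :* z) := y :* (x :* z)) refl _ _ _ ⟩
      v zero * ((t - Λ₀) * charPoly quotientMatrix t) ∎)
      where
      K : Matrix (suc n)
      K i j = t * identity i j - M i j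

      entries : ∀ i j → schur (setCol₀ K v) r i j ≈ t * identity i j - quotientMatrix i j
      entries i j = begin
        t * identity i j - M (suc i) (suc j) - v (suc i) * (r * (t * 0# - M zero (suc j)))
          ≈⟨ +-congˡ (-‿cong (*-congˡ (*-congˡ (trans (+-congʳ (zeroʳ t)) (+-identityˡ _))))) ⟩
        t * identity i j - M (suc i) (suc j) - v (suc i) * (r * - M zero (suc j))
          ≈⟨ solve 5 (λ x m v r m₀ → x :- m :- v :* (r :* :- m₀) := x :- (m :- v :* (r :* m₀))) refl _ _ _ _ _ ⟩
        t * identity i j - quotientMatrix i j ∎

    private
      lift : Vector Carrier n → Vector Carrier (suc n)
      lift x = 0# ∷ᵛ x

      lift-cong : ∀ {x y} → x ≋ y → lift x ≋ lift y
      lift-cong x≋y zero    = refl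
      lift-cong x≋y (suc i) = x≋y i

      -- The representative of `x` modulo `v` with vanishing zeroth coordinate; its tail is the
      -- class of `x` in the quotient.
      eliminate : Vector Carrier (suc n) → Vector Carrier (suc n)
      eliminate x = combine 1# (- (x zero * r)) x v

      eliminate-zero : ∀ x → eliminate x zero ≈ 0#
      eliminate-zero x = begin
        1# * x zero + - (x zero * r) * v zero
          ≈⟨ +-cong (*-identityˡ _) (solve 3 (λ x r v → :- (x :* r) :* v := :- (v :* r :* x)) refl _ _ _) ⟩
        x zero - v zero * r * x zero
          ≈⟨ +-congˡ (-‿cong (trans (*-congʳ v₀r≈1) (*-identityˡ _))) ⟩
        x zero - x zero
          ≈⟨ -‿inverseʳ _ ⟩
        0# ∎

      lift-tail-eliminate : ∀ x → lift (tail (eliminate x)) ≋ eliminate x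
      lift-tail-eliminate x zero    = sym (eliminate-zero x)
      lift-tail-eliminate x (suc i) = refl

      quotient-· : ∀ x → quotientMatrix · x ≋ tail (eliminate (M · lift x))
      quotient-· x i = begin
        quotientMatrix i ∙ x
          ≈⟨ ∙-cong (λ j → trans
               (solve 4 (λ m v r m₀ → m :- v :* (r :* m₀) := m :+ :- (v :* r) :* m₀) refl _ _ _ _)
               (+-congʳ (sym (*-identityˡ _)))) (λ _ → refl) ⟩
        combine 1# (- (v (suc i) * r)) (tail (M (suc i))) (tail (M zero)) ∙ x
          ≈⟨ ∙-linearˡ 1# _ _ _ x ⟩
        1# * tail (M (suc i)) ∙ x + - (v (suc i) * r) * tail (M zero) ∙ x
          ≈⟨ +-cong (*-congˡ (·-lift (suc i))) (trans
               (solve 3 (λ v r m → :- (v :* r) :* m := :- (m :* r) :* v) refl _ _ _)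
               (*-congʳ (-‿cong (*-congʳ (·-lift zero))))) ⟩
        tail (eliminate (M · lift x)) i ∎
        where
        ·-lift : ∀ k → tail (M k) ∙ x ≈ (M · lift x) k
        ·-lift k = sym (trans (∙-suc _ _) (trans (+-congʳ (zeroʳ _)) (+-identityˡ _)))

      -- The inner product of the components orthogonal to v.
      [_,_] : Vector Carrier (suc n) → Vector Carrier (suc n) → Carrier
      [ x , y ] = ⟪ x , y ⟫ - e * (⟪ x , v ⟫ * ⟪ y , v ⟫)

      []-cong : ∀ {x x′ y y′} → x ≋ x′ → y ≋ y′ → [ x , y ] ≈ [ x′ , y′ ]
      []-cong p q = +-cong (⟪⟫-cong p q)
        (-‿cong (*-congˡ (*-cong (⟪⟫-cong p λ _ → refl) (⟪⟫-cong q λ _ → refl))))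

      []-sym : ∀ x y → [ x , y ] ≈ [ y , x ]
      []-sym x y = +-cong (⟪⟫-sym x y) (-‿cong (*-congˡ (*-comm _ _)))

      []-linearˡ : ∀ a b x y z → [ combine a b x y , z ] ≈ a * [ x , z ] + b * [ y , z ]
      []-linearˡ a b x y z = begin
        ⟪ combine a b x y , z ⟫ - e * (⟪ combine a b x y , v ⟫ * ⟪ z , v ⟫)
          ≈⟨ +-cong (linearˡ a b x y z) (-‿cong (*-congˡ (*-congʳ (linearˡ a b x y v)))) ⟩
        a * ⟪ x , z ⟫ + b * ⟪ y , z ⟫ - e * ((a * ⟪ x , v ⟫ + b * ⟪ y , v ⟫) * ⟪ z , v ⟫)
          ≈⟨ solve 8 (λ a b xz yz e xv yv zv →
               a :* xz :+ b :* yz :- e :* ((a :* xv :+ b :* yv) :* zv) :=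
               a :* (xz :- e :* (xv :* zv)) :+ b :* (yz :- e :* (yv :* zv))) refl a b _ _ e _ _ _ ⟩
        a * [ x , z ] + b * [ y , z ] ∎

      v⊥ : ∀ y → [ v , y ] ≈ 0#
      v⊥ y = begin
        ⟪ v , y ⟫ - e * (⟪ v , v ⟫ * ⟪ y , v ⟫)
          ≈⟨ +-cong (⟪⟫-sym v y) (-‿cong (solve 3 (λ e d y → e :* (d :* y) := d :* e :* y) refl _ _ _)) ⟩
        ⟪ y , v ⟫ - ⟪ v , v ⟫ * e * ⟪ y , v ⟫
          ≈⟨ +-congˡ (-‿cong (trans (*-congʳ de≈1) (*-identityˡ _))) ⟩
        ⟪ y , v ⟫ - ⟪ y , v ⟫
          ≈⟨ -‿inverseʳ _ ⟩
        0# ∎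

      []-eliminate : ∀ x y → [ eliminate x , y ] ≈ [ x , y ]
      []-eliminate x y = trans ([]-linearˡ 1# _ x v y)
        (trans (+-cong (*-identityˡ _) (trans (*-congˡ (v⊥ y)) (zeroʳ _))) (+-identityʳ _))

      []-eliminate² : ∀ x y → [ eliminate x , eliminate y ] ≈ [ x , y ]
      []-eliminate² x y = trans ([]-eliminate x (eliminate y))
        (trans ([]-sym x (eliminate y)) (trans ([]-eliminate y x) ([]-sym y x)))

      ⟪M,v⟫ : ∀ x → ⟪ M · x , v ⟫ ≈ Λ₀ * ⟪ x , v ⟫
      ⟪M,v⟫ x = trans (selfAdjoint x v) (trans (⟪⟫-sym x (M · v)) (trans (scaleˡ x eigen) (*-congˡ (⟪⟫-sym v x))))

      []-selfAdjoint : ∀ x y → [ M · x , y ] ≈ [ x , M · y ]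
      []-selfAdjoint x y = +-cong (selfAdjoint x y) (-‿cong (*-congˡ (begin
        ⟪ M · x , v ⟫ * ⟪ y , v ⟫      ≈⟨ *-congʳ (⟪M,v⟫ x) ⟩
        Λ₀ * ⟪ x , v ⟫ * ⟪ y , v ⟫     ≈⟨ solve 3 (λ Λ x y → Λ :* x :* y := x :* (Λ :* y)) refl _ _ _ ⟩
        ⟪ x , v ⟫ * (Λ₀ * ⟪ y , v ⟫)   ≈⟨ *-congˡ (⟪M,v⟫ y) ⟨
        ⟪ x , v ⟫ * ⟪ M · y , v ⟫      ∎)))

      -- `[ X , X ]` is the squared length of `w`, the component of `X` orthogonal to `v`, so `w`
      -- vanishes. At the zeroth coordinate, where `X` is zero, this gives `α ≈ 0#`, and then `x`
      -- vanishes as well.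
      []-definite : ∀ x → [ lift x , lift x ] ≤ 0# → ∀ i → x i ≈ 0#
      []-definite x [x,x]≤0 i = begin
        x i                            ≈⟨ trans (+-congʳ (*-identityˡ _)) (+-identityʳ _) ⟨
        1# * x i + 0#                  ≈⟨ +-congˡ (trans (*-congʳ α≈0) (zeroˡ _)) ⟨
        1# * x i + α * v (suc i)       ≈⟨ w≈0 (suc i) ⟩
        0#                             ∎
        where
        X : Vector Carrier (suc n)
        X = lift x

        α : Carrier
        α = - (e * ⟪ X , v ⟫)

        w : Vector Carrier (suc n)
        w = combine 1# α X v

        ⟪w,w⟫ : ⟪ w , w ⟫ ≈ [ X , X ]
        ⟪w,w⟫ = begin
          ⟪ w , w ⟫
            ≈⟨ trans (linearˡ 1# α X v w) (+-cong
                 (trans (*-identityˡ _) (trans (linearʳ 1# α X X v) (+-congʳ (*-identityˡ _))))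
                 (*-congˡ (trans (linearʳ 1# α v X v) (+-cong (trans (*-identityˡ _) (⟪⟫-sym v X)) refl)))) ⟩
          ⟪ X , X ⟫ + α * ⟪ X , v ⟫ + α * (⟪ X , v ⟫ + α * ⟪ v , v ⟫)
            ≈⟨ solve 4 (λ xx e xv d → xx :+ :- (e :* xv) :* xv :+ :- (e :* xv) :* (xv :+ :- (e :* xv) :* d) :=
                 xx :- e :* (xv :* xv) :+ :- (e :* xv) :* (xv :- d :* e :* xv)) refl _ e _ _ ⟩
          [ X , X ] + α * (⟪ X , v ⟫ - ⟪ v , v ⟫ * e * ⟪ X , v ⟫)
            ≈⟨ +-congˡ (trans (*-congˡ (trans
                 (+-congˡ (-‿cong (trans (*-congʳ de≈1) (*-identityˡ _)))) (-‿inverseʳ _))) (zeroʳ _)) ⟩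
          [ X , X ] + 0#
            ≈⟨ +-identityʳ _ ⟩
          [ X , X ] ∎

        w≈0 : ∀ i → w i ≈ 0#
        w≈0 = definite w (≤-resp-≈ (sym ⟪w,w⟫) refl [x,x]≤0)

        α≈0 : α ≈ 0#
        α≈0 = *-cancelˡ-0 v₀≉0 (trans (*-comm _ _) (trans (sym (trans (+-congʳ (zeroʳ 1#)) (+-identityˡ _))) (w≈0 zero)))

    quotient : SelfAdjoint n
    quotient = record
      { matrix       = quotientMatrix
      ; innerProduct = record
        { ⟪_,_⟫    = λ x y → [ lift x , lift y ]
        ; ⟪⟫-cong  = λ p q → []-cong (lift-cong p) (lift-cong q)
        ; ⟪⟫-sym   = λ x y → []-sym (lift x) (lift y)
        ; linearˡ  = λ a b x y z → trans
            ([]-cong (λ where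
              zero    → sym (trans (+-cong (zeroʳ a) (zeroʳ b)) (+-identityˡ 0#))
              (suc i) → refl) (λ _ → refl))
            ([]-linearˡ a b (lift x) (lift y) (lift z))
        ; definite = []-definite
        }
      ; selfAdjoint  = λ x y → begin
          [ lift (quotientMatrix · x) , lift y ]   ≈⟨ quotient-form x y ⟩
          [ M · lift x , lift y ]                  ≈⟨ []-selfAdjoint (lift x) (lift y) ⟩
          [ lift x , M · lift y ]                  ≈⟨ []-sym _ _ ⟩
          [ M · lift y , lift x ]                  ≈⟨ quotient-form y x ⟨
          [ lift (quotientMatrix · y) , lift x ]   ≈⟨ []-sym _ _ ⟩
          [ lift x , lift (quotientMatrix · y) ]   ∎
      }
      where
      quotient-form : ∀ x y → [ lift (quotientMatrix · x) , lift y ] ≈ [ M · lift x , lift y ]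
      quotient-form x y = begin
        [ lift (quotientMatrix · x) , lift y ]
          ≈⟨ []-cong (λ i → trans (lift-cong (quotient-· x) i) (lift-tail-eliminate (M · lift x) i)) (λ _ → refl) ⟩
        [ eliminate (M · lift x) , lift y ]
          ≈⟨ []-eliminate (M · lift x) (lift y) ⟩
        [ M · lift x , lift y ] ∎

    quotient-deflation : Deflation S Λ₀
    quotient-deflation = record
      { rest              = quotient
      ; weight            = e
      ; coordinate        = λ x → ⟪ x , v ⟫
      ; project           = λ x → tail (eliminate x)
      ; charPoly-rest     = charPoly-quotient
      ; weight-nonneg     = 0≤e
      ; coordinate-cong   = λ p → ⟪⟫-cong p (λ _ → refl)
      ; coordinate-linear = λ a b x y → linearˡ a b x y v
      ; split-norm        = λ x → begin
          ⟪ x , x ⟫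
            ≈⟨ restore x x ⟩
          e * (⟪ x , v ⟫ * ⟪ x , v ⟫) + [ x , x ]
            ≈⟨ +-congˡ (trans ([]-cong (lift-tail-eliminate x) (lift-tail-eliminate x)) ([]-eliminate² x x)) ⟨
          e * (⟪ x , v ⟫ * ⟪ x , v ⟫) + [ lift (tail (eliminate x)) , lift (tail (eliminate x)) ] ∎
      ; split-form        = λ x → begin
          ⟪ x , M · x ⟫
            ≈⟨ restore x (M · x) ⟩
          e * (⟪ x , v ⟫ * ⟪ M · x , v ⟫) + [ x , M · x ]
            ≈⟨ +-cong (trans (*-congˡ (*-congˡ (⟪M,v⟫ x)))
                 (solve 3 (λ e x Λ → e :* (x :* (Λ :* x)) := Λ :* (e :* (x :* x))) refl _ _ _))
                 (sym (form-project x)) ⟩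
          Λ₀ * (e * (⟪ x , v ⟫ * ⟪ x , v ⟫)) + [ lift (tail (eliminate x)) , lift (quotientMatrix · tail (eliminate x)) ] ∎
      }
      where
      restore : ∀ x y → ⟪ x , y ⟫ ≈ e * (⟪ x , v ⟫ * ⟪ y , v ⟫) + [ x , y ]
      restore x y = solve 2 (λ a b → a := b :+ (a :- b)) refl _ _

      form-project : ∀ x → [ lift (tail (eliminate x)) , lift (quotientMatrix · tail (eliminate x)) ] ≈ [ x , M · x ]
      form-project x = begin
        [ lift x′ , lift (quotientMatrix · x′) ]
          ≈⟨ []-cong (lift-tail-eliminate x) (λ i → trans (lift-cong (quotient-· x′) i) (lift-tail-eliminate (M · lift x′) i)) ⟩
        [ eliminate x , eliminate (M · lift x′) ]
          ≈⟨ []-eliminate² x (M · lift x′) ⟩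
        [ x , M · lift x′ ]
          ≈⟨ []-cong (λ _ → refl) (·-cong M (lift-tail-eliminate x)) ⟩
        [ x , M · eliminate x ]
          ≈⟨ trans (sym ([]-selfAdjoint x (eliminate x))) ([]-sym _ _) ⟩
        [ eliminate x , M · x ]
          ≈⟨ []-eliminate x (M · x) ⟩
        [ x , M · x ] ∎
        where x′ = tail (eliminate x)

  unshear-shear : ∀ {n} (k : Fin n) x → unshear k (shear k x) ≋ x
  unshear-shear k x zero    = solve 2 (λ a b → a :+ b :- b := a) refl (x zero) (x (suc k))
  unshear-shear k x (suc i) = refl

  shear-cong : ∀ {n} (k : Fin n) {x y} → x ≋ y → shear k x ≋ shear k y
  shear-cong k x≋y zero    = +-cong (x≋y zero) (x≋y (suc k))
  shear-cong k x≋y (suc i) = x≋y (suc i)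

  unshear-cong : ∀ {n} (k : Fin n) {x y} → x ≋ y → unshear k x ≋ unshear k y
  unshear-cong k x≋y zero    = +-cong (x≋y zero) (-‿cong (x≋y (suc k)))
  unshear-cong k x≋y (suc i) = x≋y (suc i)

  shear-linear : ∀ {n} (k : Fin n) a b x y → shear k (combine a b x y) ≋ combine a b (shear k x) (shear k y)
  shear-linear k a b x y zero    =
    solve 6 (λ a b x y u v → a :* x :+ b :* y :+ (a :* u :+ b :* v) := a :* (x :+ u) :+ b :* (y :+ v)) refl a b _ _ _ _
  shear-linear k a b x y (suc i) = refl

  unshear-linear : ∀ {n} (k : Fin n) a b x y →
    unshear k (combine a b x y) ≋ combine a b (unshear k x) (unshear k y)
  unshear-linear k a b x y zero    =
    solve 6 (λ a b x y u v → a :* x :+ b :* y :- (a :* u :+ b :* v) := a :* (x :- u) :+ b :* (y :- v)) refl a b _ _ _ _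
  unshear-linear k a b x y (suc i) = refl

  unshear-conjugate-· : ∀ {n} (k : Fin n) (M : Matrix (suc n)) x →
    unshear k (conjugate k M · x) ≋ M · unshear k x
  unshear-conjugate-· k M x i = trans (unshear-cong k (conjugate-· k M x) i) (unshear-shear k (M · unshear k x) i)

  -- The inner product is pulled back along `unshear k`, which intertwines the conjugate with the
  -- original matrix.
  conjugateSelfAdjoint : ∀ {n} → Fin n → SelfAdjoint (suc n) → SelfAdjoint (suc n)
  conjugateSelfAdjoint k S = record
    { matrix       = conjugate k matrix
    ; innerProduct = record
      { ⟪_,_⟫    = λ x y → ⟪ unshear k x , unshear k y ⟫
      ; ⟪⟫-cong  = λ p q → ⟪⟫-cong (unshear-cong k p) (unshear-cong k q)
      ; ⟪⟫-sym   = λ x y → ⟪⟫-sym _ _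
      ; linearˡ  = λ a b x y z → trans (⟪⟫-cong (unshear-linear k a b x y) (λ _ → refl)) (linearˡ a b _ _ _)
      ; definite = λ x x≤0 → unshear-injective x (definite _ x≤0)
      }
    ; selfAdjoint  = λ x y → begin
        ⟪ unshear k (conjugate k matrix · x) , unshear k y ⟫  ≈⟨ ⟪⟫-cong (unshear-conjugate-· k matrix x) (λ _ → refl) ⟩
        ⟪ matrix · unshear k x , unshear k y ⟫                ≈⟨ selfAdjoint _ _ ⟩
        ⟪ unshear k x , matrix · unshear k y ⟫                ≈⟨ ⟪⟫-cong (λ _ → refl) (unshear-conjugate-· k matrix y) ⟨
        ⟪ unshear k x , unshear k (conjugate k matrix · y) ⟫  ∎
    }
    where
    open SelfAdjoint S

    unshear-injective : ∀ x → (∀ i → unshear k x i ≈ 0#) → ∀ i → x i ≈ 0#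
    unshear-injective x eq (suc i) = eq (suc i)
    unshear-injective x eq zero    = begin
      x zero                          ≈⟨ solve 2 (λ a b → a := a :- b :+ b) refl (x zero) (x (suc k)) ⟩
      x zero - x (suc k) + x (suc k)  ≈⟨ +-cong (eq zero) (eq (suc k)) ⟩
      0# + 0#                         ≈⟨ +-identityˡ 0# ⟩
      0#                              ∎

  unconjugate-deflation : ∀ {n} (k : Fin n) (S : SelfAdjoint (suc n)) {Λ₀} →
    Deflation (conjugateSelfAdjoint k S) Λ₀ → Deflation S Λ₀
  unconjugate-deflation k S D = record
    { rest              = rest
    ; weight            = weight
    ; coordinate        = λ x → coordinate (shear k x)
    ; project           = λ x → project (shear k x)
    ; charPoly-rest     = λ t → trans (sym (charPoly-conjugate k matrix t)) (charPoly-rest t)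
    ; weight-nonneg     = weight-nonneg
    ; coordinate-cong   = λ p → coordinate-cong (shear-cong k p)
    ; coordinate-linear = λ a b x y → trans (coordinate-cong (shear-linear k a b x y)) (coordinate-linear a b _ _)
    ; split-norm        = λ x → trans (sym (⟪⟫-cong (unshear-shear k x) (unshear-shear k x))) (split-norm (shear k x))
    ; split-form        = λ x → trans
        (sym (⟪⟫-cong (unshear-shear k x) λ i → trans (unshear-conjugate-· k matrix (shear k x) i)
          (·-cong matrix (unshear-shear k x) i)))
        (split-form (shear k x))
    }
    where
    open SelfAdjoint S
    open Deflation D

  deflate-at₀ : ∀ {n} (S : SelfAdjoint (suc n)) Λ₀ v → ¬ v zero ≈ 0# →
    (∀ i → (SelfAdjoint.matrix S · v) i ≈ Λ₀ * v i) → ¬ ¬ Deflation S Λ₀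
  deflate-at₀ S Λ₀ v v₀≉0 eigen = do
    r , v₀r≈1 ← reciprocal v₀≉0
    -- `norm v ≤ 0#` is itself a negation, so its refutation is the double negation of
    -- `0# < norm v`.
    0<d ← (λ d≤0 → v₀≉0 (definite v d≤0 zero))
    let e , 0<e , de≈1 = inverse 0<d
    return (quotient-deflation S Λ₀ v eigen r v₀r≈1 e de≈1 (<⇒≤ 0<e))
    where open SelfAdjoint S

  deflate : ∀ {n} (S : SelfAdjoint (suc n)) Λ₀ → charPoly (SelfAdjoint.matrix S) Λ₀ ≈ 0# → ¬ ¬ Deflation S Λ₀
  deflate {n} S Λ₀ χ≈0 = do
    v , v≉0 , Kv≈0 ← singular⇒kernel _ χ≈0
    let eigen : ∀ i → (matrix · v) i ≈ Λ₀ * v i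
        eigen i = begin
          (matrix · v) i
            ≈⟨ solve 2 (λ a b → a := b :- (b :- a)) refl _ (Λ₀ * v i) ⟩
          Λ₀ * v i - (Λ₀ * v i - (matrix · v) i)
            ≈⟨ +-congˡ (-‿cong (trans (sym (charMatrix-· matrix Λ₀ v i)) (Kv≈0 i))) ⟩
          Λ₀ * v i - 0#
            ≈⟨ trans (+-congˡ -0#≈0#) (+-identityʳ _) ⟩
          Λ₀ * v i ∎
    excluded-middle (v zero ≈ 0#) >>= λ where
      (inj₂ v₀≉0) → deflate-at₀ S Λ₀ v v₀≉0 eigen
      (inj₁ v₀≈0) → sheared v v₀≈0 v≉0 eigen
    where
    open SelfAdjoint S

    sheared : ∀ v → v zero ≈ 0# → NonZero v → (∀ i → (matrix · v) i ≈ Λ₀ * v i) → ¬ ¬ Deflation S Λ₀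
    sheared v v₀≈0 (zero  , v₀≉0) eigen = contradiction v₀≈0 v₀≉0
    sheared v v₀≈0 (suc k , vₖ≉0) eigen = do
      -- The zeroth entry of `shear k v` is `v zero + v (suc k)`, which is nonzero because `v zero`
      -- vanishes and `v (suc k)` does not.
      D ← deflate-at₀ (conjugateSelfAdjoint k S) Λ₀ (shear k v)
            (λ eq → vₖ≉0 (trans (sym (trans (+-congʳ v₀≈0) (+-identityˡ _))) eq)) λ i → begin
              (conjugate k matrix · shear k v) i       ≈⟨ conjugate-· k matrix (shear k v) i ⟩
              shear k (matrix · unshear k (shear k v)) i
                ≈⟨ shear-cong k (λ j → trans (·-cong matrix (unshear-shear k v) j) (eigen j)) i ⟩
              shear k (λ j → Λ₀ * v j) i               ≈⟨ scale i ⟩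
              Λ₀ * shear k v i                         ∎
      return (unconjugate-deflation k S D)
      where
      scale : ∀ i → shear k (λ j → Λ₀ * v j) i ≈ Λ₀ * shear k v i
      scale zero    = sym (distribˡ Λ₀ _ _)
      scale (suc i) = refl

  -- Eigenvalue bounds for the quadratic form

  Splits : ∀ {n} → Matrix n → Vector Carrier n → Set
  Splits M Λ = ∀ t → charPoly M t ≈ product λ i → t - Λ i

  splits⇒root₀ : ∀ {n} {M : Matrix (suc n)} {Λ} → Splits M Λ → charPoly M (Λ zero) ≈ 0#
  splits⇒root₀ {Λ = Λ} splits = trans (splits (Λ zero)) (trans (*-congʳ (-‿inverseʳ _)) (zeroˡ _))

  deflation-splits : ∀ {n} {S : SelfAdjoint (suc n)} {Λ} (D : Deflation S (Λ zero)) →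
    Splits (SelfAdjoint.matrix S) Λ → Splits (SelfAdjoint.matrix (Deflation.rest D)) (tail Λ)
  deflation-splits {S = S} {Λ} D splits = polynomial-cancel
    (polynomial-charPoly _) (polynomial-product (tail Λ)) (Λ zero)
    λ t → trans (sym (Deflation.charPoly-rest D t)) (splits t)

  -- Each deflation splits off a nonnegative weighted square from the norm and `Λ i` times the same
  -- quantity from the form; the bounds add up.
  form-≤ : ∀ {n} (S : SelfAdjoint n) {Λ} → Splits (SelfAdjoint.matrix S) Λ →
    ∀ {μ} → (∀ i → Λ i ≤ μ) → ∀ x → SelfAdjoint.form S x ≤ μ * SelfAdjoint.norm S x
  form-≤ {zero} S splits Λ≤μ x = ≤-reflexive (trans (empty _) (sym (trans (*-congˡ (empty x)) (zeroʳ _))))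
    where
    open SelfAdjoint S
    empty : ∀ y → ⟪ x , y ⟫ ≈ 0#
    -- In dimension zero every vector is `0#` times itself.
    empty y = trans (scaleˡ {0#} {x} {x} y λ ()) (zeroˡ _)
  form-≤ {suc n} S {Λ} splits {μ} Λ≤μ x = deflate S (Λ zero) (splits⇒root₀ {Λ = Λ} splits) >>= bound
    where
    bound : Deflation S (Λ zero) → SelfAdjoint.form S x ≤ μ * SelfAdjoint.norm S x
    bound D = ≤-resp-≈
      (trans (+-congʳ (*-comm _ _)) (sym (split-form x)))
      (trans (+-congʳ (*-comm _ _)) (trans (sym (distribˡ μ _ _)) (*-congˡ (sym (split-norm x)))))
      (+-mono-≤ (*-monoˡ-≤ (*-nonneg weight-nonneg (x*x-nonneg (coordinate x))) (Λ≤μ zero))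
        (form-≤ rest (deflation-splits {S = S} {Λ} D splits) (Λ≤μ ∘ suc) (project x)))
      where open Deflation D

  -- One half of Courant–Fischer: the plane of p and q meets the orthogonal
  -- complement of the eigenline deflated first.
  second-eigenvalue-bound : ∀ {n} (S : SelfAdjoint (suc n)) {Λ} → Splits (SelfAdjoint.matrix S) Λ →
    ∀ {μ} → (∀ i → Λ (suc i) ≤ μ) → ∀ p q →
    ¬ ¬ ∃ λ a → ∃ λ b → ¬ (a ≈ 0# × b ≈ 0#) ×
      SelfAdjoint.form S (combine a b p q) ≤ μ * SelfAdjoint.norm S (combine a b p q)
  second-eigenvalue-bound {n} S {Λ} splits {μ} Λ≤μ p q = deflate S (Λ zero) (splits⇒root₀ {Λ = Λ} splits) >>= witness
    where
    open SelfAdjoint S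

    complement-bound : (D : Deflation S (Λ zero)) → ∀ x → Deflation.coordinate D x ≈ 0# → form x ≤ μ * norm x
    complement-bound D x x⊥ = ≤-resp-≈
      (sym (trans (split-form x) (trans (+-congʳ (trans (*-congˡ c≈0) (zeroʳ _))) (+-identityˡ _))))
      (*-congˡ (sym (trans (split-norm x) (trans (+-congʳ c≈0) (+-identityˡ _)))))
      (form-≤ rest (deflation-splits {S = S} {Λ} D splits) Λ≤μ (project x))
      where
      open Deflation D
      c≈0 : weight * (coordinate x * coordinate x) ≈ 0#
      c≈0 = trans (*-congˡ (trans (*-congʳ x⊥) (zeroˡ _))) (zeroʳ _)

    witness : Deflation S (Λ zero) →
      ¬ ¬ ∃ λ a → ∃ λ b → ¬ (a ≈ 0# × b ≈ 0#) × form (combine a b p q) ≤ μ * norm (combine a b p q)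
    -- Membership in the complement is one linear condition on the plane. It is solved by
    -- `coordinate q` and `- coordinate p`, unless both vanish, when any coefficients do.
    witness D = excluded-middle (coordinate p ≈ 0# × coordinate q ≈ 0#) >>= λ where
        (inj₁ (p≈0 , q≈0)) → return (1# , 1# , (λ (1≈0 , _) → <⇒≉ 0<1 1≈0) , complement-bound D _ (begin
          coordinate (combine 1# 1# p q)             ≈⟨ coordinate-linear 1# 1# p q ⟩
          1# * coordinate p + 1# * coordinate q      ≈⟨ 1*x+1*y _ _ ⟩
          coordinate p + coordinate q                ≈⟨ +-cong p≈0 q≈0 ⟩
          0# + 0#                                    ≈⟨ +-identityˡ 0# ⟩
          0#                                         ∎))
        (inj₂ pq≉0) → return (coordinate q , - coordinate p ,
          (λ (q≈0 , -p≈0) → pq≉0 (trans (solve 1 (λ x → x := :- :- x) refl _) (trans (-‿cong -p≈0) -0#≈0#) , q≈0)) ,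
          complement-bound D _ (begin
          coordinate (combine (coordinate q) (- coordinate p) p q)
            ≈⟨ coordinate-linear _ _ p q ⟩
          coordinate q * coordinate p + - coordinate p * coordinate q
            ≈⟨ solve 2 (λ a b → b :* a :+ :- a :* b := a :* b :- a :* b) refl _ _ ⟩
          coordinate p * coordinate q - coordinate p * coordinate q
            ≈⟨ -‿inverseʳ _ ⟩
          0# ∎))
      where open Deflation D

  -- Symmetric matrices and the edge matrix

  symmetric⇒selfAdjoint : ∀ {n} (B : Matrix n) → (∀ i j → B i j ≈ B j i) → SelfAdjoint n
  symmetric⇒selfAdjoint B B-sym = record
    { matrix       = B
    ; innerProduct = record
      { ⟪_,_⟫    = _∙_
      ; ⟪⟫-cong  = ∙-cong
      ; ⟪⟫-sym   = ∙-comm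
      ; linearˡ  = ∙-linearˡ
      ; definite = ∙-definite
      }
    ; selfAdjoint  = λ x y → begin
        (B · x) ∙ y                    ≈⟨ ∙-comm _ y ⟩
        y ∙ (B · x)                    ≈⟨ ∙-assoc y B x ⟩
        (λ j → y ∙ λ i → B i j) ∙ x    ≈⟨ ∙-comm _ x ⟩
        (x ∙ λ j → y ∙ λ i → B i j)
          ≈⟨ ∙-cong (λ _ → refl) (λ j → trans (∙-comm y _) (∙-cong (λ i → B-sym i j) (λ _ → refl))) ⟩
        x ∙ (B · y)                    ∎
    }

  -- Allows the signs of all entries of the eigenvector to be fixed at once.
  ¬¬-Fin : ∀ {n} {P : Fin n → Set} → (∀ i → ¬ ¬ P i) → ¬ ¬ (∀ i → P i)
  ¬¬-Fin {zero}  p = return λ ()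
  ¬¬-Fin {suc n} p = do
    p₀ ← p zero
    p₊ ← ¬¬-Fin (p ∘ suc)
    return λ where
      zero    → p₀
      (suc i) → p₊ i

  ∑∑ : ∀ {n} → (Fin n → Fin n → Carrier) → Carrier
  ∑∑ f = ∑ λ i → ∑ (f i)

  ∑-+ : ∀ {n} (f g : Vector Carrier n) → ∑ (λ i → f i + g i) ≈ ∑ f + ∑ g
  ∑-+ f g = trans (∑-cong λ i → sym (1*x+1*y (f i) (g i))) (trans (∑-linear 1# 1# f g) (1*x+1*y _ _))

  0≤x+x⇒0≤x : ∀ {x} → 0# ≤ x + x → 0# ≤ x
  0≤x+x⇒0≤x {x} 0≤x+x x<0 =
    0≤x+x (<-≤-trans (<-resp-≈ refl (+-identityˡ x) (+-monoˡ-< x x<0)) (<⇒≤ x<0))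

  -- Twice the double sum is the double sum of `f i j + f j i`.
  ∑∑-nonneg : ∀ {n} (f : Fin n → Fin n → Carrier) → (∀ i j → 0# ≤ f i j + f j i) → 0# ≤ ∑∑ f
  ∑∑-nonneg f 0≤f = 0≤x+x⇒0≤x (≤-resp-≈ refl
    (trans (∑-cong λ i → ∑-+ (f i) (λ j → f j i)) (trans (∑-+ _ _) (+-congˡ (sym (∑-swap f)))))
    (∑-nonneg _ λ i → ∑-nonneg _ (0≤f i)))

  opposite : ∀ {x y} → 0# ≤ x → y ≤ 0# → 0# ≤ - (x * y)
  opposite {x} {y} 0≤x y≤0 = ≤-resp-≈ refl
    (trans (*-congˡ (+-identityˡ _)) (solve 2 (λ x y → x :* :- y := :- (x :* y)) refl x y))
    (*-nonneg 0≤x (x≤y⇒0≤y-x y≤0))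

  -- A sum of two rank-one matrices, which makes its product with a vector explicit. For distinct
  -- `u` and `v` it is the adjacency matrix of a single edge.
  edgeMatrix : ∀ {n} → Fin n → Fin n → Matrix n
  edgeMatrix u v i j = identity u i * identity v j + identity v i * identity u j

  edgeMatrix-· : ∀ {n} (u v i : Fin n) (z : Vector Carrier n) →
    (edgeMatrix u v · z) i ≈ identity u i * z v + identity v i * z u
  edgeMatrix-· u v i z = trans (∙-linearˡ _ _ _ _ z) (+-cong (*-congˡ (identity-∙ v z)) (*-congˡ (identity-∙ u z)))

  identity-diagonal : ∀ {n} (i : Fin n) → identity i i ≈ 1#
  identity-diagonal i = reflexive (≡.cong (if_then 1# else 0#) (dec-true (i ≟ i) ≡.refl))

  identity-offDiagonal : ∀ {n} {i j : Fin n} → i ≢ j → identity i j ≈ 0#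
  identity-offDiagonal {i = i} {j} i≢j = reflexive (≡.cong (if_then 1# else 0#) (dec-false (i ≟ j) i≢j))

  edgeMatrix-sym : ∀ {n} (u v i j : Fin n) → edgeMatrix u v i j ≈ edgeMatrix u v j i
  edgeMatrix-sym u v i j = trans (+-comm _ _) (+-cong (*-comm _ _) (*-comm _ _))

  edgeMatrix-edge : ∀ {n} {u v : Fin n} → u ≢ v → edgeMatrix u v u v ≈ 1#
  edgeMatrix-edge {u = u} {v} u≢v = begin
    identity u u * identity v v + identity v u * identity u v
      ≈⟨ +-cong (*-cong (identity-diagonal u) (identity-diagonal v)) (*-congˡ (identity-offDiagonal u≢v)) ⟩
    1# * 1# + identity v u * 0#
      ≈⟨ trans (+-cong (*-identityˡ 1#) (zeroʳ _)) (+-identityʳ 1#) ⟩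
    1# ∎

  edgeMatrix-other : ∀ {n} {u v i j : Fin n} → ¬ (u ≡ i × v ≡ j) → ¬ (v ≡ i × u ≡ j) → edgeMatrix u v i j ≈ 0#
  edgeMatrix-other p q = trans (+-cong (vanish p) (vanish q)) (+-identityˡ 0#)
    where
    vanish : ∀ {k l i j} → ¬ (k ≡ i × l ≡ j) → identity k i * identity l j ≈ 0#
    vanish {k} {l} {i} {j} ¬kl with k ≟ i
    ... | no  _   = zeroˡ _
    ... | yes k≡i = trans (*-congˡ (identity-offDiagonal λ l≡j → ¬kl (k≡i , l≡j))) (zeroʳ _)

  -- The quadratic form without the edge

  module _ {n} (A B : Matrix (suc n)) (u v : Fin (suc n)) (A≈B+E : ∀ i j → A i j ≈ B i j + edgeMatrix u v i j)
           (B-sym : ∀ i j → B i j ≈ B j i) (0≤B : ∀ i j → 0# ≤ B i j)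
           (κ : Carrier) (z : Vector Carrier (suc n)) (Az≈κz : ∀ i → (A · z) i ≈ κ * z i)
           (0<zᵤ : 0# < z u) (zᵥ<0 : z v < 0#)
           where

    private
      S : SelfAdjoint (suc n)
      S = symmetric⇒selfAdjoint B B-sym
      open SelfAdjoint S using (form; norm; ⟪⟫-cong)

      eigen : ∀ i → κ * z i ≈ (B · z) i + (identity u i * z v + identity v i * z u)
      eigen i = begin
        κ * z i
          ≈⟨ Az≈κz i ⟨
        (A · z) i
          ≈⟨ ∙-cong (λ j → trans (A≈B+E i j) (sym (1*x+1*y _ _))) (λ _ → refl) ⟩
        combine 1# 1# (B i) (edgeMatrix u v i) ∙ z
          ≈⟨ trans (∙-linearˡ 1# 1# _ _ z) (1*x+1*y _ _) ⟩
        (B · z) i + (edgeMatrix u v · z) i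
          ≈⟨ +-congˡ (edgeMatrix-· u v i z) ⟩
        (B · z) i + (identity u i * z v + identity v i * z u) ∎

      d : Carrier
      d = - (z u * z v)

      -- The sign decisions are an argument because they exist only under a double negation.
      module Signs (sign : ∀ i → 0# < z i ⊎ z i ≤ 0#) where

        p q : Vector Carrier (suc n)
        p i with sign i
        ... | inj₁ _ = z i
        ... | inj₂ _ = 0#
        q i with sign i
        ... | inj₁ _ = 0#
        ... | inj₂ _ = z i

      module Combination (sign : ∀ i → 0# < z i ⊎ z i ≤ 0#) (a b : Carrier) where
        open Signs sign

        s y : Vector Carrier (suc n)
        s i with sign i
        ... | inj₁ _ = a
        ... | inj₂ _ = b
        y i = s i * z i

        N : Carrier
        N = a * a + b * b

        combine≋y : combine a b p q ≋ y
        combine≋y i with sign i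
        ... | inj₁ _ = trans (+-congˡ (zeroʳ b)) (+-identityʳ _)
        ... | inj₂ _ = trans (+-congʳ (zeroʳ a)) (+-identityˡ _)

        sᵤ≡a : s u ≡ a
        sᵤ≡a with sign u
        ... | inj₁ _   = ≡.refl
        ... | inj₂ z≤0 = contradiction 0<zᵤ z≤0

        sᵥ≡b : s v ≡ b
        sᵥ≡b with sign v
        ... | inj₁ 0<z = contradiction 0<z (<⇒≤ zᵥ<0)
        ... | inj₂ _   = ≡.refl

        s²≤N : ∀ i → s i * s i ≤ N
        s²≤N i with sign i
        ... | inj₁ _ = ≤-resp-≈ (+-identityʳ _) refl (+-mono-≤ (≤-reflexive refl) (x*x-nonneg b))
        ... | inj₂ _ = ≤-resp-≈ (+-identityˡ _) refl (+-mono-≤ (x*x-nonneg a) (≤-reflexive refl))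

        edge : Fin (suc n) → Fin (suc n) → Carrier
        edge i j = - (z i * z j) * ((s i - s j) * (s i - s j))

        -- On the same side `s i` and `s j` coincide and the square vanishes; across the sides
        -- `z i * z j` is nonpositive.
        edge-nonneg : ∀ i j → 0# ≤ edge i j
        edge-nonneg i j with sign i | sign j
        ... | inj₁ _    | inj₁ _    = ≤-reflexive (sym (trans (*-congˡ (trans (*-congʳ (-‿inverseʳ a)) (zeroˡ _))) (zeroʳ _)))
        ... | inj₂ _    | inj₂ _    = ≤-reflexive (sym (trans (*-congˡ (trans (*-congʳ (-‿inverseʳ b)) (zeroˡ _))) (zeroʳ _)))
        ... | inj₁ 0<zᵢ | inj₂ zⱼ≤0 = *-nonneg (opposite (<⇒≤ 0<zᵢ) zⱼ≤0) (x*x-nonneg _)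
        ... | inj₂ zᵢ≤0 | inj₁ 0<zⱼ = *-nonneg
          (≤-resp-≈ refl (-‿cong (*-comm (z j) (z i))) (opposite (<⇒≤ 0<zⱼ) zᵢ≤0)) (x*x-nonneg _)

        -- Summed, this is form y - κ * norm y - d * N; adding the (j , i) term
        -- to the (i , j) term turns it into B i j * edge i j.
        excess : Fin (suc n) → Fin (suc n) → Carrier
        excess i j = B i j * (s i * z i * (s j * z j)) - B i j * (s i * s i * (z i * z j))

        excess-nonneg : 0# ≤ ∑∑ excess
        excess-nonneg = ∑∑-nonneg excess λ i j → ≤-resp-≈ refl
          (trans
            (solve 5 (λ b x y s t → b :* (:- (x :* y) :* ((s :- t) :* (s :- t))) :=
              b :* (s :* x :* (t :* y)) :- b :* (s :* s :* (x :* y)) :+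
              (b :* (t :* y :* (s :* x)) :- b :* (t :* t :* (y :* x)))) refl (B i j) (z i) (z j) (s i) (s j))
            (+-congˡ (+-cong (*-congʳ (B-sym i j)) (-‿cong (*-congʳ (B-sym i j))))))
          (*-nonneg (0≤B i j) (edge-nonneg i j))

        -- This is the eigenvector equation at `i`, multiplied by `s i * s i * z i`.
        κ-norm-term : ∀ i → κ * (y i * y i) ≈ ∑ (λ j → B i j * (s i * s i * (z i * z j))) +
          (identity u i * (s i * s i * (z i * z v)) + identity v i * (s i * s i * (z i * z u)))
        κ-norm-term i = begin
          κ * (s i * z i * (s i * z i))
            ≈⟨ solve 3 (λ k s z → k :* (s :* z :* (s :* z)) := s :* s :* z :* (k :* z)) refl κ (s i) (z i) ⟩
          s i * s i * z i * (κ * z i)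
            ≈⟨ *-congˡ (eigen i) ⟩
          s i * s i * z i * ((B · z) i + (identity u i * z v + identity v i * z u))
            ≈⟨ solve 7 (λ s x b p y q w → s :* s :* x :* (b :+ (p :* y :+ q :* w)) :=
                 s :* s :* x :* b :+ (p :* (s :* s :* (x :* y)) :+ q :* (s :* s :* (x :* w)))) refl
                 (s i) (z i) _ _ (z v) _ (z u) ⟩
          s i * s i * z i * (B · z) i + (identity u i * (s i * s i * (z i * z v)) + identity v i * (s i * s i * (z i * z u)))
            ≈⟨ +-congʳ (trans (*-distribˡ-∑ _ _) (∑-cong λ j →
                 solve 4 (λ s x b y → s :* s :* x :* (b :* y) := b :* (s :* s :* (x :* y))) refl (s i) (z i) (B i j) (z j))) ⟩
          ∑ (λ j → B i j * (s i * s i * (z i * z j))) +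
            (identity u i * (s i * s i * (z i * z v)) + identity v i * (s i * s i * (z i * z u))) ∎

        T : Carrier
        T = ∑∑ λ i j → B i j * (s i * s i * (z i * z j))

        -- The deleted edge contributes `z u * z v` with weight `a * a` from the row of `u` and
        -- `b * b` from the row of `v`.
        κ-norm : κ * norm y ≈ T - d * N
        κ-norm = begin
          κ * norm y
            ≈⟨ trans (*-distribˡ-∑ κ _) (∑-cong κ-norm-term) ⟩
          ∑ (λ i → ∑ (λ j → B i j * (s i * s i * (z i * z j))) +
            (identity u i * (s i * s i * (z i * z v)) + identity v i * (s i * s i * (z i * z u))))
            ≈⟨ trans (∑-+ _ _) (+-congˡ (trans (∑-+ _ _) (+-cong (identity-∙ u _) (identity-∙ v _)))) ⟩
          T + (s u * s u * (z u * z v) + s v * s v * (z v * z u))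
            ≈⟨ +-congˡ (+-cong (*-congʳ (reflexive (≡.cong₂ _*_ sᵤ≡a sᵤ≡a)))
                               (*-congʳ (reflexive (≡.cong₂ _*_ sᵥ≡b sᵥ≡b)))) ⟩
          T + (a * a * (z u * z v) + b * b * (z v * z u))
            ≈⟨ solve 5 (λ t a b x y → t :+ (a :* a :* (x :* y) :+ b :* b :* (y :* x)) :=
                 t :- :- (x :* y) :* (a :* a :+ b :* b)) refl T a b (z u) (z v) ⟩
          T - d * N ∎

        form-excess : form y ≈ ∑∑ excess + T
        form-excess = begin
          ∑ (λ i → y i * ∑ λ j → B i j * y j)
            ≈⟨ ∑-cong (λ i → trans (*-distribˡ-∑ (y i) _) (trans (∑-cong λ j →
                 solve 4 (λ s b t r → s :* (b :* t) := b :* (s :* t) :- b :* r :+ b :* r) refl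
                   (y i) (B i j) (y j) (s i * s i * (z i * z j))) (∑-+ (excess i) _))) ⟩
          ∑ (λ i → ∑ (excess i) + ∑ λ j → B i j * (s i * s i * (z i * z j)))
            ≈⟨ ∑-+ _ _ ⟩
          ∑∑ excess + T ∎

        norm-≤ : norm y ≤ N * norm z
        norm-≤ = ≤-resp-≈ refl (sym (*-distribˡ-∑ N _)) (∑-mono-≤ λ i → ≤-resp-≈
          (solve 2 (λ s z → z :* z :* (s :* s) := s :* z :* (s :* z)) refl (s i) (z i))
          (*-comm (z i * z i) N)
          (*-monoˡ-≤ (x*x-nonneg (z i)) (s²≤N i)))

        -- The form exceeds `κ * norm y` by at least `d * N`, while the shift by `ε` costs at most
        -- `ε * (N * norm z)`.
        form-lower-bound : ∀ ε → 0# ≤ ε → N * (d - ε * norm z) ≤ form y - (κ + ε) * norm y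
        form-lower-bound ε 0≤ε = ≤-resp-≈
          (solve 4 (λ n d e m → :- (e :* (n :* m)) :+ (d :* n) := n :* (d :- e :* m)) refl N d ε (norm z))
          (begin
            - (ε * norm y) + (∑∑ excess + d * N)
              ≈⟨ solve 5 (λ e n x t g → :- (e :* n) :+ (x :+ g) := x :+ t :- (t :- g) :- e :* n) refl ε (norm y) (∑∑ excess) T (d * N) ⟩
            ∑∑ excess + T - (T - d * N) - ε * norm y
              ≈⟨ +-congʳ (+-cong form-excess (-‿cong κ-norm)) ⟨
            form y - κ * norm y - ε * norm y
              ≈⟨ solve 4 (λ f k n e → f :- k :* n :- e :* n := f :- (k :+ e) :* n) refl (form y) κ (norm y) ε ⟩
            form y - (κ + ε) * norm y ∎)
          (+-mono-≤
            (neg-mono (*-monoˡ-≤ 0≤ε norm-≤))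
            (≤-resp-≈ (+-identityˡ _) refl (+-mono-≤ excess-nonneg (≤-reflexive refl))))
          where
          neg-mono : ∀ {x y} → x ≤ y → - y ≤ - x
          neg-mono {x} {y} x≤y = 0≤y-x⇒x≤y (≤-resp-≈ refl
            (solve 2 (λ x y → y :- x := :- x :- :- y) refl x y) (x≤y⇒0≤y-x x≤y))

        bound⇒y≤0 : ∀ {μ} → form (combine a b p q) ≤ μ * norm (combine a b p q) → form y - μ * norm y ≤ 0#
        bound⇒y≤0 {μ} bound = ≤-resp-≈
          (+-congʳ (⟪⟫-cong combine≋y (·-cong B combine≋y))) (-‿inverseʳ _)
          (+-mono-≤ bound (≤-reflexive (-‿cong (*-congˡ (⟪⟫-cong (λ i → sym (combine≋y i)) (λ i → sym (combine≋y i)))))))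

    -- Otherwise some nontrivial combination has `form - (κ + ε) * norm` at most zero, against a
    -- lower bound that is positive because `N` and `d - ε * norm z` are. The goal being a negation,
    -- the signs, the coefficients and `0# < N` may come from under double negations.
    second-eigenvalue-exceeds : ∀ {Λ} → Splits B Λ → ∀ ε → 0# ≤ ε → ε * norm z < d →
      ¬ (∀ i → Λ (suc i) ≤ κ + ε)
    second-eigenvalue-exceeds {Λ} splits ε 0≤ε ε‖z‖<d Λ≤κ+ε =
      ¬¬-Fin (λ i → excluded-middle (0# < z i)) λ sign →
      second-eigenvalue-bound S {Λ} splits Λ≤κ+ε (Signs.p sign) (Signs.q sign) λ (a , b , ab≉0 , bound) →
        positive a b ab≉0 λ 0<N →
          ≤-trans (Combination.form-lower-bound sign a b ε 0≤ε) (Combination.bound⇒y≤0 sign a b bound)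
            (*-pos 0<N (x<y⇒0<y-x ε‖z‖<d))
      where
      positive : ∀ a b → ¬ (a ≈ 0# × b ≈ 0#) → ¬ a * a + b * b ≤ 0#
      positive a b ab≉0 N≤0 = ab≉0
        ( x*x≤0⇒x≈0 (≤-trans (≤-resp-≈ (+-identityʳ _) refl (+-mono-≤ (≤-reflexive refl) (x*x-nonneg b))) N≤0)
        , x*x≤0⇒x≈0 (≤-trans (≤-resp-≈ (+-identityˡ _) refl (+-mono-≤ (x*x-nonneg a) (≤-reflexive refl))) N≤0))

    second-eigenvalue-> : ∀ {Λ} → Splits B Λ → ∀ {x} → (∀ i → Λ (suc i) ≤ x) → κ < x
    second-eigenvalue-> {Λ} splits {x} Λ≤x =
      -- With `e` the inverse of `norm z + 1#`, the choice `ε = d * e` satisfies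
      -- `ε * norm z = d - ε`. The added one makes the denominator positive outright.
      let e , 0<e , Ne≈1 = inverse 0<N
          0<ε : 0# < d * e
          0<ε = *-pos 0<d 0<e
          ε‖z‖<d : d * e * norm z < d
          ε‖z‖<d = 0<y-x⇒x<y (<-resp-≈ refl (begin
            d * e
              ≈⟨ solve 3 (λ d e m → d :* e := d :* (e :* m :+ e) :- d :* e :* m) refl d e (norm z) ⟩
            d * (e * norm z + e) - d * e * norm z
              ≈⟨ +-congʳ (trans (*-congˡ (trans (+-congˡ (sym (*-identityʳ e))) (trans (sym (distribˡ e _ _))
                   (trans (*-comm _ _) Ne≈1)))) (*-identityʳ d)) ⟩
            d - d * e * norm z ∎) 0<ε)
      in <-≤-trans
        (<-resp-≈ (+-identityˡ κ) (+-comm _ κ) (+-monoˡ-< κ 0<ε))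
        λ x<κ+ε → second-eigenvalue-exceeds {Λ} splits (d * e) (<⇒≤ 0<ε) ε‖z‖<d
          λ i → ≤-trans (Λ≤x i) (<⇒≤ x<κ+ε)
      where
      0<N : 0# < norm z + 1#
      0<N = <-≤-trans 0<1 (≤-resp-≈ (+-identityˡ 1#) refl
        (+-mono-≤ (∑-nonneg _ λ i → x*x-nonneg (z i)) (≤-reflexive refl)))

      0<d : 0# < d
      0<d = <-resp-≈ refl (solve 2 (λ x y → x :* :- y := :- (x :* y)) refl (z u) (z v))
        (*-pos 0<zᵤ (x<0⇒0<-x zᵥ<0))

open import Defs

-- The real numbers as an ordered field

module _ where
  open Data.Rational.Solver.+-*-Solver

  opaque
    -- Reduces an inequality to one whose sides have the same difference, so that the estimates on
    -- real sequences leave only a ring identity to the solver.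
    shift-≤ : ∀ {p q p′ q′} → p ℚ.≤ q → q ℚ.- p ≡ q′ ℚ.- p′ → p′ ℚ.≤ q′
    shift-≤ {p} {q} {p′} {q′} p≤q eq = ≡.subst₂ ℚ._≤_
      (solve 2 (λ p p′ → p :+ (p′ :- p) := p′) ≡.refl p p′)
      (≡.trans (solve 3 (λ p q p′ → q :+ (p′ :- p) := (q :- p) :+ p′) ≡.refl p q p′)
        (≡.trans (≡.cong (ℚ._+ p′) eq) (solve 2 (λ p′ q′ → q′ :- p′ :+ p′ := q′) ≡.refl p′ q′)))
      (ℚ.+-monoˡ-≤ (p′ ℚ.- p) p≤q)

    shift-< : ∀ {p q p′ q′} → p ℚ.< q → q ℚ.- p ≡ q′ ℚ.- p′ → p′ ℚ.< q′
    shift-< {p} {q} {p′} {q′} p<q eq = ≡.subst₂ ℚ._<_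
      (solve 2 (λ p p′ → p :+ (p′ :- p) := p′) ≡.refl p p′)
      (≡.trans (solve 3 (λ p q p′ → q :+ (p′ :- p) := (q :- p) :+ p′) ≡.refl p q p′)
        (≡.trans (≡.cong (ℚ._+ p′) eq) (solve 2 (λ p′ q′ → q′ :- p′ :+ p′ := q′) ≡.refl p′ q′)))
      (ℚ.+-monoˡ-< (p′ ℚ.- p) p<q)

    p≤∣p∣ : ∀ p → p ℚ.≤ ∣ p ∣
    p≤∣p∣ p with ℚ.≤-total 0ℚ p
    ... | inj₁ 0≤p = ℚ.≤-reflexive (≡.sym (ℚ.0≤p⇒∣p∣≡p 0≤p))
    ... | inj₂ p≤0 = ℚ.≤-trans p≤0 (ℚ.0≤∣p∣ p)

    ∣p∣<q⇒p<q : ∀ {p q} → ∣ p ∣ ℚ.< q → p ℚ.< q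
    ∣p∣<q⇒p<q {p} = ℚ.≤-<-trans (p≤∣p∣ p)

    ∣p∣<q⇒-p<q : ∀ {p q} → ∣ p ∣ ℚ.< q → ℚ.- p ℚ.< q
    ∣p∣<q⇒-p<q {p} ∣p∣<q = ∣p∣<q⇒p<q (≡.subst (ℚ._< _) (≡.sym (ℚ.∣-p∣≡∣p∣ p)) ∣p∣<q)

    ∣p∣<q : ∀ {p q} → p ℚ.< q → ℚ.- p ℚ.< q → ∣ p ∣ ℚ.< q
    ∣p∣<q {p} p<q -p<q with ℚ.∣p∣≡p∨∣p∣≡-p p
    ... | inj₁ eq = ≡.subst (ℚ._< _) (≡.sym eq) p<q
    ... | inj₂ eq = ≡.subst (ℚ._< _) (≡.sym eq) -p<q

    0<½* : ∀ {ε} → 0ℚ ℚ.< ε → 0ℚ ℚ.< ½ ℚ.* ε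
    0<½* {ε} 0<ε = ≡.subst (ℚ._< ½ ℚ.* ε) (ℚ.*-zeroʳ ½) (ℚ.*-monoʳ-<-pos ½ 0<ε)

    0<* : ∀ {p q} → 0ℚ ℚ.< p → 0ℚ ℚ.< q → 0ℚ ℚ.< p ℚ.* q
    0<* {p} {q} 0<p 0<q = ≡.subst (ℚ._< p ℚ.* q) (ℚ.*-zeroʳ p) (ℚ.*-monoʳ-<-pos p {{ℚ.positive 0<p}} 0<q)

    positive-reciprocal : ∀ {p} → 0ℚ ℚ.< p → ∃ λ q → 0ℚ ℚ.< q × p ℚ.* q ≡ 1ℚ
    positive-reciprocal {p} 0<p =
      (1/ p) , ℚ.positive⁻¹ (1/ p) {{ℚ.1/pos⇒pos p}} , ℚ.*-inverseʳ p
      where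
      instance
        pos : ℚ.Positive p
        pos = ℚ.positive 0<p
        nonZero : ℚ.NonZero p
        nonZero = ℚ.pos⇒nonZero p

    quarter : ∀ {ε} → 0ℚ ℚ.< ε → ∃ λ δ → 0ℚ ℚ.< δ × δ ℚ.+ δ ℚ.+ δ ℚ.+ δ ≡ ε
    quarter {ε} 0<ε = ½ ℚ.* (½ ℚ.* ε) , 0<½* (0<½* 0<ε) ,
      solve 1 (λ ε → let δ = con ½ :* (con ½ :* ε) in δ :+ δ :+ δ :+ δ := ε) ≡.refl ε

    half-sum-< : ∀ {p q r ε} → r ≡ p ℚ.+ q → ∣ p ∣ ℚ.< ½ ℚ.* ε → ∣ q ∣ ℚ.< ½ ℚ.* ε → ∣ r ∣ ℚ.< ε
    half-sum-< {p} {q} {r} {ε} r≡p+q ∣p∣< ∣q∣< = begin-strict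
      ∣ r ∣                  ≡⟨ ≡.cong ∣_∣ r≡p+q ⟩
      ∣ p ℚ.+ q ∣            ≤⟨ ℚ.∣p+q∣≤∣p∣+∣q∣ p q ⟩
      ∣ p ∣ ℚ.+ ∣ q ∣        <⟨ ℚ.+-mono-< ∣p∣< ∣q∣< ⟩
      ½ ℚ.* ε ℚ.+ ½ ℚ.* ε    ≡⟨ solve 1 (λ ε → con ½ :* ε :+ con ½ :* ε := ε) ≡.refl ε ⟩
      ε                      ∎
      where open ℚ.≤-Reasoning

    ∣*∣-< : ∀ p q {B δ} → 0ℚ ℚ.< B → ∣ p ∣ ℚ.< δ → ∣ q ∣ ℚ.≤ B → ∣ p ℚ.* q ∣ ℚ.< δ ℚ.* B
    ∣*∣-< p q {B} {δ} 0<B ∣p∣<δ ∣q∣≤B = begin-strict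
      ∣ p ℚ.* q ∣        ≡⟨ ℚ.∣p*q∣≡∣p∣*∣q∣ p q ⟩
      ∣ p ∣ ℚ.* ∣ q ∣    ≤⟨ ℚ.*-monoˡ-≤-nonNeg ∣ p ∣ {{ℚ.nonNegative (ℚ.0≤∣p∣ p)}} ∣q∣≤B ⟩
      ∣ p ∣ ℚ.* B        <⟨ ℚ.*-monoˡ-<-pos B {{ℚ.positive 0<B}} ∣p∣<δ ⟩
      δ ℚ.* B            ∎
      where open ℚ.≤-Reasoning

    divide : ∀ {B ε} → 0ℚ ℚ.< B → 0ℚ ℚ.< ε → ∃ λ δ → 0ℚ ℚ.< δ × δ ℚ.* B ≡ ε
    divide {B} {ε} 0<B 0<ε =
      let r , 0<r , Br≡1 = positive-reciprocal 0<B
      in ε ℚ.* r , 0<* 0<ε 0<r , ≡.trans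
           (solve 3 (λ ε r B → ε :* r :* B := ε :* (B :* r)) ≡.refl ε r B)
           (≡.trans (≡.cong (ε ℚ.*_) Br≡1) (ℚ.*-identityʳ ε))

  eventually-map : ∀ {P Q : ℕ → Set} → (∀ n → P n → Q n) → Eventually P → Eventually Q
  eventually-map f (N , p) = N , λ n N≤n → f n (p n N≤n)

  eventually-map₂ : ∀ {P Q R : ℕ → Set} → (∀ n → P n → Q n → R n) →
    Eventually P → Eventually Q → Eventually R
  eventually-map₂ f (M , p) (N , q) = M ℕ.⊔ N , λ n M⊔N≤n →
    f n (p n (ℕ.≤-trans (ℕ.m≤m⊔n M N) M⊔N≤n)) (q n (ℕ.≤-trans (ℕ.m≤n⊔m M N) M⊔N≤n))

  ≈-pointwise : ∀ {x y} → (∀ n → seq x n ≡ seq y n) → x ≈ y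
  ≈-pointwise {x} {y} eq = mk≈ λ ε 0<ε → 0 , λ n _ →
    ≡.subst (ℚ._< ε) (≡.sym (≡.cong ∣_∣ (≡.trans (≡.cong (ℚ._- seq y n) (eq n)) (ℚ.+-inverseʳ (seq y n))))) 0<ε

  ≈-refl : ∀ {x} → x ≈ x
  ≈-refl {x} = ≈-pointwise {x} {x} λ _ → ≡.refl

  ≈-sym : ∀ {x y} → x ≈ y → y ≈ x
  ≈-sym {x} {y} (mk≈ x~y) = mk≈ λ ε 0<ε → eventually-map (λ n → ≡.subst (ℚ._< ε)
    (≡.trans (≡.sym (ℚ.∣-p∣≡∣p∣ (seq x n ℚ.- seq y n)))
      (≡.cong ∣_∣ (solve 2 (λ a b → :- (a :- b) := b :- a) ≡.refl (seq x n) (seq y n))))) (x~y ε 0<ε)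

  ≈-trans : ∀ {x y z} → x ≈ y → y ≈ z → x ≈ z
  ≈-trans {x} {y} {z} (mk≈ x~y) (mk≈ y~z) = mk≈ λ ε 0<ε → eventually-map₂
    (λ n → half-sum-< (solve 3 (λ x y z → x :- z := (x :- y) :+ (y :- z)) ≡.refl (seq x n) (seq y n) (seq z n)))
    (x~y _ (0<½* 0<ε)) (y~z _ (0<½* 0<ε))

  +-cong : ∀ {x x′ y y′} → x ≈ x′ → y ≈ y′ → x + y ≈ x′ + y′
  +-cong {x} {x′} {y} {y′} (mk≈ x~x′) (mk≈ y~y′) = mk≈ λ ε 0<ε → eventually-map₂
    (λ n → half-sum-< (solve 4 (λ x x′ y y′ → x :+ y :- (x′ :+ y′) := (x :- x′) :+ (y :- y′)) ≡.refl
      (seq x n) (seq x′ n) (seq y n) (seq y′ n)))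
    (x~x′ _ (0<½* 0<ε)) (y~y′ _ (0<½* 0<ε))

  -‿cong : ∀ {x y} → x ≈ y → - x ≈ - y
  -‿cong {x} {y} (mk≈ x~y) = mk≈ λ ε 0<ε → eventually-map (λ n → ≡.subst (ℚ._< ε)
    (≡.trans (≡.sym (ℚ.∣-p∣≡∣p∣ (seq x n ℚ.- seq y n)))
      (≡.cong ∣_∣ (solve 2 (λ a b → :- (a :- b) := :- a :- :- b) ≡.refl (seq x n) (seq y n))))) (x~y ε 0<ε)

  bounded : ∀ x → ∃ λ B → 0ℚ ℚ.< B × Eventually λ n → ∣ seq x n ∣ ℚ.≤ B
  bounded x =
    let N , close = cauchy x 1ℚ (ℚ.positive⁻¹ 1ℚ)
        xN = seq x N
    in 1ℚ ℚ.+ ∣ xN ∣ , ℚ.+-mono-<-≤ (ℚ.positive⁻¹ 1ℚ) (ℚ.0≤∣p∣ xN) , N , λ n N≤n → begin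
      ∣ seq x n ∣                    ≡⟨ ≡.cong ∣_∣ (solve 2 (λ a b → a := (a :- b) :+ b) ≡.refl (seq x n) xN) ⟩
      ∣ (seq x n ℚ.- xN) ℚ.+ xN ∣    ≤⟨ ℚ.∣p+q∣≤∣p∣+∣q∣ (seq x n ℚ.- xN) xN ⟩
      ∣ seq x n ℚ.- xN ∣ ℚ.+ ∣ xN ∣  ≤⟨ ℚ.+-monoˡ-≤ ∣ xN ∣ (ℚ.<⇒≤ (close n N N≤n ℕ.≤-refl)) ⟩
      1ℚ ℚ.+ ∣ xN ∣                  ∎
    where open ℚ.≤-Reasoning

  *-congʳ : ∀ {x x′} y → x ≈ x′ → x * y ≈ x′ * y
  *-congʳ {x} {x′} y (mk≈ x~x′) = mk≈ λ ε 0<ε →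
    let B , 0<B , y≤B   = bounded y
        δ , 0<δ , δB≡ε = divide 0<B 0<ε
    in eventually-map₂ (λ n ∣x-x′∣<δ ∣y∣≤B → ≡.subst₂ (λ p q → ∣ p ∣ ℚ.< q)
         (solve 3 (λ x x′ y → (x :- x′) :* y := x :* y :- x′ :* y) ≡.refl (seq x n) (seq x′ n) (seq y n))
         δB≡ε (∣*∣-< (seq x n ℚ.- seq x′ n) (seq y n) 0<B ∣x-x′∣<δ ∣y∣≤B))
       (x~x′ δ 0<δ) y≤B

  *-comm : ∀ x y → x * y ≈ y * x
  *-comm x y = ≈-pointwise {x * y} {y * x} λ n → ℚ.*-comm (seq x n) (seq y n)

  *-cong : ∀ {x x′ y y′} → x ≈ x′ → y ≈ y′ → x * y ≈ x′ * y′
  *-cong {x} {x′} {y} {y′} x≈x′ y≈y′ = ≈-trans {x * y} {x′ * y} {x′ * y′} (*-congʳ {x} {x′} y x≈x′)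
    (≈-trans {x′ * y} {y * x′} {x′ * y′} (*-comm x′ y)
      (≈-trans {y * x′} {y′ * x′} {x′ * y′} (*-congʳ {y} {y′} x′ y≈y′) (*-comm y′ x′)))

  ℝ-commutativeRing : CommutativeRing 0ℓ 0ℓ
  ℝ-commutativeRing = record
    { Carrier = ℝ
    ; _≈_     = _≈_
    ; _+_     = _+_
    ; _*_     = _*_
    ; -_      = -_
    ; 0#      = 0ℝ
    ; 1#      = 1ℝ
    ; isCommutativeRing = record
      { isRing = record
        { +-isAbelianGroup = record
          { isGroup = record
            { isMonoid = record
              { isSemigroup = record
                { isMagma = record
                  { isEquivalence = record
                    { refl  = λ {x} → ≈-refl {x}
                    ; sym   = λ {x} {y} → ≈-sym {x} {y}
                    ; trans = λ {x} {y} {z} → ≈-trans {x} {y} {z}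
                    }
                  ; ∙-cong = λ {x} {x′} {y} {y′} → +-cong {x} {x′} {y} {y′}
                  }
                ; assoc = λ x y z → ≈-pointwise {(x + y) + z} {x + (y + z)} λ n → ℚ.+-assoc (seq x n) (seq y n) (seq z n)
                }
              ; identity = (λ x → ≈-pointwise {0ℝ + x} {x} λ n → ℚ.+-identityˡ (seq x n))
                         , (λ x → ≈-pointwise {x + 0ℝ} {x} λ n → ℚ.+-identityʳ (seq x n))
              }
            ; inverse = (λ x → ≈-pointwise { - x + x} {0ℝ} λ n → ℚ.+-inverseˡ (seq x n))
                      , (λ x → ≈-pointwise {x + - x} {0ℝ} λ n → ℚ.+-inverseʳ (seq x n))
            ; ⁻¹-cong = λ {x} {y} → -‿cong {x} {y}
            }
          ; comm = λ x y → ≈-pointwise {x + y} {y + x} λ n → ℚ.+-comm (seq x n) (seq y n)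
          }
        ; *-cong     = λ {x} {x′} {y} {y′} → *-cong {x} {x′} {y} {y′}
        ; *-assoc    = λ x y z → ≈-pointwise {(x * y) * z} {x * (y * z)} λ n → ℚ.*-assoc (seq x n) (seq y n) (seq z n)
        ; *-identity = (λ x → ≈-pointwise {1ℝ * x} {x} λ n → ℚ.*-identityˡ (seq x n))
                     , (λ x → ≈-pointwise {x * 1ℝ} {x} λ n → ℚ.*-identityʳ (seq x n))
        ; distrib    = (λ x y z → ≈-pointwise {x * (y + z)} {x * y + x * z} λ n → ℚ.*-distribˡ-+ (seq x n) (seq y n) (seq z n))
                     , (λ x y z → ≈-pointwise {(y + z) * x} {y * x + z * x} λ n → ℚ.*-distribʳ-+ (seq x n) (seq y n) (seq z n))
        }
      ; *-comm = *-comm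
      }
    }

  <-resp-≈ : ∀ {x x′ y y′} → x ≈ x′ → y ≈ y′ → x < y → x′ < y′
  <-resp-≈ {x} {x′} {y} {y′} (mk≈ x~x′) (mk≈ y~y′) (mk< g 0<g x+g≤y) with quarter 0<g
  -- Of the gap `4k`, each of the two replacements costs at most `k`.
  ... | k , 0<k , ≡.refl = mk< (k ℚ.+ k) (ℚ.+-mono-< 0<k 0<k) (eventually-map₂
      (λ n x+g≤y (x~x′ , y~y′) → shift-≤
        (ℚ.+-mono-≤ x+g≤y (ℚ.+-mono-≤ (ℚ.<⇒≤ (∣p∣<q⇒-p<q x~x′)) (ℚ.<⇒≤ (∣p∣<q⇒p<q y~y′))))
        (solve 5 (λ x x′ y y′ k → (y :+ (k :+ k)) :- (x :+ (k :+ k :+ k :+ k) :+ (:- (x :- x′) :+ (y :- y′))) :=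
          y′ :- (x′ :+ (k :+ k))) ≡.refl (seq x n) (seq x′ n) (seq y n) (seq y′ n) k))
      x+g≤y (eventually-map₂ (λ _ → _,_) (x~x′ k 0<k) (y~y′ k 0<k)))

  <-asym : ∀ {x y} → x < y → ¬ y < x
  <-asym {x} {y} (mk< g 0<g (M , x+g≤y)) (mk< h 0<h (N , y+h≤x)) = ℚ.<-irrefl ≡.refl
    (ℚ.<-≤-trans (ℚ.+-mono-< 0<g 0<h) (shift-≤
      (ℚ.+-mono-≤ (x+g≤y n (ℕ.m≤m⊔n M N)) (y+h≤x n (ℕ.m≤n⊔m M N)))
      (solve 4 (λ x y g h → (y :+ x) :- (x :+ g :+ (y :+ h)) := con 0ℚ :- (g :+ h)) ≡.refl (seq x n) (seq y n) g h)))
    where n = M ℕ.⊔ N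

  -- One rational approximation decides: with `ε = 4δ` and precision `δ`, comparing it with `2δ`
  -- leaves a gap of `δ` in either case.
  positive-or-small : ∀ x {ε} → 0ℚ ℚ.< ε → 0ℝ < x ⊎ x < fromℚ ε
  positive-or-small x 0<ε with quarter 0<ε
  ... | δ , 0<δ , ≡.refl with cauchy x δ 0<δ
  ... | N , close with ℚ.≤-total (δ ℚ.+ δ) (seq x N)
  ... | inj₁ 2δ≤x = inj₁ (mk< δ 0<δ (N , λ n N≤n → shift-≤
          (ℚ.+-mono-≤ 2δ≤x (ℚ.<⇒≤ (∣p∣<q⇒-p<q (close n N N≤n ℕ.≤-refl))))
          (solve 3 (λ δ x xN → (xN :+ δ) :- (δ :+ δ :+ :- (x :- xN)) := x :- (con 0ℚ :+ δ)) ≡.refl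
            δ (seq x n) (seq x N))))
  ... | inj₂ x≤2δ = inj₂ (mk< δ 0<δ (N , λ n N≤n → shift-≤
          (ℚ.+-mono-≤ x≤2δ (ℚ.<⇒≤ (∣p∣<q⇒p<q (close n N N≤n ℕ.≤-refl))))
          (solve 3 (λ δ x xN → (δ :+ δ :+ δ) :- (xN :+ (x :- xN)) := (δ :+ δ :+ δ :+ δ) :- (x :+ δ)) ≡.refl
            δ (seq x n) (seq x N))))

  <-cotrans : ∀ {x y} → x < y → ∀ z → x < z ⊎ z < y
  -- The threshold is the gap itself: `z - x` below `g` places `z` below `y`.
  <-cotrans {x} {y} (mk< g 0<g x+g≤y) z with positive-or-small (z - x) 0<g
  ... | inj₁ (mk< h 0<h separated) = inj₁ (mk< h 0<h (eventually-map (λ n 0+h≤z-x → shift-≤ 0+h≤z-x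
          (solve 3 (λ x z h → (z :- x) :- (con 0ℚ :+ h) := z :- (x :+ h)) ≡.refl (seq x n) (seq z n) h)) separated))
  ... | inj₂ (mk< h 0<h separated) = inj₂ (mk< h 0<h (eventually-map₂ (λ n x+g≤y z-x+h≤g → shift-≤
          (ℚ.+-mono-≤ x+g≤y z-x+h≤g)
          (solve 5 (λ x y z g h → (y :+ g) :- (x :+ g :+ (z :- x :+ h)) := y :- (z :+ h)) ≡.refl
            (seq x n) (seq y n) (seq z n) g h)) x+g≤y separated))

  -- For each `ε`, `positive-or-small` applied to a difference either contradicts a hypothesis or
  -- bounds the difference eventually by `ε`, so a modulus is obtained from two negations.
  tight : ∀ {x y} → ¬ x < y → ¬ y < x → x ≈ y
  tight {x} {y} x≮y y≮x = mk≈ λ ε 0<ε → eventually-map₂ (λ n → ∣p∣<q)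
    (bound x y y≮x ε 0<ε)
    (eventually-map (λ n → ≡.subst (ℚ._< ε) (solve 2 (λ x y → y :- x := :- (x :- y)) ≡.refl (seq x n) (seq y n)))
      (bound y x x≮y ε 0<ε))
    where
    bound : ∀ x y → ¬ y < x → ∀ ε → 0ℚ ℚ.< ε → Eventually λ n → seq x n ℚ.- seq y n ℚ.< ε
    bound x y y≮x ε 0<ε with positive-or-small (x - y) 0<ε
    ... | inj₂ (mk< h 0<h separated) = eventually-map (λ n x-y+h≤ε → shift-<
            (ℚ.+-mono-<-≤ 0<h x-y+h≤ε)
            (solve 4 (λ x y h ε → (h :+ ε) :- (con 0ℚ :+ (x :- y :+ h)) := ε :- (x :- y)) ≡.refl (seq x n) (seq y n) h ε))
            separated
    ... | inj₁ (mk< h 0<h separated) = contradiction (mk< h 0<h (eventually-map (λ n 0+h≤x-y → shift-≤ 0+h≤x-y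
            (solve 3 (λ x y h → (x :- y) :- (con 0ℚ :+ h) := x :- (y :+ h)) ≡.refl (seq x n) (seq y n) h)) separated)) y≮x

  +-monoˡ-< : ∀ {x y} z → x < y → x + z < y + z
  +-monoˡ-< {x} {y} z (mk< g 0<g separated) = mk< g 0<g (eventually-map (λ n x+g≤y → shift-≤ x+g≤y
    (solve 4 (λ x y z g → y :- (x :+ g) := (y :+ z) :- (x :+ z :+ g)) ≡.refl (seq x n) (seq y n) (seq z n) g)) separated)

  *-pos : ∀ {x y} → 0ℝ < x → 0ℝ < y → 0ℝ < x * y
  *-pos {x} {y} (mk< g 0<g 0+g≤x) (mk< h 0<h 0+h≤y) = mk< (g ℚ.* h) (0<* 0<g 0<h) (eventually-map₂
    (λ n 0+g≤x 0+h≤y → begin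
      0ℚ ℚ.+ g ℚ.* h           ≡⟨ ℚ.+-identityˡ _ ⟩
      g ℚ.* h                  ≤⟨ ℚ.*-monoˡ-≤-nonNeg g {{ℚ.nonNegative (ℚ.<⇒≤ 0<g)}} (≡.subst (ℚ._≤ seq y n) (ℚ.+-identityˡ h) 0+h≤y) ⟩
      g ℚ.* seq y n            ≤⟨ ℚ.*-monoʳ-≤-nonNeg (seq y n)
        {{ℚ.nonNegative (ℚ.≤-trans (ℚ.<⇒≤ 0<h) (≡.subst (ℚ._≤ seq y n) (ℚ.+-identityˡ h) 0+h≤y))}}
        (≡.subst (ℚ._≤ seq x n) (ℚ.+-identityˡ g) 0+g≤x) ⟩
      seq x n ℚ.* seq y n      ∎) 0+g≤x 0+h≤y)
    where open ℚ.≤-Reasoning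

  -- The inverse sequence is capped at 1/g, where g > 0 eventually bounds
  -- x from below, so that it is defined from the first index on.
  inverse : ∀ {x} → 0ℝ < x → ∃ λ y → 0ℝ < y × x * y ≈ 1ℝ
  inverse {x} (mk< g 0<g (N , 0+g≤x)) = mkℝ r r-cauchy , 0<y , mk≈ λ ε 0<ε → N , λ n N≤n →
    ≡.subst (ℚ._< ε) (≡.sym (≡.cong ∣_∣ (≡.trans (≡.cong (ℚ._- 1ℚ) (≡.trans
      (≡.cong (ℚ._* r n) (≡.sym (m≡x n N≤n))) (mr≡1 n))) (ℚ.+-inverseʳ 1ℚ)))) 0<ε
    where
    open ℚ.≤-Reasoning

    m : ℕ → ℚ
    m n = g ℚ.⊔ seq x n

    0<m : ∀ n → 0ℚ ℚ.< m n
    0<m n = ℚ.<-≤-trans 0<g (ℚ.p≤p⊔q g (seq x n))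

    m≡x : ∀ n → N ℕ.≤ n → m n ≡ seq x n
    m≡x n N≤n = ℚ.p≤q⇒p⊔q≡q (≡.subst (ℚ._≤ seq x n) (ℚ.+-identityˡ g) (0+g≤x n N≤n))

    r : ℕ → ℚ
    r n = proj₁ (positive-reciprocal (0<m n))

    0<r : ∀ n → 0ℚ ℚ.< r n
    0<r n = proj₁ (proj₂ (positive-reciprocal (0<m n)))

    mr≡1 : ∀ n → m n ℚ.* r n ≡ 1ℚ
    mr≡1 n = proj₂ (proj₂ (positive-reciprocal (0<m n)))

    G : ℚ
    G = proj₁ (positive-reciprocal 0<g)

    0<G : 0ℚ ℚ.< G
    0<G = proj₁ (proj₂ (positive-reciprocal 0<g))

    gG≡1 : g ℚ.* G ≡ 1ℚ
    gG≡1 = proj₂ (proj₂ (positive-reciprocal 0<g))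

    r≤G : ∀ n → r n ℚ.≤ G
    r≤G n = begin
      r n                    ≡⟨ ℚ.*-identityˡ (r n) ⟨
      1ℚ ℚ.* r n             ≡⟨ ≡.cong (ℚ._* r n) gG≡1 ⟨
      g ℚ.* G ℚ.* r n        ≡⟨ ℚ.*-assoc g G (r n) ⟩
      g ℚ.* (G ℚ.* r n)      ≤⟨ ℚ.*-monoʳ-≤-nonNeg (G ℚ.* r n) {{ℚ.nonNegative (ℚ.<⇒≤ (0<* 0<G (0<r n)))}} (ℚ.p≤p⊔q g (seq x n)) ⟩
      m n ℚ.* (G ℚ.* r n)    ≡⟨ solve 3 (λ m G r → m :* (G :* r) := m :* r :* G) ≡.refl (m n) G (r n) ⟩
      m n ℚ.* r n ℚ.* G      ≡⟨ ≡.cong (ℚ._* G) (mr≡1 n) ⟩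
      1ℚ ℚ.* G               ≡⟨ ℚ.*-identityˡ G ⟩
      G                      ∎

    ∣rr∣≤GG : ∀ i j → ∣ r i ℚ.* r j ∣ ℚ.≤ G ℚ.* G
    ∣rr∣≤GG i j = begin
      ∣ r i ℚ.* r j ∣  ≡⟨ ℚ.0≤p⇒∣p∣≡p (ℚ.<⇒≤ (0<* (0<r i) (0<r j))) ⟩
      r i ℚ.* r j      ≤⟨ ℚ.*-monoˡ-≤-nonNeg (r i) {{ℚ.nonNegative (ℚ.<⇒≤ (0<r i))}} (r≤G j) ⟩
      r i ℚ.* G        ≤⟨ ℚ.*-monoʳ-≤-nonNeg G {{ℚ.nonNegative (ℚ.<⇒≤ 0<G)}} (r≤G i) ⟩
      G ℚ.* G          ∎

    -- The identity `1/a - 1/b = (b - a)/(a b)`, through which the Cauchy property of `m` passes to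
    -- `r`.
    r-difference : ∀ i j → r i ℚ.- r j ≡ (m j ℚ.- m i) ℚ.* (r i ℚ.* r j)
    r-difference i j = ≡.trans
      (≡.cong₂ ℚ._-_
        (≡.trans (≡.sym (ℚ.*-identityʳ (r i))) (≡.cong (r i ℚ.*_) (≡.sym (mr≡1 j))))
        (≡.trans (≡.sym (ℚ.*-identityʳ (r j))) (≡.cong (r j ℚ.*_) (≡.sym (mr≡1 i)))))
      (solve 4 (λ a b c d → c :* (b :* d) :- d :* (a :* c) := (b :- a) :* (c :* d)) ≡.refl (m i) (m j) (r i) (r j))

    r-cauchy : Cauchy r
    r-cauchy ε 0<ε =
      let 0<GG           = 0<* 0<G 0<G
          δ , 0<δ , eq   = divide 0<GG 0<ε
          M , close      = cauchy x δ 0<δ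
      in N ℕ.⊔ M , λ i j p q → ≡.subst₂ (λ a b → ∣ a ∣ ℚ.< b) (≡.sym (r-difference i j)) eq
           (∣*∣-< (m j ℚ.- m i) (r i ℚ.* r j) 0<GG
             (≡.subst₂ (λ a b → ∣ a ℚ.- b ∣ ℚ.< δ)
               (≡.sym (m≡x j (ℕ.≤-trans (ℕ.m≤m⊔n N M) q))) (≡.sym (m≡x i (ℕ.≤-trans (ℕ.m≤m⊔n N M) p)))
               (close j i (ℕ.≤-trans (ℕ.m≤n⊔m N M) q) (ℕ.≤-trans (ℕ.m≤n⊔m N M) p)))
             (∣rr∣≤GG i j))

    0<y : 0ℝ < mkℝ r r-cauchy
    0<y =
      -- The gap below the inverse is the reciprocal of an upper bound for `x`.
      let B , 0<B , ∣x∣≤B = bounded x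
          b , 0<b , Bb≡1  = positive-reciprocal 0<B
      in mk< b 0<b (eventually-map₂ (λ n N≤n ∣x∣≤B → begin
           0ℚ ℚ.+ b                 ≡⟨ solve 1 (λ b → con 0ℚ :+ b := con 1ℚ :* b) ≡.refl b ⟩
           1ℚ ℚ.* b                 ≡⟨ ≡.cong (ℚ._* b) (mr≡1 n) ⟨
           m n ℚ.* r n ℚ.* b        ≡⟨ ℚ.*-assoc (m n) (r n) b ⟩
           m n ℚ.* (r n ℚ.* b)      ≤⟨ ℚ.*-monoʳ-≤-nonNeg (r n ℚ.* b) {{ℚ.nonNegative (ℚ.<⇒≤ (0<* (0<r n) 0<b))}}
             (≡.subst (ℚ._≤ B) (≡.sym (m≡x n N≤n)) (ℚ.≤-trans (p≤∣p∣ (seq x n)) ∣x∣≤B)) ⟩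
           B ℚ.* (r n ℚ.* b)        ≡⟨ solve 3 (λ B r b → B :* (r :* b) := r :* (B :* b)) ≡.refl B (r n) b ⟩
           r n ℚ.* (B ℚ.* b)        ≡⟨ ≡.cong (r n ℚ.*_) Bb≡1 ⟩
           r n ℚ.* 1ℚ               ≡⟨ ℚ.*-identityʳ (r n) ⟩
           r n                      ∎) (N , λ _ N≤n → N≤n) ∣x∣≤B)

ℝ-orderedField : OrderedField
ℝ-orderedField = record
  { commutativeRing = ℝ-commutativeRing
  ; fromℚ           = record
    { ⟦_⟧    = fromℚ
    ; +-homo = λ p q → ≈-pointwise {fromℚ (p ℚ.+ q)} {fromℚ p + fromℚ q} λ _ → ≡.refl
    ; *-homo = λ p q → ≈-pointwise {fromℚ (p ℚ.* q)} {fromℚ p * fromℚ q} λ _ → ≡.refl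
    ; -‿homo = λ p → ≈-pointwise {fromℚ (ℚ.- p)} { - fromℚ p} λ _ → ≡.refl
    ; 0-homo = ≈-refl {0ℝ}
    ; 1-homo = ≈-refl {1ℝ}
    }
  ; _<_             = _<_
  ; <-resp-≈        = λ {x} {x′} {y} {y′} → <-resp-≈ {x} {x′} {y} {y′}
  ; <-asym          = λ {x} {y} → <-asym {x} {y}
  ; <-cotrans       = λ {x} {y} → <-cotrans {x} {y}
  ; tight           = λ {x} {y} → tight {x} {y}
  ; 0<1             = mk< 1ℚ (ℚ.positive⁻¹ 1ℚ) (0 , λ _ _ → ℚ.≤-refl)
  ; +-monoˡ-<       = λ {x} {y} → +-monoˡ-< {x} {y}
  ; *-pos           = λ {x} {y} → *-pos {x} {y}
  ; inverse         = λ {x} → inverse {x}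
  }

-- Agreement with the sums and determinants of the statement

private
  module 𝔽 = OrderedField ℝ-orderedField
  module 𝕃 = LinearAlgebra ℝ-orderedField

∑≈sum : ∀ {n} (f : Vector ℝ n) → 𝕃.∑ f ≈ sum f
∑≈sum {zero}  f = 𝕃.∑-empty f
∑≈sum {suc n} f = 𝔽.trans {𝕃.∑ f} {f zero + 𝕃.∑ (f ∘ suc)} {sum f}
  (𝕃.∑-suc f) (𝔽.+-congˡ {f zero} {𝕃.∑ (f ∘ suc)} {sum (f ∘ suc)} (∑≈sum (f ∘ suc)))

det≈det : ∀ {n} (M : Matrix n) → 𝕃.det M ≈ det M
det≈det {zero}  M = 𝕃.det-empty M
det≈det {suc n} M = 𝔽.trans {𝕃.det M} {𝕃.∑ term′} {det M} (𝕃.det-suc M)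
  (𝔽.trans {𝕃.∑ term′} {𝕃.∑ term} {det M} (𝕃.∑-cong {f = term′} {g = term} λ j →
    𝔽.*-congˡ {(- 1ℝ) ^ toℕ j} {M zero j * 𝕃.det (minor j)} {M zero j * det (minor j)}
      (𝔽.*-congˡ {M zero j} {𝕃.det (minor j)} {det (minor j)} (det≈det (minor j))))
    (∑≈sum term))
  where
  minor : Fin (suc n) → Matrix n
  minor j i k = M (suc i) (punchIn j k)

  term term′ : Vector ℝ (suc n)
  term  j = (- 1ℝ) ^ toℕ j * (M zero j * det (minor j))
  term′ j = (- 1ℝ) ^ toℕ j * (M zero j * 𝕃.det (minor j))

-- Adjacency matrices

indicator : ∀ {P : Set} → Dec P → ℝ
indicator P? = if does P? then 1ℝ else 0ℝ

indicator-yes : ∀ {P : Set} (P? : Dec P) → P → indicator P? ≡ 1ℝ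
indicator-yes P? p = ≡.cong (if_then 1ℝ else 0ℝ) (dec-true P? p)

indicator-no : ∀ {P : Set} (P? : Dec P) → ¬ P → indicator P? ≡ 0ℝ
indicator-no P? ¬p = ≡.cong (if_then 1ℝ else 0ℝ) (dec-false P? ¬p)

-- `adj?` gives separate decisions at `i j` and at `j i`, so their values are compared through
-- `adj-sym`.
adjacencyMatrix-sym : ∀ {n} (G : SimpleGraph n) i j → adjacencyMatrix G i j ≡ adjacencyMatrix G j i
adjacencyMatrix-sym G i j with adj? G j i
... | yes ji = indicator-yes (adj? G i j) (adj-sym G ji)
... | no ¬ji = indicator-no (adj? G i j) (¬ji ∘ adj-sym G)

adjacencyMatrix-nonneg : ∀ {n} (G : SimpleGraph n) i j → 0ℝ ≤ adjacencyMatrix G i j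
adjacencyMatrix-nonneg G i j with adj? G i j
... | yes _ = 𝕃.<⇒≤ {0ℝ} {1ℝ} 𝔽.0<1
... | no  _ = 𝕃.≤-reflexive {0ℝ} {0ℝ} (𝔽.refl {0ℝ})

adjacencyMatrix-deleteEdge : ∀ {n} (G : SimpleGraph n) u v → Adj G u v → ∀ i j →
  adjacencyMatrix G i j ≈ adjacencyMatrix (deleteEdge G u v) i j + 𝕃.edgeMatrix u v i j
adjacencyMatrix-deleteEdge G u v uv i j = cases (sameEdge? u v i j)
  where
  A B : ℝ
  A = adjacencyMatrix G i j
  B = adjacencyMatrix (deleteEdge G u v) i j

  u≢v : u ≢ v
  u≢v ≡.refl = loopless G u uv

  sum-≈ : ∀ {a b e} → A ≈ a → B ≈ b → 𝕃.edgeMatrix u v i j ≈ e → a ≈ b + e → A ≈ B + 𝕃.edgeMatrix u v i j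
  sum-≈ {a} {b} {e} A≈a B≈b E≈e eq = 𝔽.trans {A} {a} {B + E} A≈a (𝔽.trans {a} {b + e} {B + E} eq
    (𝔽.sym {B + E} {b + e} (𝔽.+-cong {B} {b} {E} {e} B≈b E≈e)))
    where E = 𝕃.edgeMatrix u v i j

  present : Adj G i j → A ≈ 1ℝ
  present ij = 𝔽.reflexive {A} {1ℝ} (indicator-yes (adj? G i j) ij)

  deleted : SameEdge u v i j → B ≈ 0ℝ
  deleted same = 𝔽.reflexive {B} {0ℝ} (indicator-no (adj? (deleteEdge G u v) i j) λ (_ , ¬same) → ¬same same)

  cases : Dec (SameEdge u v i j) → A ≈ B + 𝕃.edgeMatrix u v i j
  cases (yes same@(inj₁ (≡.refl , ≡.refl))) =
    sum-≈ {1ℝ} {0ℝ} {1ℝ} (present uv) (deleted same) (𝕃.edgeMatrix-edge u≢v) (𝔽.sym {0ℝ + 1ℝ} {1ℝ} (𝔽.+-identityˡ 1ℝ))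
  cases (yes same@(inj₂ (≡.refl , ≡.refl))) =
    sum-≈ {1ℝ} {0ℝ} {1ℝ} (present (adj-sym G uv)) (deleted same)
      (𝔽.trans {𝕃.edgeMatrix u v v u} {𝕃.edgeMatrix u v u v} {1ℝ} (𝕃.edgeMatrix-sym u v v u) (𝕃.edgeMatrix-edge u≢v))
      (𝔽.sym {0ℝ + 1ℝ} {1ℝ} (𝔽.+-identityˡ 1ℝ))
  cases (no ¬same) = sum-≈ {A} {A} {0ℝ} (𝔽.refl {A}) (𝔽.reflexive {B} {A} B≡A)
    (𝕃.edgeMatrix-other (λ (u≡i , v≡j) → ¬same (inj₁ (≡.sym u≡i , ≡.sym v≡j)))
                        (λ (v≡i , u≡j) → ¬same (inj₂ (≡.sym v≡i , ≡.sym u≡j))))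
    (𝔽.sym {A + 0ℝ} {A} (𝔽.+-identityʳ A))
    where
    B≡A : B ≡ A
    B≡A with adj? G i j
    -- For adjacent `i` and `j`, the decision after deletion reduces to the negation of `sameEdge?`.
    ... | yes _ = ≡.cong (λ same → if not same then 1ℝ else 0ℝ) (dec-false (sameEdge? u v i j) ¬same)
    ... | no  _  = ≡.refl

theorem2p3 : ∀ {n} (G : SimpleGraph n) (λ₂ : ℝ) (z : Vector ℝ n) →
    IsKthEigenvalue 2 (adjacencyMatrix G) λ₂ →
    IsEigenvector (adjacencyMatrix G) λ₂ z →
    ∀ (u v : Fin n) → u ∈ V₊ z → v ∈ V₋ z → Adj G u v →
    ∀ (λ₂′ : ℝ) → IsKthEigenvalue 2 (adjacencyMatrix (deleteEdge G u v)) λ₂′ →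
    λ₂ < λ₂′
-- The equation `suc (toℕ i) ≡ 2` leaves only the index `suc zero`, which also makes the number of
-- vertices a successor.
theorem2p3 G λ₂ z _ eigen u v z∈V₊ z∈V₋ uv λ₂′ (Λ , spectrum , suc zero , ≡.refl , λ₂′≈Λ₁) =
  𝕃.second-eigenvalue-> A B u v (adjacencyMatrix-deleteEdge G u v uv)
    (λ i j → 𝔽.reflexive {B i j} {B j i} (adjacencyMatrix-sym (deleteEdge G u v) i j))
    (adjacencyMatrix-nonneg (deleteEdge G u v))
    λ₂ z
    (λ i → 𝔽.trans {(A 𝕃.· z) i} {(A · z) i} {λ₂ * z i} (∑≈sum λ j → A i j * z j) (IsEigenvector.scales eigen i))
    z∈V₊ z∈V₋ {Λ}
    (λ t → 𝔽.trans {𝕃.charPoly B t} {charPoly B t} {product λ i → t - Λ i}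
      (det≈det λ i j → t * identity i j - B i j) (IsSpectrum.splits spectrum t))
    {λ₂′}
    (λ i → 𝕃.≤-resp-≈ {Λ (suc i)} {Λ (suc i)} {Λ (suc zero)} {λ₂′} (𝔽.refl {Λ (suc i)})
      (𝔽.sym {λ₂′} {Λ (suc zero)} λ₂′≈Λ₁)
      (IsSpectrum.nonIncreasing spectrum (suc zero) (suc i) (ℕ.s≤s ℕ.z≤n)))
  where
  A = adjacencyMatrix G
  B = adjacencyMatrix (deleteEdge G u v)
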